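{- Let $d\geq 2$ be a fixed integer. As $n\to\infty$, the number of permutations in $\mathfrak{S}(dn)$ with no decreasing subsequence of length $d+1$ is asymptotically equal (ratio tending to $1$) to the number of involutions in $\mathfrak{S}(2dn)$ whose longest decreasing subsequence has length exactly $d$ and whose longest increasing subsequence has length exactly $2n$.
   Context: $\mathfrak{S}(m)$ denotes the symmetric group on $\{1,\dots,m\}$, with permutations viewed as words $\sigma(1)\sigma(2)\cdots\sigma(m)$ for the purpose of increasing/decreasing subsequences. An involution is a permutation $\sigma$ with $\sigma^2=\mathrm{id}$. -}

module Defs where

open import Data.Nat as ℕ using (ℕ; zero; suc; _+_)
open import Data.Fin using (Fin; _<_; _<?_; _≟_)
open import Data.Fin.Properties using (all?)
open import Data.Fin.Subset using (Subset; _∈_; ∣_∣)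
open import Data.Fin.Subset.Properties using (_∈?_; anySubset?)
open import Data.Vec.Functional using (_∷_)
open import Data.List using (List; map; allFin)
open import Data.Nat.ListAction using (sum)
open import Level using (0ℓ)
open import Data.Product using (Σ; ∃; _×_; _,_)
open import Data.Bool using (if_then_else_)
open import Relation.Nullary using (Dec; does; ¬_; ¬?; _×-dec_; _→-dec_)
open import Relation.Unary using (Pred; Decidable)
open import Relation.Binary.PropositionalEquality using (_≡_)

Word : ℕ → Set
Word m = Fin m → Fin m

IsPerm : ∀ {m} → Word m → Set
IsPerm {m} σ = ∀ (i j : Fin m) → σ i ≡ σ j → i ≡ j

IsInvolution : ∀ {m} → Word m → Set
IsInvolution {m} σ = ∀ (i : Fin m) → σ (σ i) ≡ i

DecreasingOn : ∀ {m} → Word m → Subset m → Set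
DecreasingOn {m} σ s = ∀ (i j : Fin m) → i ∈ s → j ∈ s → i < j → σ j < σ i

IncreasingOn : ∀ {m} → Word m → Subset m → Set
IncreasingOn {m} σ s = ∀ (i j : Fin m) → i ∈ s → j ∈ s → i < j → σ i < σ j

HasDecSub : ∀ {m} → ℕ → Word m → Set
HasDecSub {m} k σ = ∃ λ (s : Subset m) → ∣ s ∣ ≡ k × DecreasingOn σ s

HasIncSub : ∀ {m} → ℕ → Word m → Set
HasIncSub {m} k σ = ∃ λ (s : Subset m) → ∣ s ∣ ≡ k × IncreasingOn σ s

LDSis : ∀ {m} → ℕ → Word m → Set
LDSis k σ = HasDecSub k σ × ¬ HasDecSub (suc k) σ

LISis : ∀ {m} → ℕ → Word m → Set
LISis k σ = HasIncSub k σ × ¬ HasIncSub (suc k) σ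

decreasingOn? : ∀ {m} (σ : Word m) (s : Subset m) → Dec (DecreasingOn σ s)
decreasingOn? σ s = all? λ i → all? λ j →
  (i ∈? s) →-dec (j ∈? s) →-dec (i <? j) →-dec (σ j <? σ i)

increasingOn? : ∀ {m} (σ : Word m) (s : Subset m) → Dec (IncreasingOn σ s)
increasingOn? σ s = all? λ i → all? λ j →
  (i ∈? s) →-dec (j ∈? s) →-dec (i <? j) →-dec (σ i <? σ j)

hasDecSub? : ∀ {m} k (σ : Word m) → Dec (HasDecSub k σ)
hasDecSub? k σ = anySubset? λ s → (∣ s ∣ ℕ.≟ k) ×-dec decreasingOn? σ s

hasIncSub? : ∀ {m} k (σ : Word m) → Dec (HasIncSub k σ)
hasIncSub? k σ = anySubset? λ s → (∣ s ∣ ℕ.≟ k) ×-dec increasingOn? σ s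

isPerm? : ∀ {m} (σ : Word m) → Dec (IsPerm σ)
isPerm? σ = all? λ i → all? λ j → (σ i ≟ σ j) →-dec (i ≟ j)

isInvolution? : ∀ {m} (σ : Word m) → Dec (IsInvolution σ)
isInvolution? σ = all? λ i → σ (σ i) ≟ i

count : ∀ m k {P : Pred (Fin m → Fin k) 0ℓ} → Decidable P → ℕ
count zero    k P? = if does (P? (λ ())) then 1 else 0
count (suc m) k P? = sum (map (λ x → count m k (λ f → P? (x ∷ f))) (allFin k))

AvoidDec : ℕ → ∀ {m} → Word m → Set
AvoidDec d σ = IsPerm σ × ¬ HasDecSub (suc d) σ

avoidDec? : ∀ d {m} (σ : Word m) → Dec (AvoidDec d σ)
avoidDec? d σ = isPerm? σ ×-dec ¬? (hasDecSub? (suc d) σ)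

InvLDSLIS : ℕ → ℕ → ∀ {m} → Word m → Set
InvLDSLIS d l σ = IsPerm σ × IsInvolution σ × LDSis d σ × LISis l σ

invLDSLIS? : ∀ d l {m} (σ : Word m) → Dec (InvLDSLIS d l σ)
invLDSLIS? d l σ = isPerm? σ ×-dec isInvolution? σ
  ×-dec (hasDecSub? d σ ×-dec ¬? (hasDecSub? (suc d) σ))
  ×-dec (hasIncSub? l σ ×-dec ¬? (hasIncSub? (suc l) σ))

numAvoid : ℕ → ℕ → ℕ
numAvoid d m = count m m (avoidDec? d)

numInv : ℕ → ℕ → ℕ → ℕ
numInv d l m = count m m (invLDSLIS? d l)

module Submission where

open import Defs
open import Level using (0ℓ)
open import Data.Nat using (ℕ; zero; suc; _+_; _*_; _∸_; _^_; _!; _⊔_; _≤_; _<_; z≤n; s≤s; s≤s⁻¹; z<s; s<s; s<s⁻¹; ∣_-_∣; _≟_; _<?_; _≤?_; NonZero; >-nonZero; >-nonZero⁻¹)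
open import Data.Nat.Properties
open import Data.Nat.ListAction using (sum; product)
open import Data.Nat.Tactic.RingSolver using (solve-∀)
open import Algebra.Properties.CommutativeSemigroup *-commutativeSemigroup using (x∙yz≈y∙xz)
open import Data.Bool using (Bool; true; false; if_then_else_)
open import Data.Empty using ()
open import Data.Unit using (⊤; tt)
open import Data.Maybe using (Maybe; just; nothing)
open import Data.Maybe.Properties using (just-injective)
open import Data.Product using (Σ; ∃; ∃₂; _×_; _,_; proj₁; proj₂)
open import Data.Sum using (_⊎_; inj₁; inj₂; [_,_]′)
open import Data.Fin as Fin using (Fin; toℕ; fromℕ<)
import Data.Fin.Properties as Finₚ
open import Data.Fin.Subset as Subset using (Subset; inside; outside)
import Data.Fin.Subset.Properties as Subsetₚ
open import Data.Vec as Vec using (Vec)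
import Data.Vec.Functional as F
open import Data.List using (List; []; _∷_; _++_; map; length; concatMap; filter; upTo; applyUpTo; allFin; tabulate; replicate)
open import Data.List.Properties using (length-++; length-map; length-tabulate; ≡-dec; ∷-injective; ∷-injectiveˡ; ∷-injectiveʳ; filter-accept; filter-reject; map-∘; map-id; map-concatMap; concatMap-map; length-upTo; map-upTo; map-injective)
open import Data.List.Relation.Unary.Any as Any using (Any; here; there)
open import Data.List.Relation.Unary.All as All using (All; []; _∷_)
import Data.List.Relation.Unary.All.Properties as Allₚ
open import Data.List.Relation.Unary.AllPairs using ([]; _∷_)
open import Data.List.Relation.Unary.Unique.Propositional using (Unique)
import Data.List.Relation.Unary.Unique.Propositional.Properties as Uniqueₚ
open import Data.List.Membership.Propositional using (_∈_; _∉_; find; lose)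
open import Data.List.Membership.Propositional.Properties using (∈-∃++; ∈-++⁺ˡ; ∈-++⁺ʳ; ∈-++⁻; ∈-map⁺; ∈-map⁻; ∈-filter⁺; ∈-filter⁻; ∈-concatMap⁺; ∈-concatMap⁻; ∈-allFin; ∈-upTo⁺; ∈-upTo⁻)
open import Function using (_∘_; id)
open import Relation.Nullary using (Dec; yes; no; does; ¬_; _×-dec_; contradiction)
open import Relation.Nullary.Decidable using (dec-true; dec-false)
open import Relation.Unary using (Pred; Decidable)
open import Relation.Binary using (tri<; tri≈; tri>)
open import Relation.Binary.PropositionalEquality using (_≡_; _≢_; _≗_; refl; sym; trans; cong; cong₂; subst; subst₂; module ≡-Reasoning)

-- Both counts are sums over the shapes λ ⊢ dn with at most d columns. By Robinson-Schensted (in the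
-- form of Fomin's growth diagrams) the first is Σ f(λ)², where f counts standard tableaux. The
-- involutions are extremal for Erdős-Szekeres, so they correspond to standard tableaux of the
-- rectangle 2n × d; cutting such a tableau in the middle gives Σ f(λ) g(λ), where g counts the
-- tableaux of the complement of λ in the rectangle. With l the strictly decreasing sequence
-- attached to λ and M = 2n + d - 1, the Frobenius formula gives f(l) = (dn)! Δ(l) / ∏ lᵢ! and
-- g(l) = (dn)! Δ(l) / ∏ (M - lᵢ)!, with the same Vandermonde product Δ. For lᵢ within n^(3/5) of n the
-- two agree up to a factor tending to 1, because Σ lᵢ = Σ (M - lᵢ) kills the linear term of
-- log (M - l)! / l!; the other l contribute an exponentially small proportion.

-- No asymptotics of either sum is computed. The shapes far from the centre are measured against one
-- explicit shape, the rectangle with `d` rows of length `n`: its term f g is part of the second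
-- sum. As the number of shapes is polynomial in `n`, a crude polynomial bound for Δ is enough
-- there. The window h = n^(3/5) answers two demands. Beyond distance 2h a factorial gains a factor
-- exponential in h²/n, which has to beat every polynomial in `n`; inside the window the logarithm
-- of (M - l)! / l! deviates from its linear term by the order of h³/n², which has to vanish. Any
-- exponent strictly between 1/2 and 2/3 meets both; with 3/5 and `n` near r^5 all scales are powers
-- of r, namely h = r³ and h²/n = r. All estimates are inequalities between natural numbers with
-- denominators cleared, and ratios of factorials are compared through their squares. The formulas
-- for f and g come from one count of lattice paths in a Weyl chamber: the Vandermonde product
-- vanishes on the walls, and l ↦ M - l exchanges decreasing and increasing sequences.

𝟙 : ∀ {P : Set} → Dec P → ℕ
𝟙 p = if does p then 1 else 0

𝟙-yes : ∀ {P : Set} (p : Dec P) → P → 𝟙 p ≡ 1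
𝟙-yes p h = cong (if_then 1 else 0) (dec-true p h)

𝟙-no : ∀ {P : Set} (p : Dec P) → ¬ P → 𝟙 p ≡ 0
𝟙-no p h = cong (if_then 1 else 0) (dec-false p h)

𝟙≤1 : ∀ {P : Set} (p : Dec P) → 𝟙 p ≤ 1
𝟙≤1 (yes _) = ≤-refl
𝟙≤1 (no _) = z≤n

𝟙-cong : ∀ {P Q : Set} (p : Dec P) (q : Dec Q) → (P → Q) → (Q → P) → 𝟙 p ≡ 𝟙 q
𝟙-cong p (yes y) f g = 𝟙-yes p (g y)
𝟙-cong p (no n) f g = 𝟙-no p (λ x → n (f x))

𝟙-∧ : ∀ {P Q R : Set} (p : Dec P) (q : Dec Q) (r : Dec R) → (R → P × Q) → (P → Q → R) → 𝟙 r ≡ 𝟙 p * 𝟙 q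
𝟙-∧ (yes x) (yes y) r f g = 𝟙-yes r (g x y)
𝟙-∧ (yes x) (no ¬y) r f g = 𝟙-no r (¬y ∘ proj₂ ∘ f)
𝟙-∧ (no ¬x) q r f g = 𝟙-no r (¬x ∘ proj₁ ∘ f)

𝟙-*-cong : ∀ {P : Set} (p : Dec P) {a b} → (P → a ≡ b) → 𝟙 p * a ≡ 𝟙 p * b
𝟙-*-cong (yes x) h = cong (1 *_) (h x)
𝟙-*-cong (no _) h = refl

𝟙-absorb : ∀ {P : Set} (p : Dec P) {a} → (¬ P → a ≡ 0) → 𝟙 p * a ≡ a
𝟙-absorb (yes _) h = *-identityˡ _
𝟙-absorb (no ¬x) h = sym (h ¬x)

-- Finite sums and counting by relations

∑ : ∀ {A : Set} → List A → (A → ℕ) → ℕ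
∑ xs F = sum (map F xs)

module _ {A : Set} where

  ∑-cong : (xs : List A) {F G : A → ℕ} → (∀ {x} → x ∈ xs → F x ≡ G x) → ∑ xs F ≡ ∑ xs G
  ∑-cong [] h = refl
  ∑-cong (x ∷ xs) h = cong₂ _+_ (h (here refl)) (∑-cong xs (h ∘ there))

  ∑-mono : (xs : List A) {F G : A → ℕ} → (∀ {x} → x ∈ xs → F x ≤ G x) → ∑ xs F ≤ ∑ xs G
  ∑-mono [] h = z≤n
  ∑-mono (x ∷ xs) h = +-mono-≤ (h (here refl)) (∑-mono xs (h ∘ there))

  ∑-++ : (xs ys : List A) (F : A → ℕ) → ∑ (xs ++ ys) F ≡ ∑ xs F + ∑ ys F
  ∑-++ [] ys F = refl
  ∑-++ (x ∷ xs) ys F = trans (cong (F x +_) (∑-++ xs ys F)) (sym (+-assoc (F x) _ _))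

  ∑-concatMap : {B : Set} (G : B → List A) (ys : List B) (F : A → ℕ) →
    ∑ (concatMap G ys) F ≡ ∑ ys (λ y → ∑ (G y) F)
  ∑-concatMap G [] F = refl
  ∑-concatMap G (y ∷ ys) F =
    trans (∑-++ (G y) (concatMap G ys) F) (cong (∑ (G y) F +_) (∑-concatMap G ys F))

  ∑-map : {B : Set} (G : B → A) (ys : List B) (F : A → ℕ) → ∑ (map G ys) F ≡ ∑ ys (F ∘ G)
  ∑-map G [] F = refl
  ∑-map G (y ∷ ys) F = cong (F (G y) +_) (∑-map G ys F)

  ∑-0 : (xs : List A) → ∑ xs (λ _ → 0) ≡ 0
  ∑-0 [] = refl
  ∑-0 (x ∷ xs) = ∑-0 xs

  ∑-+ : (xs : List A) (F G : A → ℕ) → ∑ xs (λ x → F x + G x) ≡ ∑ xs F + ∑ xs G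
  ∑-+ [] F G = refl
  ∑-+ (x ∷ xs) F G = trans (cong (F x + G x +_) (∑-+ xs F G)) (interchange (F x) (G x) _ _)
    where
    interchange : ∀ a b c d → a + b + (c + d) ≡ a + c + (b + d)
    interchange = solve-∀

  ∑-*ʳ : (xs : List A) (F : A → ℕ) (c : ℕ) → ∑ xs (λ x → F x * c) ≡ ∑ xs F * c
  ∑-*ʳ [] F c = refl
  ∑-*ʳ (x ∷ xs) F c = trans (cong (F x * c +_) (∑-*ʳ xs F c)) (sym (*-distribʳ-+ c (F x) _))

  ∑-*ˡ : (xs : List A) (F : A → ℕ) (c : ℕ) → ∑ xs (λ x → c * F x) ≡ c * ∑ xs F
  ∑-*ˡ xs F c = trans (∑-cong xs (λ {x} _ → *-comm c (F x))) (trans (∑-*ʳ xs F c) (*-comm _ c))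

  ∑-const : (xs : List A) (c : ℕ) → ∑ xs (λ _ → c) ≡ length xs * c
  ∑-const [] c = refl
  ∑-const (x ∷ xs) c = cong (c +_) (∑-const xs c)

  ∑-≥ : {xs : List A} {x : A} (F : A → ℕ) → x ∈ xs → F x ≤ ∑ xs F
  ∑-≥ F (here refl) = m≤m+n _ _
  ∑-≥ F (there i) = ≤-trans (∑-≥ F i) (m≤n+m _ _)

  length-filter-∑ : {P : Pred A 0ℓ} (P? : Decidable P) (xs : List A) →
    length (filter P? xs) ≡ ∑ xs (λ x → 𝟙 (P? x))
  length-filter-∑ P? [] = refl
  length-filter-∑ P? (x ∷ xs) with P? x
  ... | yes _ = cong suc (length-filter-∑ P? xs)
  ... | no _ = length-filter-∑ P? xs

  ∑-filter : {P : Pred A 0ℓ} (P? : Decidable P) (xs : List A) (F : A → ℕ) →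
    ∑ (filter P? xs) F ≡ ∑ xs (λ x → 𝟙 (P? x) * F x)
  ∑-filter P? [] F = refl
  ∑-filter P? (x ∷ xs) F with P? x
  ... | yes _ = cong₂ _+_ (sym (*-identityˡ (F x))) (∑-filter P? xs F)
  ... | no _ = ∑-filter P? xs F

  length-concatMap : {B : Set} (G : B → List A) (ys : List B) →
    length (concatMap G ys) ≡ ∑ ys (length ∘ G)
  length-concatMap G [] = refl
  length-concatMap G (y ∷ ys) =
    trans (length-++ (G y)) (cong (length (G y) +_) (length-concatMap G ys))

  ∈-concatMap⁺′ : {B : Set} {G : B → List A} {y : B} {ys : List B} {x : A} →
    y ∈ ys → x ∈ G y → x ∈ concatMap G ys
  ∈-concatMap⁺′ {G = G} i j = ∈-concatMap⁺ G (lose i j)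

  ∈-concatMap⁻′ : {B : Set} (G : B → List A) (ys : List B) {x : A} →
    x ∈ concatMap G ys → ∃ λ y → y ∈ ys × x ∈ G y
  ∈-concatMap⁻′ G ys i = find (∈-concatMap⁻ G {xs = ys} i)

  Unique-concatMap : {B : Set} (G : B → List A) {ys : List B} → Unique ys →
    (∀ y → Unique (G y)) → (∀ {y y′ x} → x ∈ G y → x ∈ G y′ → y ≡ y′) → Unique (concatMap G ys)
  Unique-concatMap G [] u h = []
  Unique-concatMap G {y ∷ ys} (y∉ ∷ us) u h =
    Uniqueₚ.++⁺ (u y) (Unique-concatMap G us u h)
      λ (i , j) → let (y′ , k , l) = ∈-concatMap⁻′ G ys j in All.lookup y∉ k (h i l)

  module _ {B : Set} (R : A → B → Set) where

    length-≤ : (xs : List A) (ys : List B) → Unique xs →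
      (∀ {x} → x ∈ xs → ∃ λ y → y ∈ ys × R x y) →
      (∀ {x x′ y} → R x y → R x′ y → x ≡ x′) → length xs ≤ length ys
    length-≤ [] ys u t i = z≤n
    length-≤ (x ∷ xs) ys (x∉ ∷ u) t i with t (here refl)
    ... | y , y∈ , r with ∈-∃++ y∈
    ... | as , bs , refl =
      subst (suc (length xs) ≤_) len (s≤s (length-≤ xs (as ++ bs) u t′ i))
      where
      len : suc (length (as ++ bs)) ≡ length (as ++ y ∷ bs)
      len = trans (cong suc (length-++ as)) (trans (sym (+-suc _ _)) (sym (length-++ as)))
      t′ : ∀ {x′} → x′ ∈ xs → ∃ λ y′ → y′ ∈ as ++ bs × R x′ y′
      t′ x′∈ with t (there x′∈)
      ... | y′ , y′∈ , r′ with ∈-++⁻ as y′∈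
      ... | inj₁ q = y′ , ∈-++⁺ˡ q , r′
      ... | inj₂ (here refl) = contradiction (i r r′) (All.lookup x∉ x′∈)
      ... | inj₂ (there q) = y′ , ∈-++⁺ʳ as q , r′

∑-swap : {A B : Set} (xs : List A) (ys : List B) (F : A → B → ℕ) →
  ∑ xs (λ x → ∑ ys (F x)) ≡ ∑ ys (λ y → ∑ xs (λ x → F x y))
∑-swap [] ys F = sym (∑-0 ys)
∑-swap (x ∷ xs) ys F = trans (cong (∑ ys (F x) +_) (∑-swap xs ys F)) (sym (∑-+ ys (F x) _))

-- Bijections are given as relations because Robinson-Schensted is set up as an inductive relation:
-- totality and uniqueness on both sides are what its lemmas deliver, and no map has to be
-- extracted.
length-≡ : {A B : Set} (R : A → B → Set) (xs : List A) (ys : List B) → Unique xs → Unique ys →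
  (∀ {x} → x ∈ xs → ∃ λ y → y ∈ ys × R x y) → (∀ {y} → y ∈ ys → ∃ λ x → x ∈ xs × R x y) →
  (∀ {x x′ y} → R x y → R x′ y → x ≡ x′) → (∀ {x y y′} → R x y → R x y′ → y ≡ y′) →
  length xs ≡ length ys
length-≡ R xs ys u v s t i j = ≤-antisym
  (length-≤ R xs ys u s i) (length-≤ (λ y x → R x y) ys xs v t j)

-- Listing the words that `count` counts

toL : ∀ {m k} → (Fin m → Fin k) → List ℕ
toL f = tabulate (λ i → toℕ (f i))

-- Two absurd lambdas are never definitionally equal, so the one inside count is recovered by unification.
count-zero : ∀ k {P : Pred (Fin 0 → Fin k) 0ℓ} (P? : Decidable P) → ∃ λ f → count 0 k P? ≡ 𝟙 (P? f)
count-zero k P? = _ , refl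

-- The recursion is that of `count`, so that the lengths agree clause by clause. Words are stored as
-- lists of numbers, since functions that agree pointwise need not be equal.
enum : ∀ m k {P : Pred (Fin m → Fin k) 0ℓ} → Decidable P → List (List ℕ)
enum zero k P? = if does (P? (proj₁ (count-zero k P?))) then [] ∷ [] else []
enum (suc m) k P? = concatMap (λ x → map (toℕ x ∷_) (enum m k (λ f → P? (x F.∷ f)))) (allFin k)

length-enum : ∀ m k {P : Pred (Fin m → Fin k) 0ℓ} (P? : Decidable P) → length (enum m k P?) ≡ count m k P?
length-enum zero k P? with does (P? (proj₁ (count-zero k P?)))
... | true = refl
... | false = refl
length-enum (suc m) k P? = trans (length-concatMap _ (allFin k))
  (∑-cong (allFin k) λ {x} _ → trans (length-map _ (enum m k _)) (length-enum m k (λ f → P? (x F.∷ f))))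

enum-unique : ∀ m k {P : Pred (Fin m → Fin k) 0ℓ} (P? : Decidable P) → Unique (enum m k P?)
enum-unique zero k P? with does (P? (proj₁ (count-zero k P?)))
... | true = [] ∷ []
... | false = []
enum-unique (suc m) k P? = Unique-concatMap _ (Uniqueₚ.allFin⁺ k)
  (λ x → Uniqueₚ.map⁺ ∷-injectiveʳ (enum-unique m k (λ f → P? (x F.∷ f))))
  λ i j → let (_ , _ , p) = ∈-map⁻ _ i ; (_ , _ , q) = ∈-map⁻ _ j in
    Finₚ.toℕ-injective (∷-injectiveˡ (trans (sym p) q))

∈-enum⁻ : ∀ m k {P : Pred (Fin m → Fin k) 0ℓ} (P? : Decidable P) {w} → w ∈ enum m k P? →
  ∃ λ f → P f × w ≡ toL f
∈-enum⁻ zero k P? i with P? (proj₁ (count-zero k P?)) | i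
... | yes p | here refl = _ , p , refl
∈-enum⁻ (suc m) k P? i with ∈-concatMap⁻′ _ (allFin k) i
... | x , _ , j with ∈-map⁻ _ j
... | w , l , refl with ∈-enum⁻ m k (λ f → P? (x F.∷ f)) l
... | f , p , refl = x F.∷ f , p , refl

-- The enumeration reaches `f` only as its head put in front of its tail, a function that agrees
-- with `f` pointwise; hence the requirement that `P` respects `≗`.
∈-enum⁺ : ∀ m k {P : Pred (Fin m → Fin k) 0ℓ} (P? : Decidable P) →
  (∀ {f g} → f ≗ g → P f → P g) → ∀ f → P f → toL f ∈ enum m k P?
∈-enum⁺ zero k P? resp f p with P? (proj₁ (count-zero k P?))
... | yes _ = here refl
... | no ¬p = contradiction (resp (λ ()) p) ¬p
∈-enum⁺ (suc m) k P? resp f p = ∈-concatMap⁺′ (∈-allFin (f Fin.zero)) (∈-map⁺ _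
  (∈-enum⁺ m k (λ g → P? (f Fin.zero F.∷ g)) (λ {g} {h} e → resp (λ { Fin.zero → refl ; (Fin.suc i) → e i }))
    (f ∘ Fin.suc) (resp (λ { Fin.zero → refl ; (Fin.suc i) → refl }) p)))

-- Robinson-Schensted by growth diagrams

-- A word of boxes added (just the row) or not (nothing), the last step at the head.
Chain : Set
Chain = List (Maybe ℕ)

sh : Chain → ℕ → ℕ
sh [] i = 0
sh (nothing ∷ C) i = sh C i
sh (just r ∷ C) i = 𝟙 (r ≟ i) + sh C i

Add : (ℕ → ℕ) → ℕ → Set
Add s zero = ⊤
Add s (suc r) = s (suc r) < s r

Valid : Chain → Set
Valid [] = ⊤
Valid (nothing ∷ C) = Valid C
Valid (just r ∷ C) = Add (sh C) r × Valid C

cnt : List ℕ → ℕ → ℕ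
cnt w = sh (map just w)

Lat : List ℕ → Set
Lat w = Valid (map just w)

-- Fomin's local rules for one row of the growth diagram: C is the chain of shapes along the bottom
-- (its head is the last step), the cross sits in column x, C′ is the chain along the top, and r is
-- the row of the box by which the two final shapes differ.
data Ins : Chain → ℕ → Chain → ℕ → Set where
  new  : ∀ {C} → Ins (nothing ∷ C) (length C) (just 0 ∷ C) 0
  flat : ∀ {C x C′ r} → Ins C x C′ r → Ins (nothing ∷ C) x (nothing ∷ C′) r
  pass : ∀ {b C x C′ r} → b ≢ r → Ins C x C′ r → Ins (just b ∷ C) x (just b ∷ C′) r
  bump : ∀ {C x C′ r} → Ins C x C′ r → Ins (just r ∷ C) x (just (suc r) ∷ C′) (suc r)

-- C has a flat step in column x.
data Free : Chain → ℕ → Set where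
  now   : ∀ {C} → Free (nothing ∷ C) (length C)
  later : ∀ {h C x} → Free C x → Free (h ∷ C) x

sh-same : ∀ r C → sh (just r ∷ C) r ≡ suc (sh C r)
sh-same r C = cong (_+ sh C r) (𝟙-yes (r ≟ r) refl)

sh-diff : ∀ {r i} C → r ≢ i → sh (just r ∷ C) i ≡ sh C i
sh-diff {r} {i} C ne = cong (_+ sh C i) (𝟙-no (r ≟ i) ne)

Add-resp : ∀ {s t} r → s ≗ t → Add s r → Add t r
Add-resp zero e a = tt
Add-resp (suc r) e a = subst₂ _<_ (e _) (e _) a

Add-other : ∀ {s t b} r → (∀ i → t i ≡ 𝟙 (b ≟ i) + s i) → r ≢ b → Add s r → Add t r
Add-other zero e ne a = tt
Add-other {s} {t} {b} (suc r) e ne a =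
  subst₂ _<_ (sym (trans (e (suc r)) (cong (_+ s (suc r)) (𝟙-no (b ≟ suc r) (ne ∘ sym))))) (sym (e r))
    (≤-trans a (m≤n+m _ _))

sh-antitone : ∀ C → Valid C → ∀ i → sh C (suc i) ≤ sh C i
sh-antitone [] v i = z≤n
sh-antitone (nothing ∷ C) v i = sh-antitone C v i
sh-antitone (just r ∷ C) (a , v) i with r ≟ suc i
... | yes refl = subst₂ _≤_ (sym (sh-same (suc i) C)) (sym (sh-diff C (1+n≢n {i}))) a
... | no ne = subst (_≤ sh (just r ∷ C) i) (sym (sh-diff C ne)) (≤-trans (sh-antitone C v i) (m≤n+m _ (𝟙 (r ≟ i))))

Ins-sh : ∀ {C x C′ r} → Ins C x C′ r → ∀ i → sh C′ i ≡ 𝟙 (r ≟ i) + sh C i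
Ins-sh new i = refl
Ins-sh (flat p) i = Ins-sh p i
Ins-sh {r = r} (pass {b} {C} ne p) i =
  trans (cong (𝟙 (b ≟ i) +_) (Ins-sh p i)) (left-comm (𝟙 (b ≟ i)) (𝟙 (r ≟ i)) (sh C i))
  where
  left-comm : ∀ a b c → a + (b + c) ≡ b + (a + c)
  left-comm = solve-∀
Ins-sh (bump {r = r} p) i = cong (𝟙 (suc r ≟ i) +_) (Ins-sh p i)

Ins-sh-same : ∀ {C x C′ r} → Ins C x C′ r → sh C′ r ≡ suc (sh C r)
Ins-sh-same {C} {r = r} p = trans (Ins-sh p r) (sh-same r C)

Ins-sh-diff : ∀ {C x C′ r i} → r ≢ i → Ins C x C′ r → sh C′ i ≡ sh C i
Ins-sh-diff {C} {i = i} ne p = trans (Ins-sh p i) (sh-diff C ne)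

-- The case with content is `bump`: once a box has joined row `r`, row `suc r` has room for one,
-- because it was at most as long as row `r` before.
Ins-valid : ∀ {C x C′ r} → Ins C x C′ r → Valid C → Valid C′ × Add (sh C) r
Ins-valid new v = (tt , v) , tt
Ins-valid (flat p) v = Ins-valid p v
Ins-valid {r = r} (pass {b} ne p) (a , v) with Ins-valid p v
... | v′ , a′ = (Add-other b (Ins-sh p) ne a , v′) , Add-other r (λ i → refl) (ne ∘ sym) a′
Ins-valid (bump {C} {r = r} p) (a , v) with Ins-valid p v
... | v′ , a′ = (subst₂ _<_ (sym (Ins-sh-diff r≢ p)) (sym (Ins-sh-same p)) le , v′) ,
    subst₂ _<_ (sym (sh-diff C r≢)) (sym (sh-same r C)) le
  where
  r≢ : r ≢ suc r
  r≢ = 1+n≢n ∘ sym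
  le : sh C (suc r) < suc (sh C r)
  le = s≤s (sh-antitone C v r)

Ins-length : ∀ {C x C′ r} → Ins C x C′ r → length C′ ≡ length C
Ins-length new = refl
Ins-length (flat p) = cong suc (Ins-length p)
Ins-length (pass _ p) = cong suc (Ins-length p)
Ins-length (bump p) = cong suc (Ins-length p)

Free-< : ∀ {C x} → Free C x → x < length C
Free-< now = n<1+n _
Free-< (later f) = m<n⇒m<1+n (Free-< f)

Ins-free : ∀ {C x C′ r} → Ins C x C′ r → Free C x
Ins-free new = now
Ins-free (flat p) = later (Ins-free p)
Ins-free (pass _ p) = later (Ins-free p)
Ins-free (bump p) = later (Ins-free p)

Ins-< : ∀ {C x C′ r} → Ins C x C′ r → x < length C
Ins-< = Free-< ∘ Ins-free

Ins-exists : ∀ {C x} → Free C x → ∃₂ λ C′ r → Ins C x C′ r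
Ins-exists now = _ , _ , new
Ins-exists (later {nothing} f) with Ins-exists f
... | _ , _ , p = _ , _ , flat p
Ins-exists (later {just b} f) with Ins-exists f
... | _ , r , p with b ≟ r
... | yes refl = _ , _ , bump p
... | no ne = _ , _ , pass ne p

Ins-free⁺ : ∀ {C x C′ r y} → Ins C x C′ r → Free C y → y ≢ x → Free C′ y
Ins-free⁺ new now ne = contradiction refl ne
Ins-free⁺ new (later f) ne = later f
Ins-free⁺ (flat p) now ne = subst (Free _) (Ins-length p) now
Ins-free⁺ (flat p) (later f) ne = later (Ins-free⁺ p f ne)
Ins-free⁺ (pass _ p) (later f) ne = later (Ins-free⁺ p f ne)
Ins-free⁺ (bump p) (later f) ne = later (Ins-free⁺ p f ne)

Ins-free⁻ : ∀ {C x C′ r y} → Ins C x C′ r → Free C′ y → Free C y × y ≢ x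
Ins-free⁻ new (later f) = later f , <⇒≢ (Free-< f)
Ins-free⁻ (flat p) now = subst (Free _) (sym (Ins-length p)) now ,
  λ e → <⇒≢ (subst (_ <_) (sym (Ins-length p)) (Ins-< p)) (sym e)
Ins-free⁻ (flat p) (later f) = let (g , ne) = Ins-free⁻ p f in later g , ne
Ins-free⁻ (pass _ p) (later f) = let (g , ne) = Ins-free⁻ p f in later g , ne
Ins-free⁻ (bump p) (later f) = let (g , ne) = Ins-free⁻ p f in later g , ne

Ins-functional : ∀ {C x C′ r C″ s} → Ins C x C′ r → Ins C x C″ s → C′ ≡ C″ × r ≡ s
Ins-functional new new = refl , refl
Ins-functional new (flat q) = contradiction (Ins-< q) (<-irrefl refl)
Ins-functional (flat p) new = contradiction (Ins-< p) (<-irrefl refl)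
Ins-functional (flat p) (flat q) with Ins-functional p q
... | refl , refl = refl , refl
Ins-functional (pass x p) (pass y q) with Ins-functional p q
... | refl , refl = refl , refl
Ins-functional (pass x p) (bump q) with Ins-functional p q
... | refl , refl = contradiction refl x
Ins-functional (bump p) (pass x q) with Ins-functional p q
... | refl , refl = contradiction refl x
Ins-functional (bump p) (bump q) with Ins-functional p q
... | refl , refl = refl , refl

Ins-injective : ∀ {C x C′ r D y} → Ins C x C′ r → Ins D y C′ r → C ≡ D × x ≡ y
Ins-injective new new = refl , refl
Ins-injective new (pass ne q) = contradiction refl ne
Ins-injective (flat p) (flat q) with Ins-injective p q
... | refl , refl = refl , refl
Ins-injective (pass ne p) new = contradiction refl ne
Ins-injective (pass ne p) (pass _ q) with Ins-injective p q
... | refl , refl = refl , refl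
Ins-injective (pass ne p) (bump q) = contradiction refl ne
Ins-injective (bump p) (pass ne q) = contradiction refl ne
Ins-injective (bump p) (bump q) with Ins-injective p q
... | refl , refl = refl , refl

-- The local rules run backwards from a corner in row `r`. If the last step of the top chain is in
-- row `r` itself, it came from the cross when `r` is 0 and from a `bump` otherwise; in the latter
-- case the validity of that step says exactly that the row above has a corner, so the recursion can
-- go on there.
Ins-surjective : ∀ C′ r → Valid C′ → sh C′ (suc r) < sh C′ r → ∃₂ λ C x → Ins C x C′ r × Valid C
Ins-surjective (nothing ∷ T) r v lt with Ins-surjective T r v lt
... | C , x , p , v′ = _ , x , flat p , v′
Ins-surjective (just b ∷ T) r (a , v) lt with b ≟ r
Ins-surjective (just b ∷ T) zero (a , v) lt | yes refl = _ , _ , new , v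
Ins-surjective (just b ∷ T) (suc r) (a , v) lt | yes refl with Ins-surjective T r v a
... | C , x , p , v′ = _ , x , bump p , proj₂ (Ins-valid p v′) , v′
Ins-surjective (just b ∷ T) r (a , v) lt | no ne
  with Ins-surjective T r v (≤-trans (s≤s (m≤n+m _ _)) (subst (sh (just b ∷ T) (suc r) <_) (sh-diff T ne) lt))
... | C , x , p , v′ = _ , x , pass ne p , add b a ne (subst (sh (just b ∷ T) (suc r) <_) (sh-diff T ne) lt) , v′
  where
  add : ∀ b → Add (sh T) b → b ≢ r → sh (just b ∷ T) (suc r) < sh T r → Add (sh C) b
  add zero a ne lt = tt
  add (suc c) a ne lt with c ≟ r
  ... | no c≢ = subst₂ _<_ (Ins-sh-diff (ne ∘ sym) p) (Ins-sh-diff (c≢ ∘ sym) p) a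
  ... | yes refl = subst (_< sh C c) (Ins-sh-diff (ne ∘ sym) p)
    (s≤s⁻¹ (subst₂ _<_ (sh-same (suc c) T) (Ins-sh-same p) lt))

-- The first row of the shape reached after the first `y` columns of the chain.
row₀ : Chain → ℕ → ℕ
row₀ [] y = 0
row₀ (just zero ∷ C) y = 𝟙 (length C <? y) + row₀ C y
row₀ (_ ∷ C) y = row₀ C y

row₀-full : ∀ C {y} → length C ≤ y → row₀ C y ≡ sh C 0
row₀-full [] le = refl
row₀-full (nothing ∷ C) le = row₀-full C (≤-trans (n≤1+n _) le)
row₀-full (just zero ∷ C) {y} le =
  cong₂ _+_ (𝟙-yes (length C <? y) le) (row₀-full C (≤-trans (n≤1+n _) le))
row₀-full (just (suc _) ∷ C) le = row₀-full C (≤-trans (n≤1+n _) le)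

row₀-≤ : ∀ C y → row₀ C y ≤ sh C 0
row₀-≤ [] y = z≤n
row₀-≤ (nothing ∷ C) y = row₀-≤ C y
row₀-≤ (just zero ∷ C) y = +-mono-≤ (𝟙≤1 (length C <? y)) (row₀-≤ C y)
row₀-≤ (just (suc _) ∷ C) y = row₀-≤ C y

Ins-row₀-≤ : ∀ {C x C′ r y} → Ins C x C′ r → y ≤ x → row₀ C′ y ≡ row₀ C y
Ins-row₀-≤ {y = y} (new {C}) le = cong (_+ row₀ C y) (𝟙-no (length C <? y) (≤⇒≯ le))
Ins-row₀-≤ (flat p) le = Ins-row₀-≤ p le
Ins-row₀-≤ {y = y} (pass {zero} _ p) le =
  cong₂ _+_ (cong (λ n → 𝟙 (n <? y)) (Ins-length p)) (Ins-row₀-≤ p le)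
Ins-row₀-≤ (pass {suc _} _ p) le = Ins-row₀-≤ p le
Ins-row₀-≤ {y = y} (bump {C} {r = zero} p) le = trans (Ins-row₀-≤ p le)
  (cong (_+ row₀ C y) (sym (𝟙-no (length C <? y) (<-asym (≤-<-trans le (Ins-< p))))))
Ins-row₀-≤ (bump {r = suc _} p) le = Ins-row₀-≤ p le

-- Right of the cross the top chain has one more box in row 0 until the bottom chain next adds a box
-- there; that box is bumped, and from then on the first rows agree. The maximum covers both phases,
-- and it is the recursion of `lds` for a letter put in front.
Ins-row₀-> : ∀ {C x C′ r y} → Ins C x C′ r → x < y → row₀ C′ y ≡ row₀ C y ⊔ suc (row₀ C x)
Ins-row₀-> {y = y} (new {C}) lt = trans (cong₂ _+_ (𝟙-yes (length C <? y) lt) (row₀-full C (<⇒≤ lt)))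
  (sym (trans (cong₂ (λ a b → a ⊔ suc b) (row₀-full C (<⇒≤ lt)) (row₀-full C ≤-refl)) (m≤n⇒m⊔n≡n (n≤1+n _))))
Ins-row₀-> (flat p) lt = Ins-row₀-> p lt
Ins-row₀-> {x = x} {r = r} {y = y} (pass {zero} {C} {C′ = C′} ne p) lt
  rewrite 𝟙-no (length C <? x) (<⇒≯ (Ins-< p)) | Ins-length p with length C <? y
... | yes l rewrite 𝟙-yes (length C <? y) l = trans (cong suc (trans (row₀-full C′ (subst (_≤ y) (sym (Ins-length p)) (<⇒≤ l))) (Ins-sh-diff (ne ∘ sym) p)))
  (sym (trans (cong (λ a → suc a ⊔ suc (row₀ C x)) (row₀-full C (<⇒≤ l))) (m≥n⇒m⊔n≡m (s≤s (row₀-≤ C x)))))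
... | no ¬l rewrite 𝟙-no (length C <? y) ¬l = Ins-row₀-> p lt
Ins-row₀-> (pass {suc _} _ p) lt = Ins-row₀-> p lt
Ins-row₀-> {x = x} {y = y} (bump {C} {C′ = C′} {r = zero} p) lt
  rewrite 𝟙-no (length C <? x) (<⇒≯ (Ins-< p)) with length C <? y
... | yes l rewrite 𝟙-yes (length C <? y) l = trans (trans (row₀-full C′ (subst (_≤ y) (sym (Ins-length p)) (<⇒≤ l))) (Ins-sh-same p))
  (sym (trans (cong (λ a → suc a ⊔ suc (row₀ C x)) (row₀-full C (<⇒≤ l))) (m≥n⇒m⊔n≡m (s≤s (row₀-≤ C x)))))
... | no ¬l rewrite 𝟙-no (length C <? y) ¬l = Ins-row₀-> p lt
Ins-row₀-> (bump {r = suc _} p) lt = Ins-row₀-> p lt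

-- The length of the longest decreasing subsequence of xs with all letters below y.
lds : List ℕ → ℕ → ℕ
lds [] y = 0
lds (x ∷ xs) y = if does (x <? y) then lds xs y ⊔ suc (lds xs x) else lds xs y

lds-yes : ∀ x xs y → x < y → lds (x ∷ xs) y ≡ lds xs y ⊔ suc (lds xs x)
lds-yes x xs y lt rewrite dec-true (x <? y) lt = refl

lds-no : ∀ x xs y → ¬ x < y → lds (x ∷ xs) y ≡ lds xs y
lds-no x xs y ¬lt rewrite dec-false (x <? y) ¬lt = refl

lds-tail : ∀ x xs y → lds xs y ≤ lds (x ∷ xs) y
lds-tail x xs y with does (x <? y)
... | true = m≤m⊔n _ _
... | false = ≤-refl

lds-head : ∀ x xs y → x < y → lds xs x < lds (x ∷ xs) y
lds-head x xs y lt rewrite lds-yes x xs y lt = m≤n⊔m (lds xs y) _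

module _ (m : ℕ) where

  -- One row of the growth diagram per letter, the last letter of the word at the bottom. `C` is the
  -- top boundary, which is the insertion tableau once no flat step is left; `Q` lists the rows of
  -- the boxes gained, which is the recording tableau.
  data RS : List ℕ → Chain → List ℕ → Set where
    start : RS [] (replicate m nothing) []
    step  : ∀ {xs C Q x C′ r} → RS xs C Q → Ins C x C′ r → RS (x ∷ xs) C′ (r ∷ Q)

  sh-empty : ∀ m i → sh (replicate m nothing) i ≡ 0
  sh-empty zero i = refl
  sh-empty (suc m) i = sh-empty m i

  valid-empty : ∀ m → Valid (replicate m nothing)
  valid-empty zero = tt
  valid-empty (suc m) = valid-empty m

  row₀-empty : ∀ m y → row₀ (replicate m nothing) y ≡ 0
  row₀-empty zero y = refl
  row₀-empty (suc m) y = row₀-empty m y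

  length-empty : ∀ m → length {A = Maybe ℕ} (replicate m nothing) ≡ m
  length-empty zero = refl
  length-empty (suc m) = cong suc (length-empty m)

  free-empty : ∀ m {x} → x < m → Free (replicate m nothing) x
  free-empty (suc m) {x} lt with m≤n⇒m<n∨m≡n (s≤s⁻¹ lt)
  ... | inj₁ l = later (free-empty m l)
  ... | inj₂ refl = subst (Free _) (length-empty m) now

  RS-valid : ∀ {w C Q} → RS w C Q → Valid C × Lat Q × sh C ≗ cnt Q
  RS-valid start = valid-empty m , tt , sh-empty m
  RS-valid (step {r = r} s p) with RS-valid s
  ... | v , l , e with Ins-valid p v
  ... | v′ , a = v′ , (Add-resp r e a , l) , λ i → trans (Ins-sh p i) (cong (𝟙 (r ≟ i) +_) (e i))

  RS-length : ∀ {w C Q} → RS w C Q → length C ≡ m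
  RS-length start = length-empty m
  RS-length (step s p) = trans (Ins-length p) (RS-length s)

  RS-length-Q : ∀ {w C Q} → RS w C Q → length w ≡ length Q
  RS-length-Q start = refl
  RS-length-Q (step s p) = cong suc (RS-length-Q s)

  RS-free⁺ : ∀ {w C Q x} → RS w C Q → x < m → x ∉ w → Free C x
  RS-free⁺ start lt x∉ = free-empty m lt
  RS-free⁺ (step s p) lt x∉ = Ins-free⁺ p (RS-free⁺ s lt (x∉ ∘ there)) (x∉ ∘ here)

  RS-free⁻ : ∀ {w C Q x} → RS w C Q → Free C x → x ∉ w
  RS-free⁻ (step s p) f (here e) = proj₂ (Ins-free⁻ p f) e
  RS-free⁻ (step s p) f (there i) = RS-free⁻ s (proj₁ (Ins-free⁻ p f)) i

  RS-total : ∀ w → Unique w → All (_< m) w → ∃₂ λ C Q → RS w C Q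
  RS-total [] u a = _ , _ , start
  RS-total (x ∷ w) (x∉ ∷ u) (lt ∷ a) with RS-total w u a
  ... | C , Q , s with Ins-exists (RS-free⁺ s lt (λ i → All.lookup x∉ i refl))
  ... | C′ , r , p = _ , _ , step s p

  RS-letters : ∀ {w C Q} → RS w C Q → Unique w × All (_< m) w
  RS-letters start = [] , []
  RS-letters (step s p) with RS-letters s
  ... | u , a = Allₚ.¬Any⇒All¬ _ (RS-free⁻ s (Ins-free p)) ∷ u , subst (_ <_) (RS-length s) (Ins-< p) ∷ a

  RS-functional : ∀ {w C Q C′ Q′} → RS w C Q → RS w C′ Q′ → C ≡ C′ × Q ≡ Q′
  RS-functional start start = refl , refl
  RS-functional (step s p) (step t q) with RS-functional s t
  ... | refl , refl with Ins-functional p q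
  ... | refl , refl = refl , refl

  RS-injective : ∀ {w w′ C Q} → RS w C Q → RS w′ C Q → w ≡ w′
  RS-injective start start = refl
  RS-injective (step s p) (step t q) with Ins-injective p q
  ... | refl , refl = cong (_ ∷_) (RS-injective s t)

  sh≡0⇒empty : ∀ C → (∀ i → sh C i ≡ 0) → C ≡ replicate (length C) nothing
  sh≡0⇒empty [] h = refl
  sh≡0⇒empty (nothing ∷ C) h = cong (nothing ∷_) (sh≡0⇒empty C h)
  sh≡0⇒empty (just r ∷ C) h = contradiction (trans (sym (sh-same r C)) (h r)) λ ()

  RS-surjective : ∀ C Q → Valid C → Lat Q → sh C ≗ cnt Q → length C ≡ m → ∃ λ w → RS w C Q
  RS-surjective C [] v l e refl = [] , subst (λ C′ → RS [] C′ []) (sym (sh≡0⇒empty C e)) start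
  RS-surjective C (r ∷ Q) v (a , l) e len
    with Ins-surjective C r v
      (subst₂ _<_ (sym (trans (e (suc r)) (sh-diff (map just Q) (1+n≢n ∘ sym))))
        (sym (trans (e r) (sh-same r (map just Q)))) (s≤s (sh-antitone (map just Q) l r)))
  ... | C₀ , x , p , v₀ with RS-surjective C₀ Q v₀ l
      (λ i → +-cancelˡ-≡ (𝟙 (r ≟ i)) _ _ (trans (sym (Ins-sh p i)) (e i))) (trans (sym (Ins-length p)) len)
  ... | w , s = x ∷ w , step s p

  nothings : Chain → ℕ
  nothings [] = 0
  nothings (nothing ∷ C) = suc (nothings C)
  nothings (just _ ∷ C) = nothings C

  Ins-nothings : ∀ {C x C′ r} → Ins C x C′ r → nothings C ≡ suc (nothings C′)
  Ins-nothings new = refl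
  Ins-nothings (flat p) = cong suc (Ins-nothings p)
  Ins-nothings (pass _ p) = Ins-nothings p
  Ins-nothings (bump p) = Ins-nothings p

  RS-nothings : ∀ {w C Q} → RS w C Q → nothings C + length w ≡ m
  RS-nothings start = trans (+-identityʳ _) (nothings-empty m)
    where
    nothings-empty : ∀ m → nothings (replicate m nothing) ≡ m
    nothings-empty zero = refl
    nothings-empty (suc m) = cong suc (nothings-empty m)
  RS-nothings (step s p) = trans (+-suc _ _) (trans (cong (_+ _) (sym (Ins-nothings p))) (RS-nothings s))

  nothings≡0 : ∀ C → nothings C ≡ 0 → ∃ λ P → C ≡ map just P
  nothings≡0 [] e = [] , refl
  nothings≡0 (just r ∷ C) e with nothings≡0 C e
  ... | P , refl = r ∷ P , refl

  -- Each letter uses up one flat step, so a word as long as the diagram is wide leaves none.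
  RS-full : ∀ {w C Q} → RS w C Q → length w ≡ m → ∃ λ P → C ≡ map just P
  RS-full {w} {C} s len = nothings≡0 C (+-cancelʳ-≡ (length w) _ 0 (trans (RS-nothings s) (sym len)))

  -- Schensted's theorem for the first row. It measures decreasing subsequences because letters are
  -- inserted from the end of the word.
  RS-row₀ : ∀ {w C Q} → RS w C Q → ∀ y → row₀ C y ≡ lds w y
  RS-row₀ start y = row₀-empty m y
  RS-row₀ (step {x = x} s p) y with x <? y
  ... | yes lt rewrite dec-true (x <? y) lt = trans (Ins-row₀-> p lt) (cong₂ (λ a b → a ⊔ suc b) (RS-row₀ s y) (RS-row₀ s x))
  ... | no ¬lt rewrite dec-false (x <? y) ¬lt = trans (Ins-row₀-≤ p (≮⇒≥ ¬lt)) (RS-row₀ s y)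

  RS-lds : ∀ {w C Q} → RS w C Q → sh C 0 ≡ lds w m
  RS-lds {C = C} s = trans (sym (row₀-full C (≤-reflexive (RS-length s)))) (RS-row₀ s m)

-- Row words to column words: the box added in row r lies in column cnt w r.
tr : List ℕ → List ℕ
tr [] = []
tr (r ∷ w) = cnt w r ∷ tr w

cnt-below-add : ∀ w r i → Lat w → Add (cnt w) r → (cnt w r < cnt w i → i < r) × (i < r → cnt w r < cnt w i)
cnt-below-add w r i v a = to r a , from r a
  where
  anti : ∀ {i j} → i ≤ j → cnt w j ≤ cnt w i
  anti {j = zero} z≤n = ≤-refl
  anti {j = suc j} le with m≤n⇒m<n∨m≡n le
  ... | inj₁ l = ≤-trans (sh-antitone (map just w) v j) (anti (s≤s⁻¹ l))
  ... | inj₂ refl = ≤-refl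
  to : ∀ r → Add (cnt w) r → cnt w r < cnt w i → i < r
  to r a lt with i <? r
  ... | yes l = l
  ... | no ¬l = contradiction (anti (≮⇒≥ ¬l)) (<⇒≱ lt)
  from : ∀ r → Add (cnt w) r → i < r → cnt w r < cnt w i
  from (suc r) a lt = <-≤-trans a (anti (s≤s⁻¹ lt))

-- Conjugation is expressed cell by cell, which makes it symmetric in `w` and `tr w`. A new box ends
-- its row in one shape and its column in the other; that its transposed position is again the next
-- free one is `tr-corner`, which rests on the cells of the shorter word, hence the mutual
-- induction.
tr-cnt : ∀ w → Lat w → ∀ i j → (i < cnt (tr w) j → j < cnt w i) × (j < cnt w i → i < cnt (tr w) j)
tr-corner : ∀ w r → Lat w → Add (cnt w) r → cnt (tr w) (cnt w r) ≡ r

tr-corner w r v a = ≤-antisym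
  (≮⇒≥ λ lt → <-irrefl refl (proj₁ (tr-cnt w v r (cnt w r)) lt))
  (≮⇒≥ λ lt → <-irrefl refl (below _ lt))
  where
  below : ∀ i → i < r → i < cnt (tr w) (cnt w r)
  below i lt = proj₂ (tr-cnt w v i (cnt w r)) (proj₂ (cnt-below-add w r i v a) lt)

tr-cnt [] v i j = (λ ()) , (λ ())
tr-cnt (r ∷ w) (a , v) i j with r ≟ i | cnt w r ≟ j
... | yes refl | yes refl rewrite 𝟙-yes (cnt w r ≟ cnt w r) refl | 𝟙-yes (r ≟ r) refl
      = (λ _ → n<1+n _) , (λ _ → s≤s (≤-reflexive (sym (tr-corner w r v a))))
... | yes refl | no ne rewrite 𝟙-yes (r ≟ r) refl | 𝟙-no (cnt w r ≟ j) ne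
      = (λ l → m<n⇒m<1+n (proj₁ (tr-cnt w v r j) l)) ,
        (λ l → proj₂ (tr-cnt w v r j) (≤∧≢⇒< (s≤s⁻¹ l) (ne ∘ sym)))
... | no ne | yes refl rewrite 𝟙-no (r ≟ i) ne | 𝟙-yes (cnt w r ≟ cnt w r) refl
      = (λ l → proj₂ (cnt-below-add w r i v a) (≤∧≢⇒< (subst (i ≤_) (tr-corner w r v a) (s≤s⁻¹ l)) (ne ∘ sym))) ,
        (λ l → m<n⇒m<1+n (proj₂ (tr-cnt w v i (cnt w r)) l))
... | no ne | no ne′ rewrite 𝟙-no (r ≟ i) ne | 𝟙-no (cnt w r ≟ j) ne′ = tr-cnt w v i j

tr-Lat : ∀ w → Lat w → Lat (tr w)
tr-Lat [] v = tt
tr-Lat (r ∷ w) (a , v) = add (cnt w r) refl , tr-Lat w v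
  where
  add : ∀ j → cnt w r ≡ j → Add (cnt (tr w)) j
  add zero e = tt
  add (suc j) e = subst (_< cnt (tr w) j) (trans (sym (tr-corner w r v a)) (cong (cnt (tr w)) e))
    (proj₂ (tr-cnt w v r j) (subst (j <_) (sym e) (n<1+n j)))

tr-involutive : ∀ w → Lat w → tr (tr w) ≡ w
tr-involutive [] v = refl
tr-involutive (r ∷ w) (a , v) = cong₂ _∷_ (tr-corner w r v a) (tr-involutive w v)

tr-length : ∀ w → length (tr w) ≡ length w
tr-length [] = refl
tr-length (r ∷ w) = cong suc (tr-length w)

below-≡ : ∀ {a b} → (∀ i → i < a → i < b) → (∀ i → i < b → i < a) → a ≡ b
below-≡ f g = ≤-antisym (≮⇒≥ λ lt → <-irrefl refl (f _ lt)) (≮⇒≥ λ lt → <-irrefl refl (g _ lt))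

tr-shape : ∀ u v → Lat u → Lat v → cnt u ≗ cnt v → cnt (tr u) ≗ cnt (tr v)
tr-shape u v lu lv e j = below-≡
  (λ i lt → proj₂ (tr-cnt v lv i j) (subst (j <_) (e i) (proj₁ (tr-cnt u lu i j) lt)))
  (λ i lt → proj₂ (tr-cnt u lu i j) (subst (j <_) (sym (e i)) (proj₁ (tr-cnt v lv i j) lt)))

tr-letters : ∀ d w → Lat w → cnt w 0 ≤ d → All (_< d) (tr w)
tr-letters d [] v le = []
tr-letters d (r ∷ w) (a , v) le =
  ≤-trans (proj₁ (tr-cnt (r ∷ w) (a , v) 0 (cnt w r))
    (subst (0 <_) (sym (sh-same (cnt w r) (map just (tr w)))) z<s)) le
  ∷ tr-letters d w v (≤-trans (m≤n+m _ (𝟙 (r ≟ 0))) le)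

cnt-absent : ∀ d w → All (_< d) w → ∀ {i} → d ≤ i → cnt w i ≡ 0
cnt-absent d [] a le = refl
cnt-absent d (r ∷ w) (lt ∷ a) le =
  trans (sh-diff (map just w) (<⇒≢ (<-≤-trans lt le))) (cnt-absent d w a le)

tr-columns : ∀ d u → Lat u → All (_< d) u → cnt (tr u) 0 ≤ d
tr-columns d u l a = ≮⇒≥ λ lt →
  n≮0 (subst (0 <_) (cnt-absent d u a ≤-refl) (proj₁ (tr-cnt u l d 0) lt))

-- Decreasing subsequences as subsets

module _ where
  open Subset using () renaming (_∈_ to _∈ˢ_)

  private
    tail-dec : ∀ {m k} {f : Fin (suc m) → Fin k} {b s} →
      (∀ i j → i ∈ˢ (b Vec.∷ s) → j ∈ˢ (b Vec.∷ s) → i Fin.< j → f j Fin.< f i) →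
      ∀ i j → i ∈ˢ s → j ∈ˢ s → i Fin.< j → f (Fin.suc j) Fin.< f (Fin.suc i)
    tail-dec h i j p q lt = h _ _ (Vec.there p) (Vec.there q) (s<s lt)

  lds-upper : ∀ {m k} (f : Fin m → Fin k) (s : Subset m) y →
    (∀ i j → i ∈ˢ s → j ∈ˢ s → i Fin.< j → f j Fin.< f i) → (∀ i → i ∈ˢ s → toℕ (f i) < y) →
    Subset.∣ s ∣ ≤ lds (toL f) y
  lds-upper f Vec.[] y h b = z≤n
  lds-upper f (outside Vec.∷ s) y h b =
    ≤-trans (lds-upper (f ∘ Fin.suc) s y (tail-dec h) (λ i p → b _ (Vec.there p))) (lds-tail (toℕ (f Fin.zero)) (toL (f ∘ Fin.suc)) y)
  lds-upper f (inside Vec.∷ s) y h b =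
    ≤-trans (s≤s (lds-upper (f ∘ Fin.suc) s (toℕ (f Fin.zero)) (tail-dec h)
      (λ i p → h _ _ Vec.here (Vec.there p) z<s))) (lds-head (toℕ (f Fin.zero)) (toL (f ∘ Fin.suc)) y (b _ Vec.here))

  DecBelow : ∀ {m k} → (Fin m → Fin k) → ℕ → ℕ → Set
  DecBelow {m} f y n = ∃ λ (s : Subset m) → Subset.∣ s ∣ ≡ n ×
    (∀ i j → i ∈ˢ s → j ∈ˢ s → i Fin.< j → f j Fin.< f i) × (∀ i → i ∈ˢ s → toℕ (f i) < y)

  -- Stated for every `n` up to the maximum because `HasDecSub` asks for an exact length.
  lds-lower : ∀ {m k} (f : Fin m → Fin k) y n → n ≤ lds (toL f) y → DecBelow f y n
  lds-lower {zero} f y zero le = Vec.[] , refl , (λ ()) , (λ ())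
  lds-lower {suc m} f y n le = split (toℕ (f Fin.zero) <? y) (n ≤? lds (toL (f ∘ Fin.suc)) y)
    where
    skip : n ≤ lds (toL (f ∘ Fin.suc)) y → DecBelow f y n
    skip l with lds-lower (f ∘ Fin.suc) y n l
    ... | s , e , h , b = outside Vec.∷ s , e ,
      (λ { (Fin.suc i) (Fin.suc j) (Vec.there p) (Vec.there q) lt → h i j p q (s<s⁻¹ lt) }) ,
      (λ { (Fin.suc i) (Vec.there p) → b i p })
    take : ∀ n → toℕ (f Fin.zero) < y → n ≤ lds (toL (f ∘ Fin.suc)) (toℕ (f Fin.zero)) → DecBelow f y (suc n)
    take n lt l with lds-lower (f ∘ Fin.suc) (toℕ (f Fin.zero)) n l
    ... | s , e , h , b = inside Vec.∷ s , cong suc e ,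
      (λ { Fin.zero (Fin.suc j) _ (Vec.there q) _ → b j q
         ; (Fin.suc i) (Fin.suc j) (Vec.there p) (Vec.there q) l → h i j p q (s<s⁻¹ l) }) ,
      (λ { Fin.zero _ → lt ; (Fin.suc i) (Vec.there p) → <-trans (b i p) lt })
    big : ∀ n → ¬ n ≤ lds (toL (f ∘ Fin.suc)) y → toℕ (f Fin.zero) < y →
      n ≤ lds (toL (f ∘ Fin.suc)) y ⊔ suc (lds (toL (f ∘ Fin.suc)) (toℕ (f Fin.zero))) → DecBelow f y n
    big zero ¬l lt l = contradiction z≤n ¬l
    big (suc n) ¬l lt l with ⊔-sel (lds (toL (f ∘ Fin.suc)) y) (suc (lds (toL (f ∘ Fin.suc)) (toℕ (f Fin.zero))))
    ... | inj₁ e = contradiction (subst (suc n ≤_) e l) ¬l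
    ... | inj₂ e = take n lt (s≤s⁻¹ (subst (suc n ≤_) e l))
    split : Dec (toℕ (f Fin.zero) < y) → Dec (n ≤ lds (toL (f ∘ Fin.suc)) y) → DecBelow f y n
    split _ (yes l) = skip l
    split (no ¬lt) (no ¬l) = contradiction (subst (n ≤_) (lds-no _ (toL (f ∘ Fin.suc)) y ¬lt) le) ¬l
    split (yes lt) (no ¬l) = big n ¬l lt (subst (n ≤_) (lds-yes _ (toL (f ∘ Fin.suc)) y lt) le)

avoid⇒lds : ∀ {m} d (σ : Word m) → ¬ HasDecSub (suc d) σ → lds (toL σ) m ≤ d
avoid⇒lds {m} d σ h = ≮⇒≥ λ lt → let (s , e , p , _) = lds-lower σ m (suc d) lt in h (s , e , p)

lds⇒avoid : ∀ {m} d (σ : Word m) → lds (toL σ) m ≤ d → ¬ HasDecSub (suc d) σ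
lds⇒avoid {m} d σ le (s , e , p) =
  <⇒≱ (subst (_≤ lds (toL σ) m) e (lds-upper σ s m p (λ i _ → Finₚ.toℕ<n (σ i)))) le

toL-unique : ∀ {m k} (f : Fin m → Fin k) → (∀ i j → f i ≡ f j → i ≡ j) → Unique (toL f)
toL-unique f inj = Uniqueₚ.tabulate⁺ (λ e → inj _ _ (Finₚ.toℕ-injective e))

toL-bound : ∀ {m k} (f : Fin m → Fin k) → All (_< k) (toL f)
toL-bound f = Allₚ.tabulate⁺ (λ i → Finₚ.toℕ<n (f i))

toL-cong : ∀ {m k} {f g : Fin m → Fin k} → f ≗ g → toL f ≡ toL g
toL-cong {zero} e = refl
toL-cong {suc m} e = cong₂ _∷_ (cong toℕ (e Fin.zero)) (toL-cong (e ∘ Fin.suc))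

toL-injective : ∀ {m k} {f g : Fin m → Fin k} → toL f ≡ toL g → f ≗ g
toL-injective e Fin.zero = Finₚ.toℕ-injective (∷-injectiveˡ e)
toL-injective e (Fin.suc i) = toL-injective (∷-injectiveʳ e) i

toL-surjective : ∀ m k w → length w ≡ m → All (_< k) w → ∃ λ (f : Fin m → Fin k) → w ≡ toL f
toL-surjective zero k [] e a = (λ ()) , refl
toL-surjective (suc m) k (x ∷ w) e (lt ∷ a) with toL-surjective m k w (suc-injective e) a
... | f , refl = fromℕ< lt F.∷ f , cong (_∷ toL f) (sym (Finₚ.toℕ-fromℕ< lt))

toL-lookup-injective : ∀ {m k} (f : Fin m → Fin k) → Unique (toL f) → ∀ i j → f i ≡ f j → i ≡ j
toL-lookup-injective f u Fin.zero Fin.zero e = refl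
toL-lookup-injective f (a ∷ u) Fin.zero (Fin.suc j) e = contradiction (cong toℕ e) (Allₚ.tabulate⁻ a j)
toL-lookup-injective f (a ∷ u) (Fin.suc i) Fin.zero e = contradiction (cong toℕ (sym e)) (Allₚ.tabulate⁻ a i)
toL-lookup-injective f (a ∷ u) (Fin.suc i) (Fin.suc j) e = cong Fin.suc (toL-lookup-injective (f ∘ Fin.suc) u i j e)

-- Lattice words as paths in the Weyl chamber

add? : ∀ s r → Dec (Add s r)
add? s zero = yes tt
add? s (suc r) = s (suc r) <? s r

ext : ℕ → List ℕ → List (List ℕ)
ext d w = map (_∷ w) (filter (add? (cnt w)) (upTo d))

words : ℕ → ℕ → List (List ℕ)
words d zero = [] ∷ []
words d (suc N) = concatMap (ext d) (words d N)

∈-words⁻ : ∀ d N {w} → w ∈ words d N → length w ≡ N × All (_< d) w × Lat w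
∈-words⁻ d zero (here refl) = refl , [] , tt
∈-words⁻ d (suc N) i with ∈-concatMap⁻′ (ext d) (words d N) i
... | w , j , k with ∈-map⁻ _ k | ∈-words⁻ d N j
... | r , p , refl | refl , a , l with ∈-filter⁻ (add? (cnt w)) {xs = upTo d} p
... | q , ad = refl , ∈-upTo⁻ q ∷ a , ad , l

∈-words⁺ : ∀ d N w → length w ≡ N → All (_< d) w → Lat w → w ∈ words d N
∈-words⁺ d zero [] e a l = here refl
∈-words⁺ d (suc N) (r ∷ w) e (lt ∷ a) (ad , l) = ∈-concatMap⁺′ {G = ext d}
  (∈-words⁺ d N w (suc-injective e) a l) (∈-map⁺ _ (∈-filter⁺ (add? (cnt w)) (∈-upTo⁺ lt) ad))

words-unique : ∀ d N → Unique (words d N)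
words-unique d zero = [] ∷ []
words-unique d (suc N) = Unique-concatMap (ext d) (words-unique d N)
  (λ w → Uniqueₚ.map⁺ ∷-injectiveˡ (Uniqueₚ.filter⁺ (add? (cnt w)) (Uniqueₚ.upTo⁺ d)))
  λ i j → let (_ , _ , p) = ∈-map⁻ _ i ; (_ , _ , q) = ∈-map⁻ _ j in ∷-injectiveʳ (trans (sym p) q)

-- The shape c as the strictly decreasing sequence c i + (d - 1 - i).
lst : ℕ → (ℕ → ℕ) → List ℕ
lst zero c = []
lst (suc d) c = c 0 + d ∷ lst d (c ∘ suc)

ρ : ℕ → List ℕ
ρ d = lst d (λ _ → 0)

Desc : List ℕ → Set
Desc [] = ⊤
Desc (x ∷ l) = All (_< x) l × Desc l

desc? : ∀ l → Dec (Desc l)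
desc? [] = yes tt
desc? (x ∷ l) = All.all? (_<? x) l ×-dec desc? l

ups : List ℕ → List (List ℕ)
ups [] = []
ups (x ∷ l) = (suc x ∷ l) ∷ map (x ∷_) (ups l)

-- Endpoints of the paths from `ρ d`, repeated once for every path. The multiplicity of a sequence
-- is therefore the number f of standard tableaux of its shape, and a sum of F over this list is the
-- sum of f F over shapes.
L : ℕ → ℕ → List (List ℕ)
L d zero = ρ d ∷ []
L d (suc N) = concatMap (λ l → filter desc? (ups l)) (L d N)

inc : ℕ → (ℕ → ℕ) → ℕ → ℕ
inc j c i = 𝟙 (j ≟ i) + c i

Antitone : (ℕ → ℕ) → Set
Antitone c = ∀ i → c (suc i) ≤ c i

ups-lst : ∀ d c → ups (lst d c) ≡ map (λ j → lst d (inc j c)) (upTo d)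
ups-lst zero c = refl
ups-lst (suc d) c = cong (lst (suc d) (inc 0 c) ∷_) (begin
  map (c 0 + d ∷_) (ups (lst d (c ∘ suc)))
    ≡⟨ cong (map (c 0 + d ∷_)) (ups-lst d (c ∘ suc)) ⟩
  map (c 0 + d ∷_) (map (λ j → lst d (inc j (c ∘ suc))) (upTo d))
    ≡⟨ sym (map-∘ (upTo d)) ⟩
  map (λ j → lst (suc d) (inc (suc j) c)) (upTo d)
    ≡⟨ map-∘ (upTo d) ⟩
  map (λ j → lst (suc d) (inc j c)) (map suc (upTo d))
    ≡⟨ cong (map (λ j → lst (suc d) (inc j c))) (map-upTo suc d) ⟩
  map (λ j → lst (suc d) (inc j c)) (applyUpTo suc d) ∎)
  where open ≡-Reasoning

lst-< : ∀ d c b → Antitone c → c 0 ≤ b → All (_< b + d) (lst d c)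
lst-< zero c b h le = []
lst-< (suc d) c b h le = subst (c 0 + d <_) (sym (+-suc b d)) (s≤s (+-monoˡ-≤ d le)) ∷
  All.map (λ lt → <-≤-trans lt (+-monoʳ-≤ b (n≤1+n d))) (lst-< d (c ∘ suc) b (h ∘ suc) (≤-trans (h 0) le))

desc-lst : ∀ d c → Antitone c → Desc (lst d c)
desc-lst zero c h = tt
desc-lst (suc d) c h = lst-< d (c ∘ suc) (c 0) (h ∘ suc) (h 0) , desc-lst d (c ∘ suc) (h ∘ suc)

lst-desc : ∀ d c → Desc (lst d c) → ∀ j → suc j < d → c (suc j) ≤ c j
lst-desc (suc zero) c h zero (s≤s ())
lst-desc (suc (suc d)) c ((lt ∷ _) , _) zero _ =
  +-cancelʳ-≤ d _ _ (s≤s⁻¹ (subst (suc (c 1 + d) ≤_) (+-suc (c 0) d) lt))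
lst-desc (suc d) c (_ , h) (suc j) lt = lst-desc d (c ∘ suc) h j (s≤s⁻¹ lt)

Add⇒Antitone : ∀ c j → Antitone c → Add c j → Antitone (inc j c)
Add⇒Antitone c j h a i with j ≟ suc i
... | yes refl rewrite 𝟙-yes (suc i ≟ suc i) refl | 𝟙-no (suc i ≟ i) 1+n≢n = a
... | no ne rewrite 𝟙-no (j ≟ suc i) ne = ≤-trans (h i) (m≤n+m _ _)

Desc⇒Add : ∀ d c j → j < d → Desc (lst d (inc j c)) → Add c j
Desc⇒Add d c zero lt h = tt
Desc⇒Add d c (suc j) lt h with lst-desc d (inc (suc j) c) h j lt
... | le rewrite 𝟙-yes (suc j ≟ suc j) refl | 𝟙-no (suc j ≟ j) 1+n≢n = le

map-filter : ∀ {A B : Set} {P : Pred A 0ℓ} {Q : Pred B 0ℓ} (P? : Decidable P) (Q? : Decidable Q) (f : A → B) xs →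
  (∀ {x} → x ∈ xs → P x → Q (f x)) → (∀ {x} → x ∈ xs → Q (f x) → P x) →
  map f (filter P? xs) ≡ filter Q? (map f xs)
map-filter P? Q? f [] s t = refl
map-filter P? Q? f (x ∷ xs) s t with P? x
... | yes p = trans (cong (f x ∷_) (map-filter P? Q? f xs (s ∘ there) (t ∘ there)))
  (sym (filter-accept Q? (s (here refl) p)))
... | no ¬p = trans (map-filter P? Q? f xs (s ∘ there) (t ∘ there))
  (sym (filter-reject Q? (¬p ∘ t (here refl))))

concatMap-cong-∈ : ∀ {A B : Set} {f g : A → List B} xs → (∀ {x} → x ∈ xs → f x ≡ g x) →
  concatMap f xs ≡ concatMap g xs
concatMap-cong-∈ [] h = refl
concatMap-cong-∈ (x ∷ xs) h = cong₂ _++_ (h (here refl)) (concatMap-cong-∈ xs (h ∘ there))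

-- An equality of lists and not just of counts: `ups` raises the entries in the order of `upTo d`,
-- and a box may be added exactly when the raised sequence still decreases strictly.
words-L : ∀ d N → map (lst d ∘ cnt) (words d N) ≡ L d N
words-L d zero = refl
words-L d (suc N) = begin
  map (lst d ∘ cnt) (concatMap (ext d) (words d N))
    ≡⟨ map-concatMap (lst d ∘ cnt) (ext d) (words d N) ⟩
  concatMap (map (lst d ∘ cnt) ∘ ext d) (words d N)
    ≡⟨ concatMap-cong-∈ (words d N) one ⟩
  concatMap ((λ l → filter desc? (ups l)) ∘ (lst d ∘ cnt)) (words d N)
    ≡⟨ sym (concatMap-map (λ l → filter desc? (ups l)) (lst d ∘ cnt) (words d N)) ⟩
  concatMap (λ l → filter desc? (ups l)) (map (lst d ∘ cnt) (words d N))
    ≡⟨ cong (concatMap (λ l → filter desc? (ups l))) (words-L d N) ⟩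
  L d (suc N) ∎
  where
  open ≡-Reasoning
  one : ∀ {w} → w ∈ words d N → map (lst d ∘ cnt) (ext d w) ≡ filter desc? (ups (lst d (cnt w)))
  one {w} i = begin
    map (lst d ∘ cnt) (map (_∷ w) (filter (add? (cnt w)) (upTo d)))
      ≡⟨ sym (map-∘ (filter (add? (cnt w)) (upTo d))) ⟩
    map (λ j → lst d (inc j (cnt w))) (filter (add? (cnt w)) (upTo d))
      ≡⟨ map-filter (add? (cnt w)) desc? (λ j → lst d (inc j (cnt w))) (upTo d)
           (λ {j} _ a → desc-lst d _ (Add⇒Antitone (cnt w) j anti a))
           (λ {j} k h → Desc⇒Add d (cnt w) j (∈-upTo⁻ k) h) ⟩
    filter desc? (map (λ j → lst d (inc j (cnt w))) (upTo d))
      ≡⟨ cong (filter desc?) (sym (ups-lst d (cnt w))) ⟩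
    filter desc? (ups (lst d (cnt w))) ∎
    where
    anti : Antitone (cnt w)
    anti = sh-antitone (map just w) (proj₂ (proj₂ (∈-words⁻ d N i)))

_≟ᴸ_ : (l l′ : List ℕ) → Dec (l ≡ l′)
_≟ᴸ_ = ≡-dec _≟_

mult : List (List ℕ) → List ℕ → ℕ
mult xs l = ∑ xs (λ x → 𝟙 (x ≟ᴸ l))

count-shape : ∀ d N l → length (filter (λ u → lst d (cnt u) ≟ᴸ l) (words d N)) ≡ mult (L d N) l
count-shape d N l = begin
  length (filter (λ u → lst d (cnt u) ≟ᴸ l) (words d N)) ≡⟨ length-filter-∑ _ (words d N) ⟩
  ∑ (words d N) (λ u → 𝟙 (lst d (cnt u) ≟ᴸ l)) ≡⟨ sym (∑-map (lst d ∘ cnt) (words d N) (λ x → 𝟙 (x ≟ᴸ l))) ⟩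
  mult (map (lst d ∘ cnt) (words d N)) l ≡⟨ cong (λ xs → mult xs l) (words-L d N) ⟩
  mult (L d N) l ∎
  where open ≡-Reasoning

lst-cong : ∀ d {c c′} → c ≗ c′ → lst d c ≡ lst d c′
lst-cong zero e = refl
lst-cong (suc d) e = cong₂ _∷_ (cong (_+ d) (e 0)) (lst-cong d (e ∘ suc))

lst-injective : ∀ d {c c′} → lst d c ≡ lst d c′ → ∀ i → i < d → c i ≡ c′ i
lst-injective (suc d) e zero lt = +-cancelʳ-≡ d _ _ (∷-injectiveˡ e)
lst-injective (suc d) e (suc i) lt = lst-injective d (∷-injectiveʳ e) i (s≤s⁻¹ lt)

same-shape : ∀ d u v → All (_< d) u → All (_< d) v → lst d (cnt u) ≡ lst d (cnt v) → cnt u ≗ cnt v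
same-shape d u v a b e i with i <? d
... | yes lt = lst-injective d e i lt
... | no ¬lt = trans (cnt-absent d u a (≮⇒≥ ¬lt)) (sym (cnt-absent d v b (≮⇒≥ ¬lt)))

module _ (d m : ℕ) where

  pairs : List (List ℕ × List ℕ)
  pairs = concatMap (λ u → map (u ,_) (filter (λ v → lst d (cnt v) ≟ᴸ lst d (cnt u)) (words d m))) (words d m)

  length-pairs : length pairs ≡ ∑ (L d m) (mult (L d m))
  length-pairs = begin
    length pairs ≡⟨ length-concatMap _ (words d m) ⟩
    ∑ (words d m) (λ u → length (map (u ,_) (filter (λ v → lst d (cnt v) ≟ᴸ lst d (cnt u)) (words d m))))
      ≡⟨ ∑-cong (words d m) (λ {u} _ → trans (length-map (u ,_) (filter _ (words d m))) (count-shape d m (lst d (cnt u)))) ⟩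
    ∑ (words d m) (λ u → mult (L d m) (lst d (cnt u)))
      ≡⟨ sym (∑-map (lst d ∘ cnt) (words d m) (mult (L d m))) ⟩
    ∑ (map (lst d ∘ cnt) (words d m)) (mult (L d m)) ≡⟨ cong (λ xs → ∑ xs (mult (L d m))) (words-L d m) ⟩
    ∑ (L d m) (mult (L d m)) ∎
    where open ≡-Reasoning

  pairs-unique : Unique pairs
  pairs-unique = Unique-concatMap _ (words-unique d m)
    (λ u → Uniqueₚ.map⁺ (λ e → cong proj₂ e) (Uniqueₚ.filter⁺ _ (words-unique d m)))
    λ i j → let (_ , _ , p) = ∈-map⁻ _ i ; (_ , _ , q) = ∈-map⁻ _ j in cong proj₁ (trans (sym p) q)

  private
    -- Both tableaux are transposed: `lds` is the length of row 0, so avoidance bounds the number of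
    -- columns, while `words d m` bounds the letters, that is, the number of rows. `Lat` is carried
    -- along because `tr` is inverted on lattice words.
    R : List ℕ → List ℕ × List ℕ → Set
    R w (u , v) = RS m w (map just (tr u)) (tr v) × Lat u × Lat v

    avoid-resp : ∀ {f g : Word m} → f ≗ g → AvoidDec d f → AvoidDec d g
    avoid-resp {f} {g} e (p , a) = (λ i j h → p i j (trans (e i) (trans h (sym (e j))))) ,
      lds⇒avoid d g (subst (λ w → lds w m ≤ d) (toL-cong e) (avoid⇒lds d f a))

    forth : ∀ {w} → w ∈ enum m m (avoidDec? d) → ∃ λ uv → uv ∈ pairs × R w uv
    forth i with ∈-enum⁻ m m (avoidDec? d) i
    ... | f , (p , a) , refl with RS-total m (toL f) (toL-unique f p) (toL-bound f)
    ... | C , Q , s with RS-full m s (length-tabulate _)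
    ... | P , refl with RS-valid m s
    ... | lP , lQ , e = (tr P , tr Q) ,
      ∈-concatMap⁺′ (∈-words⁺ d m (tr P) lenP (tr-letters d P lP ≤d) (tr-Lat P lP))
        (∈-map⁺ _ (∈-filter⁺ _ (∈-words⁺ d m (tr Q) lenQ (tr-letters d Q lQ (subst (_≤ d) (e 0) ≤d)) (tr-Lat Q lQ))
          (lst-cong d (λ j → sym (tr-shape P Q lP lQ e j))))) ,
      subst₂ (λ P Q → RS m (toL f) (map just P) Q) (sym (tr-involutive P lP)) (sym (tr-involutive Q lQ)) s ,
      tr-Lat P lP , tr-Lat Q lQ
      where
      ≤d : cnt P 0 ≤ d
      ≤d = subst (_≤ d) (sym (RS-lds m s)) (avoid⇒lds d f a)
      lenP : length (tr P) ≡ m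
      lenP = trans (tr-length P) (trans (sym (length-map just P)) (RS-length m s))
      lenQ : length (tr Q) ≡ m
      lenQ = trans (tr-length Q) (trans (sym (RS-length-Q m s)) (length-tabulate _))

    back : ∀ {uv} → uv ∈ pairs → ∃ λ w → w ∈ enum m m (avoidDec? d) × R w uv
    back i with ∈-concatMap⁻′ _ (words d m) i
    ... | u , j , k with ∈-map⁻ _ k
    ... | v , l , refl with ∈-filter⁻ _ {xs = words d m} l
    ... | l′ , e with ∈-words⁻ d m j | ∈-words⁻ d m l′
    ... | lenu , au , lu | lenv , av , lv
      with RS-surjective m (map just (tr u)) (tr v) (tr-Lat u lu) (tr-Lat v lv)
        (tr-shape u v lu lv (same-shape d u v au av (sym e)))
        (trans (length-map just (tr u)) (trans (tr-length u) lenu))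
    ... | w , s with RS-letters m s
    ... | uw , aw with toL-surjective m m w (trans (RS-length-Q m s) (trans (tr-length v) lenv)) aw
    ... | f , refl = toL f , ∈-enum⁺ m m (avoidDec? d) avoid-resp f
      (toL-lookup-injective f uw , lds⇒avoid d f (subst (_≤ d) (RS-lds m s) (tr-columns d u lu au))) , s , lu , lv

    unique : ∀ {w uv uv′} → R w uv → R w uv′ → uv ≡ uv′
    unique {uv = u , v} {u′ , v′} (s , lu , lv) (t , lu′ , lv′) with RS-functional m s t
    ... | p , q = cong₂ _,_ (inv lu lu′ (map-injective just-injective p)) (inv lv lv′ q)
      where
      inv : ∀ {x y} → Lat x → Lat y → tr x ≡ tr y → x ≡ y
      inv {x} {y} lx ly e = trans (sym (tr-involutive x lx)) (trans (cong tr e) (tr-involutive y ly))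

  numAvoid-∑ : numAvoid d m ≡ ∑ (L d m) (mult (L d m))
  numAvoid-∑ = begin
    numAvoid d m ≡⟨ sym (length-enum m m (avoidDec? d)) ⟩
    length (enum m m (avoidDec? d))
      ≡⟨ length-≡ R _ pairs (enum-unique m m (avoidDec? d)) pairs-unique forth back
           (λ (s , _) (t , _) → RS-injective m s t) unique ⟩
    length pairs ≡⟨ length-pairs ⟩
    ∑ (L d m) (mult (L d m)) ∎
    where open ≡-Reasoning

open import Data.Integer as Int using (ℤ; +_; -[1+_])
import Data.Integer.Properties as ℤₚ
import Data.Integer.Tactic.RingSolver as ℤSolver

-- The Frobenius formula

module Harmonic where
  open Int using (_-_; -_) renaming (_+_ to infixl 6 _+ᶻ_; _*_ to infixl 7 _*ᶻ_)

  P : ℤ → List ℤ → ℤ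
  P t [] = + 1
  P t (y ∷ ys) = (t - y) *ᶻ P t ys

  Δ : List ℤ → ℤ
  Δ [] = + 1
  Δ (x ∷ xs) = P x xs *ᶻ Δ xs

  -- The sum over i of φ applied to the i-th entry, the other entries, and the list with that entry decremented.
  sumP : (ℤ → List ℤ → List ℤ → ℤ) → List ℤ → ℤ
  sumP φ [] = + 0
  sumP φ (x ∷ xs) = φ x xs (x - + 1 ∷ xs) +ᶻ sumP (λ y o p → φ y (x ∷ o) (x ∷ p)) xs

  -- All that the inductions use about an entry `y`, the other entries `o` and the list `p` with `y`
  -- lowered. Only the polynomials `P` are recorded, so positions in the list never matter.
  record Removes (xs : List ℤ) (y : ℤ) (o p : List ℤ) : Set where
    field
      P-all : ∀ t → P t xs ≡ P t o *ᶻ (t - y)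
      P-dec : ∀ t → P t p ≡ P t o *ᶻ (t - y +ᶻ + 1)
  open Removes

  sumP-cong : ∀ xs {φ ψ} → (∀ y o p → Removes xs y o p → φ y o p ≡ ψ y o p) → sumP φ xs ≡ sumP ψ xs
  sumP-cong [] h = refl
  sumP-cong (x ∷ xs) h = cong₂ _+ᶻ_
    (h x xs (x - + 1 ∷ xs) record { P-all = λ t → ℤₚ.*-comm (t - x) (P t xs) ; P-dec = λ t → dec t x (P t xs) })
    (sumP-cong xs λ y o p r → h y (x ∷ o) (x ∷ p) record
      { P-all = λ t → trans (cong ((t - x) *ᶻ_) (P-all r t)) (sym (ℤₚ.*-assoc (t - x) (P t o) (t - y)))
      ; P-dec = λ t → trans (cong ((t - x) *ᶻ_) (P-dec r t)) (sym (ℤₚ.*-assoc (t - x) (P t o) (t - y +ᶻ + 1))) })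
    where
    dec : ∀ t x a → (t - (x - + 1)) *ᶻ a ≡ a *ᶻ (t - x +ᶻ + 1)
    dec = ℤSolver.solve-∀

  sumP-linear : ∀ a b xs φ ψ →
    sumP (λ y o p → a *ᶻ φ y o p +ᶻ b *ᶻ ψ y o p) xs ≡ a *ᶻ sumP φ xs +ᶻ b *ᶻ sumP ψ xs
  sumP-linear a b [] φ ψ = zeros a b
    where
    zeros : ∀ a b → + 0 ≡ a *ᶻ + 0 +ᶻ b *ᶻ + 0
    zeros = ℤSolver.solve-∀
  sumP-linear a b (x ∷ xs) φ ψ = trans
    (cong (a *ᶻ φ x xs (x - + 1 ∷ xs) +ᶻ b *ᶻ ψ x xs (x - + 1 ∷ xs) +ᶻ_)
      (sumP-linear a b xs (λ y o p → φ y (x ∷ o) (x ∷ p)) (λ y o p → ψ y (x ∷ o) (x ∷ p))))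
    (regroup a b (φ x xs (x - + 1 ∷ xs)) (ψ x xs (x - + 1 ∷ xs))
      (sumP (λ y o p → φ y (x ∷ o) (x ∷ p)) xs) (sumP (λ y o p → ψ y (x ∷ o) (x ∷ p)) xs))
    where
    regroup : ∀ a b u v s t → a *ᶻ u +ᶻ b *ᶻ v +ᶻ (a *ᶻ s +ᶻ b *ᶻ t) ≡ a *ᶻ (u +ᶻ s) +ᶻ b *ᶻ (v +ᶻ t)
    regroup = ℤSolver.solve-∀

  S : List ℤ → ℤ
  S = sumP (λ y _ p → y *ᶻ Δ p)

  G : ℤ → List ℤ → ℤ
  G t = sumP (λ y o p → y *ᶻ (P t o *ᶻ Δ p))

  len : List ℤ → ℤ
  len [] = + 0
  len (_ ∷ xs) = + 1 +ᶻ len xs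

  triℤ : List ℤ → ℤ
  triℤ [] = + 0
  triℤ (_ ∷ xs) = len xs +ᶻ triℤ xs

  sumℤ : List ℤ → ℤ
  sumℤ [] = + 0
  sumℤ (x ∷ xs) = x +ᶻ sumℤ xs

  -- Partial fractions of t P(t - 1) / P(t), cleared of denominators.
  G-eq : ∀ t xs → G t xs ≡ Δ xs *ᶻ ((t - len xs) *ᶻ P t xs - t *ᶻ P (t - + 1) xs)
  G-eq t [] = zero-eq t
    where
    zero-eq : ∀ t → + 0 ≡ + 1 *ᶻ ((t - + 0) *ᶻ + 1 - t *ᶻ + 1)
    zero-eq = ℤSolver.solve-∀
  G-eq t (x ∷ xs) = begin
    head +ᶻ sumP (λ y o p → y *ᶻ ((t - x) *ᶻ P t o *ᶻ (P x p *ᶻ Δ p))) xs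
      ≡⟨ cong (λ z → head +ᶻ z) (sumP-cong xs λ y o p r → summand y o p r) ⟩
    head +ᶻ sumP (λ y o p → P t xs *ᶻ (y *ᶻ (P x o *ᶻ Δ p)) +ᶻ (- (x - t +ᶻ + 1) *ᶻ P x xs) *ᶻ (y *ᶻ (P t o *ᶻ Δ p))) xs
      ≡⟨ cong (λ z → head +ᶻ z) (sumP-linear (P t xs) (- (x - t +ᶻ + 1) *ᶻ P x xs) xs _ _) ⟩
    head +ᶻ (P t xs *ᶻ G x xs +ᶻ (- (x - t +ᶻ + 1) *ᶻ P x xs) *ᶻ G t xs)
      ≡⟨ cong₂ (λ a b → head +ᶻ (P t xs *ᶻ a +ᶻ (- (x - t +ᶻ + 1) *ᶻ P x xs) *ᶻ b)) (G-eq x xs) (G-eq t xs) ⟩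
    head +ᶻ (P t xs *ᶻ (Δ xs *ᶻ ((x - len xs) *ᶻ P x xs - x *ᶻ P (x - + 1) xs)) +ᶻ
      (- (x - t +ᶻ + 1) *ᶻ P x xs) *ᶻ (Δ xs *ᶻ ((t - len xs) *ᶻ P t xs - t *ᶻ P (t - + 1) xs)))
      ≡⟨ final t x (Δ xs) (len xs) (P t xs) (P x xs) (P (x - + 1) xs) (P (t - + 1) xs) ⟩
    P x xs *ᶻ Δ xs *ᶻ ((t - (+ 1 +ᶻ len xs)) *ᶻ ((t - x) *ᶻ P t xs) - t *ᶻ ((t - + 1 - x) *ᶻ P (t - + 1) xs)) ∎
    where
    open ≡-Reasoning
    head : ℤ
    head = x *ᶻ (P t xs *ᶻ (P (x - + 1) xs *ᶻ Δ xs))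
    -- From `(t - x)(x - y + 1) = (t - y) - (x - t + 1)(x - y)`: the summand splits into two of the
    -- same kind, one at `x` and one at `t`, so that induction applies to both.
    expand : ∀ t x y a b D → y *ᶻ ((t - x) *ᶻ a *ᶻ (b *ᶻ (x - y +ᶻ + 1) *ᶻ D)) ≡
      (a *ᶻ (t - y)) *ᶻ (y *ᶻ (b *ᶻ D)) +ᶻ (- (x - t +ᶻ + 1) *ᶻ (b *ᶻ (x - y))) *ᶻ (y *ᶻ (a *ᶻ D))
    expand = ℤSolver.solve-∀
    summand : ∀ y o p → Removes xs y o p → y *ᶻ ((t - x) *ᶻ P t o *ᶻ (P x p *ᶻ Δ p)) ≡
      P t xs *ᶻ (y *ᶻ (P x o *ᶻ Δ p)) +ᶻ (- (x - t +ᶻ + 1) *ᶻ P x xs) *ᶻ (y *ᶻ (P t o *ᶻ Δ p))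
    summand y o p r rewrite P-dec r x | P-all r t | P-all r x = expand t x y (P t o) (P x o) (Δ p)
    final : ∀ t x D n a b c e → x *ᶻ (a *ᶻ (c *ᶻ D)) +ᶻ (a *ᶻ (D *ᶻ ((x - n) *ᶻ b - x *ᶻ c)) +ᶻ
      (- (x - t +ᶻ + 1) *ᶻ b) *ᶻ (D *ᶻ ((t - n) *ᶻ a - t *ᶻ e))) ≡
      b *ᶻ D *ᶻ ((t - (+ 1 +ᶻ n)) *ᶻ ((t - x) *ᶻ a) - t *ᶻ ((t - + 1 - x) *ᶻ e))
    final = ℤSolver.solve-∀

  -- Split off the head `x`: lowering a tail entry `y` turns the factor `x - y` of Δ into
  -- `x - y + 1`. The first summand gives `S xs`, and the extra 1 leaves the correction `G x xs`,
  -- which `G-eq` evaluates.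
  S-eq : ∀ xs → S xs ≡ (sumℤ xs - triℤ xs) *ᶻ Δ xs
  S-eq [] = refl
  S-eq (x ∷ xs) = begin
    head +ᶻ sumP (λ y o p → y *ᶻ (P x p *ᶻ Δ p)) xs
      ≡⟨ cong (λ z → head +ᶻ z) (sumP-cong xs λ y o p r → summand y o p r) ⟩
    head +ᶻ sumP (λ y o p → P x xs *ᶻ (y *ᶻ Δ p) +ᶻ + 1 *ᶻ (y *ᶻ (P x o *ᶻ Δ p))) xs
      ≡⟨ cong (λ z → head +ᶻ z) (sumP-linear (P x xs) (+ 1) xs _ _) ⟩
    head +ᶻ (P x xs *ᶻ S xs +ᶻ + 1 *ᶻ G x xs)
      ≡⟨ cong₂ (λ a b → head +ᶻ (P x xs *ᶻ a +ᶻ + 1 *ᶻ b)) (S-eq xs) (G-eq x xs) ⟩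
    head +ᶻ (P x xs *ᶻ ((sumℤ xs - triℤ xs) *ᶻ Δ xs) +ᶻ + 1 *ᶻ (Δ xs *ᶻ ((x - len xs) *ᶻ P x xs - x *ᶻ P (x - + 1) xs)))
      ≡⟨ final x (Δ xs) (len xs) (P x xs) (P (x - + 1) xs) (sumℤ xs) (triℤ xs) ⟩
    (x +ᶻ sumℤ xs - (len xs +ᶻ triℤ xs)) *ᶻ (P x xs *ᶻ Δ xs) ∎
    where
    open ≡-Reasoning
    head : ℤ
    head = x *ᶻ (P (x - + 1) xs *ᶻ Δ xs)
    expand : ∀ x y b D → y *ᶻ (b *ᶻ (x - y +ᶻ + 1) *ᶻ D) ≡ (b *ᶻ (x - y)) *ᶻ (y *ᶻ D) +ᶻ + 1 *ᶻ (y *ᶻ (b *ᶻ D))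
    expand = ℤSolver.solve-∀
    summand : ∀ y o p → Removes xs y o p → y *ᶻ (P x p *ᶻ Δ p) ≡ P x xs *ᶻ (y *ᶻ Δ p) +ᶻ + 1 *ᶻ (y *ᶻ (P x o *ᶻ Δ p))
    summand y o p r rewrite P-dec r x | P-all r x = expand x y (P x o) (Δ p)
    final : ∀ x D n b c s u → x *ᶻ (c *ᶻ D) +ᶻ (b *ᶻ ((s - u) *ᶻ D) +ᶻ + 1 *ᶻ (D *ᶻ ((x - n) *ᶻ b - x *ᶻ c))) ≡
      (x +ᶻ s - (n +ᶻ u)) *ᶻ (b *ᶻ D)
    final = ℤSolver.solve-∀

factorials : List ℕ → ℕ
factorials l = product (map _! l)

tri : ℕ → ℕ
tri zero = 0
tri (suc d) = d + tri d

distances : ℕ → List ℕ → ℕ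
distances x [] = 1
distances x (y ∷ l) = ∣ x - y ∣ * distances x l

-- The absolute value of the Vandermonde product.
δ : List ℕ → ℕ
δ [] = 1
δ (x ∷ l) = distances x l * δ l

downs : List ℕ → List (List ℕ)
downs [] = []
downs (zero ∷ l) = map (zero ∷_) (downs l)
downs (suc x ∷ l) = (x ∷ l) ∷ map (suc x ∷_) (downs l)

∣Δ∣≡δ : ∀ l → Int.∣ Harmonic.Δ (map +_ l) ∣ ≡ δ l
∣Δ∣≡δ [] = refl
∣Δ∣≡δ (x ∷ l) = trans (ℤₚ.abs-* (Harmonic.P (+ x) (map +_ l)) _) (cong₂ _*_ (∣P∣ l) (∣Δ∣≡δ l))
  where
  ∣-∣ : ∀ x y → Int.∣ + x Int.- + y ∣ ≡ ∣ x - y ∣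
  ∣-∣ x y with ≤-total x y
  ... | inj₁ le = trans (cong Int.∣_∣ (ℤₚ.[+m]-[+n]≡m⊖n x y)) (trans (ℤₚ.∣⊖∣-≤ le) (sym (m≤n⇒∣m-n∣≡n∸m le)))
  ... | inj₂ le = trans (cong Int.∣_∣ (ℤₚ.[+m]-[+n]≡m⊖n x y)) (trans (cong Int.∣_∣ (ℤₚ.⊖-≥ le)) (sym (m≤n⇒∣n-m∣≡n∸m le)))
  ∣P∣ : ∀ l → Int.∣ Harmonic.P (+ x) (map +_ l) ∣ ≡ distances x l
  ∣P∣ [] = refl
  ∣P∣ (y ∷ l) = trans (ℤₚ.abs-* (+ x Int.- + y) _) (cong₂ _*_ (∣-∣ x y) (∣P∣ l))

module _ where
  open Harmonic

  sumℤ-map : ∀ l → sumℤ (map +_ l) ≡ + sum l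
  sumℤ-map [] = refl
  sumℤ-map (x ∷ l) = trans (cong (Int._+_ (+ x)) (sumℤ-map l)) (sym (ℤₚ.pos-+ x (sum l)))

  len-map : ∀ l → len (map +_ l) ≡ + length l
  len-map [] = refl
  len-map (x ∷ l) = cong (Int._+_ (+ 1)) (len-map l)

  triℤ-map : ∀ l → triℤ (map +_ l) ≡ + tri (length l)
  triℤ-map [] = refl
  triℤ-map (x ∷ l) = trans (cong₂ Int._+_ (len-map l) (triℤ-map l)) (sym (ℤₚ.pos-+ (length l) _))

  -- Lowering an entry `x` divides the product of the factorials by `x`, which produces the weights
  -- of `sumP`. A zero entry has no predecessor in `downs`, and in `sumP` its weight is 0. A general
  -- `Ψ` is needed so that the induction can put fixed entries in front.
  ∑-downs : ∀ y (ψ : List ℕ → ℕ) (Ψ : List ℤ → ℤ) →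
    (∀ {y′} → y′ ∈ downs y → + (ψ y′ * factorials y′) ≡ Ψ (map +_ y′)) →
    + (∑ (downs y) ψ * factorials y) ≡ sumP (λ x _ p → x Int.* Ψ p) (map +_ y)
  ∑-downs-tail : ∀ x y (ψ : List ℕ → ℕ) (Ψ : List ℤ → ℤ) →
    (∀ {y′} → y′ ∈ map (x ∷_) (downs y) → + (ψ y′ * factorials y′) ≡ Ψ (map +_ y′)) →
    + (∑ (map (x ∷_) (downs y)) ψ * factorials (x ∷ y)) ≡
    sumP (λ z _ p → z Int.* Ψ (+ x ∷ p)) (map +_ y)

  ∑-downs-tail x y ψ Ψ h = trans (cong +_ regroup)
    (∑-downs y (λ y′ → ψ (x ∷ y′) * x !) (λ p → Ψ (+ x ∷ p))
      λ {y′} i → trans (cong +_ (*-assoc (ψ (x ∷ y′)) (x !) _)) (h (∈-map⁺ _ i)))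
    where
    regroup : ∑ (map (x ∷_) (downs y)) ψ * (x ! * factorials y) ≡
      ∑ (downs y) (λ y′ → ψ (x ∷ y′) * x !) * factorials y
    regroup = trans (sym (*-assoc (∑ (map (x ∷_) (downs y)) ψ) (x !) _)) (cong (_* factorials y)
      (trans (cong (_* x !) (∑-map (x ∷_) (downs y) ψ)) (sym (∑-*ʳ (downs y) (ψ ∘ (x ∷_)) (x !)))))

  ∑-downs [] ψ Ψ h = refl
  ∑-downs (zero ∷ y) ψ Ψ h = trans (∑-downs-tail zero y ψ Ψ h)
    (sym (ℤₚ.+-identityˡ _))
  ∑-downs (suc x ∷ y) ψ Ψ h = trans (cong +_ (*-distribʳ-+ (factorials (suc x ∷ y)) (ψ (x ∷ y)) _))
    (trans (ℤₚ.pos-+ (ψ (x ∷ y) * factorials (suc x ∷ y)) _)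
      (cong₂ Int._+_ head (∑-downs-tail (suc x) y ψ Ψ (h ∘ there))))
    where
    regroup : ∀ a x b c → a * ((1 + x) * b * c) ≡ (1 + x) * (a * (b * c))
    regroup = solve-∀
    head : + (ψ (x ∷ y) * factorials (suc x ∷ y)) ≡ + suc x Int.* Ψ (+ x ∷ map +_ y)
    head = trans (cong +_ (regroup (ψ (x ∷ y)) x (x !) (factorials y)))
      (trans (ℤₚ.pos-* (suc x) _) (cong (Int._*_ (+ suc x)) (h (here refl))))

downs-sum : ∀ y {y′} → y′ ∈ downs y → sum y ≡ suc (sum y′)
downs-sum (zero ∷ y) i with ∈-map⁻ _ i
... | _ , j , refl = downs-sum y j
downs-sum (suc x ∷ y) (here refl) = refl
downs-sum (suc x ∷ y) (there i) with ∈-map⁻ _ i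
... | y′ , j , refl = trans (cong (λ z → suc x + z) (downs-sum y j)) (+-suc (suc x) (sum y′))

downs-length : ∀ y {y′} → y′ ∈ downs y → length y′ ≡ length y
downs-length (zero ∷ y) i with ∈-map⁻ _ i
... | _ , j , refl = cong suc (downs-length y j)
downs-length (suc x ∷ y) (here refl) = refl
downs-length (suc x ∷ y) (there i) with ∈-map⁻ _ i
... | y′ , j , refl = cong suc (downs-length y j)

-- The path count needs only these facts, so one argument serves the decreasing sequences and the
-- increasing sequences that arise as complements. By `boundary`, a step out of the chamber ends on
-- a wall, where the Vandermonde product is zero.
record Chamber (d : ℕ) : Set₁ where
  field
    Adm : List ℕ → Set
    adm? : ∀ l → Dec (Adm l)
    base : List ℕ
    base-adm : Adm base
    base-unique : ∀ y → Adm y → length y ≡ d → sum y ≡ tri d → y ≡ base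
    base-δ : factorials base ≡ δ base
    boundary : ∀ {y y′} → Adm y → y′ ∈ downs y → ¬ Adm y′ → δ y′ ≡ 0

module Paths {d : ℕ} (𝒞 : Chamber d) where
  open Chamber 𝒞
  open Harmonic

  -- The number of K-step paths from base to y inside the chamber.
  H : ℕ → List ℕ → ℕ
  H zero y = 𝟙 (y ≟ᴸ base)
  H (suc K) y = 𝟙 (adm? y) * ∑ (downs y) (H K)

  H-outside : ∀ K y → ¬ Adm y → H K y ≡ 0
  H-outside zero y ¬a = 𝟙-no (y ≟ᴸ base) λ { refl → ¬a base-adm }
  H-outside (suc K) y ¬a = cong (_* ∑ (downs y) (H K)) (𝟙-no (adm? y) ¬a)

  private
    sign : ∀ z → ∃ λ s → s Int.* z ≡ + Int.∣ z ∣ × Int.∣ s ∣ ≡ 1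
    sign (+ n) = + 1 , ℤₚ.*-identityˡ (+ n) , refl
    sign -[1+ n ] = -[1+ 0 ] , ℤₚ.-1*i≡-i -[1+ n ] , refl

    -- On increasing sequences Δ may be negative; the sign at the base is the right one for all path
    -- lengths.
    s : ℤ
    s = proj₁ (sign (Δ (map +_ base)))

    -- Divided by `factorials y`, the formula obeys the recursion of `H`: `∑-downs` turns the sum
    -- over predecessors into `S`, and `S-eq` multiplies by the excess of the sum over `tri d`,
    -- which is `suc K`. Predecessors outside the chamber may be included because both sides vanish
    -- there.
    H-Δ : ∀ K y → Adm y → length y ≡ d → sum y ≡ K + tri d →
      + (H K y * factorials y) ≡ + (K !) Int.* (s Int.* Δ (map +_ y))
    H-Δ zero y a len e with base-unique y a len e
    ... | refl rewrite 𝟙-yes (base ≟ᴸ base) refl = begin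
      + (1 * factorials base) ≡⟨ cong +_ (trans (*-identityˡ _) (trans base-δ (sym (∣Δ∣≡δ base)))) ⟩
      + Int.∣ Δ (map +_ base) ∣ ≡⟨ sym (proj₁ (proj₂ (sign (Δ (map +_ base))))) ⟩
      s Int.* Δ (map +_ base) ≡⟨ sym (ℤₚ.*-identityˡ _) ⟩
      + 1 Int.* (s Int.* Δ (map +_ base)) ∎
      where open ≡-Reasoning
    H-Δ (suc K) y a lenₑ e rewrite 𝟙-yes (adm? y) a = begin
      + (1 * ∑ (downs y) (H K) * factorials y) ≡⟨ cong (λ z → + (z * factorials y)) (*-identityˡ (∑ (downs y) (H K))) ⟩
      + (∑ (downs y) (H K) * factorials y)
        ≡⟨ ∑-downs y (H K) (λ p → + (K !) Int.* (s Int.* Δ p)) below ⟩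
      sumP (λ x _ p → x Int.* (+ (K !) Int.* (s Int.* Δ p))) (map +_ y)
        ≡⟨ sumP-cong (map +_ y) (λ x o p _ → pull x (+ (K !)) s (Δ p)) ⟩
      sumP (λ x _ p → (+ (K !) Int.* s) Int.* (x Int.* Δ p) Int.+ + 0 Int.* (x Int.* Δ p)) (map +_ y)
        ≡⟨ sumP-linear (+ (K !) Int.* s) (+ 0) (map +_ y) (λ x _ p → x Int.* Δ p) (λ x _ p → x Int.* Δ p) ⟩
      (+ (K !) Int.* s) Int.* S (map +_ y) Int.+ + 0 Int.* S (map +_ y)
        ≡⟨ cong (λ z → (+ (K !) Int.* s) Int.* z Int.+ + 0 Int.* z) (trans (S-eq (map +_ y)) (cong (Int._* Δ (map +_ y)) excess)) ⟩
      (+ (K !) Int.* s) Int.* (+ suc K Int.* Δ (map +_ y)) Int.+ + 0 Int.* (+ suc K Int.* Δ (map +_ y))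
        ≡⟨ push (+ suc K) (+ (K !)) s (Δ (map +_ y)) ⟩
      (+ suc K Int.* + (K !)) Int.* (s Int.* Δ (map +_ y))
        ≡⟨ cong (Int._* (s Int.* Δ (map +_ y))) (sym (ℤₚ.pos-* (suc K) (K !))) ⟩
      + (suc K !) Int.* (s Int.* Δ (map +_ y)) ∎
      where
      open ≡-Reasoning
      pull : ∀ x k s D → x Int.* (k Int.* (s Int.* D)) ≡ (k Int.* s) Int.* (x Int.* D) Int.+ + 0 Int.* (x Int.* D)
      pull = ℤSolver.solve-∀
      push : ∀ m k s D → (k Int.* s) Int.* (m Int.* D) Int.+ + 0 Int.* (m Int.* D) ≡ (m Int.* k) Int.* (s Int.* D)
      push = ℤSolver.solve-∀
      cancel : ∀ a b → a Int.+ b Int.- b ≡ a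
      cancel = ℤSolver.solve-∀
      excess : sumℤ (map +_ y) Int.- triℤ (map +_ y) ≡ + suc K
      excess = trans (cong₂ Int._-_ (trans (sumℤ-map y) (trans (cong +_ e) (ℤₚ.pos-+ (suc K) (tri d))))
        (trans (triℤ-map y) (cong (+_ ∘ tri) lenₑ))) (cancel (+ suc K) (+ tri d))
      below : ∀ {y′} → y′ ∈ downs y → + (H K y′ * factorials y′) ≡ + (K !) Int.* (s Int.* Δ (map +_ y′))
      below {y′} i with adm? y′
      ... | yes a′ = H-Δ K y′ a′ (trans (downs-length y i) lenₑ) (suc-injective (trans (sym (downs-sum y i)) e))
      ... | no ¬a′ = trans (cong (λ z → + (z * factorials y′)) (H-outside K y′ ¬a′))
        (sym (trans (cong (λ z → + (K !) Int.* (s Int.* z)) Δ≡0)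
          (trans (cong (Int._*_ (+ (K !))) (ℤₚ.*-zeroʳ s)) (ℤₚ.*-zeroʳ (+ (K !))))))
        where
        Δ≡0 : Δ (map +_ y′) ≡ + 0
        Δ≡0 = ℤₚ.∣i∣≡0⇒i≡0 (trans (∣Δ∣≡δ y′) (boundary a i ¬a′))

  H-δ : ∀ K y → Adm y → length y ≡ d → sum y ≡ K + tri d → H K y * factorials y ≡ K ! * δ y
  H-δ K y a lenₑ e = begin
    H K y * factorials y ≡⟨ cong Int.∣_∣ (H-Δ K y a lenₑ e) ⟩
    Int.∣ + (K !) Int.* (s Int.* Δ (map +_ y)) ∣ ≡⟨ ℤₚ.abs-* (+ (K !)) _ ⟩
    K ! * Int.∣ s Int.* Δ (map +_ y) ∣ ≡⟨ cong (K ! *_) (ℤₚ.abs-* s _) ⟩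
    K ! * (Int.∣ s ∣ * Int.∣ Δ (map +_ y) ∣)
      ≡⟨ cong₂ (λ a b → K ! * (a * b)) (proj₂ (proj₂ (sign (Δ (map +_ base))))) (∣Δ∣≡δ y) ⟩
    K ! * (1 * δ y) ≡⟨ cong (K ! *_) (*-identityˡ (δ y)) ⟩
    K ! * δ y ∎
    where open ≡-Reasoning

-- The two chambers: decreasing and increasing sequences

Asc : List ℕ → Set
Asc [] = ⊤
Asc (x ∷ l) = All (x <_) l × Asc l

asc? : ∀ l → Dec (Asc l)
asc? [] = yes tt
asc? (x ∷ l) = All.all? (x <?_) l ×-dec asc? l

distances-∈ : ∀ {x l} → x ∈ l → distances x l ≡ 0
distances-∈ {x} {_ ∷ l} (here refl) = cong (_* distances x l) (m≡n⇒∣m-n∣≡0 {x} refl)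
distances-∈ {x} {y ∷ l} (there i) = trans (cong (∣ x - y ∣ *_) (distances-∈ i)) (*-zeroʳ ∣ x - y ∣)

-- Between integers, lowering one entry by 1 can break strict descent only by making it equal to
-- another entry, and then one of the distances is 0.
desc-boundary : ∀ {l l′} → Desc l → l′ ∈ downs l → ¬ Desc l′ → δ l′ ≡ 0
desc-boundary {zero ∷ l} (() ∷ _ , h) i ¬h′
desc-boundary {suc x ∷ l} (a , h) i ¬h′ = go i ¬h′
  where
  touch : ∀ l → All (_< suc x) l → All (_< x) l ⊎ x ∈ l
  touch [] [] = inj₁ []
  touch (y ∷ l) (lt ∷ a) with m≤n⇒m<n∨m≡n (s≤s⁻¹ lt) | touch l a
  ... | inj₂ refl | _ = inj₂ (here refl)
  ... | inj₁ _ | inj₂ j = inj₂ (there j)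
  ... | inj₁ lt′ | inj₁ b = inj₁ (lt′ ∷ b)
  downs-< : ∀ {b} l {l′} → All (_< b) l → l′ ∈ downs l → All (_< b) l′
  downs-< (zero ∷ l) (lt ∷ a) i with ∈-map⁻ _ i
  ... | _ , j , refl = lt ∷ downs-< l a j
  downs-< (suc x ∷ l) (lt ∷ a) (here refl) = <-trans (n<1+n x) lt ∷ a
  downs-< (suc x ∷ l) (lt ∷ a) (there i) with ∈-map⁻ _ i
  ... | _ , j , refl = lt ∷ downs-< l a j
  go : ∀ {l′} → l′ ∈ downs (suc x ∷ l) → ¬ Desc l′ → δ l′ ≡ 0
  go (here refl) ¬h′ with touch l a
  ... | inj₁ b = contradiction (b , h) ¬h′
  ... | inj₂ j = cong (_* δ l) (distances-∈ j)
  go (there i) ¬h′ with ∈-map⁻ _ i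
  ... | v , j , refl = trans (cong (distances (suc x) v *_)
    (desc-boundary h j (λ h″ → ¬h′ (downs-< l a j , h″)))) (*-zeroʳ (distances (suc x) v))

asc-boundary : ∀ {l l′} → Asc l → l′ ∈ downs l → ¬ Asc l′ → δ l′ ≡ 0
asc-boundary-tail : ∀ x l {v} → All (x <_) l → Asc l → v ∈ downs l → ¬ Asc (x ∷ v) → δ (x ∷ v) ≡ 0

asc-boundary-tail x l {v} a h j ¬h′ with touch l a j
  where
  touch : ∀ l {v} → All (x <_) l → v ∈ downs l → All (x <_) v ⊎ x ∈ v
  touch (suc y ∷ l) (lt ∷ a) (here refl) with m≤n⇒m<n∨m≡n (s≤s⁻¹ lt)
  ... | inj₁ lt′ = inj₁ (lt′ ∷ a)
  ... | inj₂ refl = inj₂ (here refl)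
  touch (suc y ∷ l) (lt ∷ a) (there i) with ∈-map⁻ _ i
  ... | _ , j , refl with touch l a j
  ... | inj₁ b = inj₁ (lt ∷ b)
  ... | inj₂ k = inj₂ (there k)
... | inj₂ k = cong (_* δ v) (distances-∈ k)
... | inj₁ b = trans (cong (distances x v *_) (asc-boundary h j (λ h″ → ¬h′ (b , h″)))) (*-zeroʳ (distances x v))

asc-boundary {zero ∷ l} (a , h) i ¬h′ with ∈-map⁻ _ i
... | v , j , refl = asc-boundary-tail zero l a h j ¬h′
asc-boundary {suc x ∷ l} (a , h) (here refl) ¬h′ = contradiction (All.map (<-trans (n<1+n x)) a , h) ¬h′
asc-boundary {suc x ∷ l} (a , h) (there i) ¬h′ with ∈-map⁻ _ i
... | v , j , refl = asc-boundary-tail (suc x) l a h j ¬h′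

desc-length-≤ : ∀ x l → All (_< x) l → Desc l → length l ≤ x
desc-length-≤ x [] a h = z≤n
desc-length-≤ x (y ∷ l) (lt ∷ _) (b , h) = ≤-trans (s≤s (desc-length-≤ y l b h)) lt

desc-sum-≥ : ∀ l → Desc l → tri (length l) ≤ sum l
desc-sum-≥ [] h = z≤n
desc-sum-≥ (x ∷ l) (a , h) = +-mono-≤ (desc-length-≤ x l a h) (desc-sum-≥ l h)

squeeze : ∀ {a b c e} → a ≤ b → c ≤ e → b + e ≡ a + c → b ≡ a × e ≡ c
squeeze {a} {b} {c} {e} le le′ eq = p , +-cancelˡ-≡ a e c (trans (cong (_+ e) (sym p)) eq)
  where
  p : b ≡ a
  p = ≤-antisym (+-cancelʳ-≤ e b a (≤-trans (≤-reflexive eq) (+-monoʳ-≤ a le′))) le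

desc-unique : ∀ d l → Desc l → length l ≡ d → sum l ≡ tri d → l ≡ ρ d
desc-unique zero [] h refl e = refl
desc-unique (suc d) (x ∷ l) (a , h) refl e
  with squeeze (desc-length-≤ x l a h) (desc-sum-≥ l h) e
... | refl , e′ = cong (x ∷_) (desc-unique (length l) l h refl e′)

up : ℕ → ℕ → List ℕ
up k zero = []
up k (suc d) = k ∷ up (suc k) d

asc-sum-≥ : ∀ k l → All (k ≤_) l → Asc l → sum (up k (length l)) ≤ sum l
asc-sum-≥ k [] a h = z≤n
asc-sum-≥ k (x ∷ l) (le ∷ _) (b , h) = +-mono-≤ le (asc-sum-≥ (suc k) l (All.map (≤-<-trans le) b) h)

asc-unique : ∀ k l → All (k ≤_) l → Asc l → sum l ≡ sum (up k (length l)) → l ≡ up k (length l)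
asc-unique k [] a h e = refl
asc-unique k (x ∷ l) (le ∷ _) (b , h) e
  with squeeze le (asc-sum-≥ (suc k) l (All.map (≤-<-trans le) b) h) e
... | refl , e′ = cong (x ∷_) (asc-unique (suc x) l b h e′)

sum-up : ∀ k d → sum (up k d) ≡ k * d + tri d
sum-up k zero = sym (trans (+-identityʳ _) (*-zeroʳ k))
sum-up k (suc d) = trans (cong (λ z → k + z) (sum-up (suc k) d)) (regroup k d (tri d))
  where
  regroup : ∀ k d t → k + ((1 + k) * d + t) ≡ k * (1 + d) + (d + t)
  regroup = solve-∀

superfactorial : ℕ → ℕ
superfactorial zero = 1
superfactorial (suc d) = d ! * superfactorial d

∣m+n-m∣ : ∀ m n → ∣ m + n - m ∣ ≡ n
∣m+n-m∣ m n = trans (m≤n⇒∣n-m∣≡n∸m (m≤m+n m n)) (m+n∸m≡n m n)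

distances-ρ : ∀ c k d → distances (c + (d + k)) (lst d (λ _ → c)) * k ! ≡ (d + k) !
distances-ρ c k zero = +-identityʳ _
distances-ρ c k (suc d) = begin
  ∣ c + (suc d + k) - (c + d) ∣ * distances (c + (suc d + k)) (lst d (λ _ → c)) * k !
    ≡⟨ cong (λ z → ∣ z - (c + d) ∣ * distances (c + (suc d + k)) (lst d (λ _ → c)) * k !) (shift c d k) ⟩
  ∣ c + d + suc k - (c + d) ∣ * distances (c + (suc d + k)) (lst d (λ _ → c)) * k !
    ≡⟨ cong (λ z → z * distances (c + (suc d + k)) (lst d (λ _ → c)) * k !) (∣m+n-m∣ (c + d) (suc k)) ⟩
  suc k * distances (c + (suc d + k)) (lst d (λ _ → c)) * k !
    ≡⟨ swap (suc k) (distances (c + (suc d + k)) (lst d (λ _ → c))) (k !) ⟩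
  distances (c + (suc d + k)) (lst d (λ _ → c)) * (suc k !)
    ≡⟨ cong (λ z → distances (c + z) (lst d (λ _ → c)) * (suc k !)) (sym (+-suc d k)) ⟩
  distances (c + (d + suc k)) (lst d (λ _ → c)) * (suc k !) ≡⟨ distances-ρ c (suc k) d ⟩
  (d + suc k) ! ≡⟨ cong _! (+-suc d k) ⟩
  (suc d + k) ! ∎
  where
  open ≡-Reasoning
  shift : ∀ c d k → c + (1 + d + k) ≡ c + d + (1 + k)
  shift = solve-∀
  swap : ∀ a b c → a * b * c ≡ b * (a * c)
  swap = solve-∀

δ-const : ∀ c d → δ (lst d (λ _ → c)) ≡ superfactorial d
δ-const c zero = refl
δ-const c (suc d) = cong₂ _*_
  (trans (cong (λ z → distances (c + z) (lst d (λ _ → c))) (sym (+-identityʳ d)))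
    (trans (sym (*-identityʳ _)) (trans (distances-ρ c 0 d) (cong _! (+-identityʳ d)))))
  (δ-const c d)

factorials-ρ : ∀ d → factorials (ρ d) ≡ superfactorial d
factorials-ρ zero = refl
factorials-ρ (suc d) = cong (d ! *_) (factorials-ρ d)

factorials-up : ∀ k d → superfactorial k * factorials (up k d) ≡ superfactorial (k + d)
factorials-up k zero = trans (*-identityʳ _) (cong superfactorial (sym (+-identityʳ k)))
factorials-up k (suc d) = trans (swap (superfactorial k) (k !) (factorials (up (suc k) d)))
  (trans (factorials-up (suc k) d) (cong superfactorial (sym (+-suc k d))))
  where
  swap : ∀ a b c → a * (b * c) ≡ b * a * c
  swap = solve-∀

map-up : ∀ c d k → map (c + (k + d) ∸_) (lst (suc d) (λ _ → c)) ≡ up k (suc d)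
map-up c zero k = cong (_∷ []) (trans (cong (c + (k + 0) ∸_) (+-identityʳ c))
  (trans (m+n∸m≡n c (k + 0)) (+-identityʳ k)))
map-up c (suc d) k = cong₂ _∷_
  (trans ([m+n]∸[m+o]≡n∸o c (k + suc d) (suc d)) (m+n∸n≡m k (suc d)))
  (trans (cong (λ z → map (c + z ∸_) (lst (suc d) (λ _ → c))) (+-suc k d)) (map-up c d (suc k)))

∣∸-∸∣ : ∀ {M x y} → x ≤ M → y ≤ M → ∣ (M ∸ x) - (M ∸ y) ∣ ≡ ∣ x - y ∣
∣∸-∸∣ {M} {x} {y} p q = [ ordered q , (λ le → trans (∣-∣-comm (M ∸ x) (M ∸ y)) (trans (ordered p le) (∣-∣-comm y x))) ]′ (≤-total x y)
  where
  ordered : ∀ {x y} → y ≤ M → x ≤ y → ∣ (M ∸ x) - (M ∸ y) ∣ ≡ ∣ x - y ∣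
  ordered {x} {y} q le = begin
    ∣ (M ∸ x) - (M ∸ y) ∣ ≡⟨ m≤n⇒∣n-m∣≡n∸m (∸-monoʳ-≤ M le) ⟩
    M ∸ x ∸ (M ∸ y) ≡⟨ ∸-+-assoc M x (M ∸ y) ⟩
    M ∸ (x + (M ∸ y)) ≡⟨ cong (M ∸_) (+-comm x (M ∸ y)) ⟩
    M ∸ ((M ∸ y) + x) ≡⟨ sym (∸-+-assoc M (M ∸ y) x) ⟩
    M ∸ (M ∸ y) ∸ x ≡⟨ cong (_∸ x) (m∸[m∸n]≡n q) ⟩
    y ∸ x ≡⟨ sym (m≤n⇒∣m-n∣≡n∸m le) ⟩
    ∣ x - y ∣ ∎
    where open ≡-Reasoning

δ-comp : ∀ M l → All (_≤ M) l → δ (map (M ∸_) l) ≡ δ l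
δ-comp M [] a = refl
δ-comp M (x ∷ l) (le ∷ a) = cong₂ _*_ (dist l a) (δ-comp M l a)
  where
  dist : ∀ l → All (_≤ M) l → distances (M ∸ x) (map (M ∸_) l) ≡ distances x l
  dist [] a = refl
  dist (y ∷ l) (le′ ∷ a) = cong₂ _*_ (∣∸-∸∣ le le′) (dist l a)

desc-chamber : ∀ d → Chamber d
desc-chamber d = record
  { Adm = Desc ; adm? = desc? ; base = ρ d
  ; base-adm = desc-lst d (λ _ → 0) (λ _ → z≤n)
  ; base-unique = desc-unique d
  ; base-δ = trans (factorials-ρ d) (sym (δ-const 0 d))
  ; boundary = desc-boundary }

asc-up : ∀ k d → All (k ≤_) (up k d) × Asc (up k d)
asc-up k zero = [] , tt
asc-up k (suc d) with asc-up (suc k) d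
... | a , h = ≤-refl ∷ All.map <⇒≤ a , a , h

asc-chamber : ∀ d → Chamber (suc d)
asc-chamber d = record
  { Adm = Asc ; adm? = asc? ; base = up 0 (suc d)
  ; base-adm = proj₂ (asc-up 0 (suc d))
  ; base-unique = λ y h lenₑ e → trans (asc-unique 0 y (All.universal (λ _ → z≤n) y) h
      (trans e (sym (trans (cong (sum ∘ up 0) lenₑ) (sum-up 0 (suc d)))))) (cong (up 0) lenₑ)
  -- The sequence 0, 1, ..., `d` is the complement of `ρ (suc d)` in `d`, so the two have the same
  -- `δ`.
  ; base-δ = trans (trans (sym (*-identityˡ _)) (factorials-up 0 (suc d)))
      (trans (sym (δ-const 0 (suc d))) (trans (sym (δ-comp d (ρ (suc d)) (All.map s≤s⁻¹ (lst-< (suc d) (λ _ → 0) 0 (λ _ → z≤n) z≤n))))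
        (cong δ (map-up 0 d 0))))
  ; boundary = asc-boundary }

-- Multiplicities in `L` as path counts

lst-length : ∀ d c → length (lst d c) ≡ d
lst-length zero c = refl
lst-length (suc d) c = cong suc (lst-length d (c ∘ suc))

sum-const : ∀ d c → sum (lst d (λ _ → c)) ≡ d * c + tri d
sum-const zero c = refl
sum-const (suc d) c = trans (cong (λ z → c + d + z) (sum-const d c)) (regroup c d (tri d))
  where
  regroup : ∀ c d t → c + d + (d * c + t) ≡ c + d * c + (d + t)
  regroup = solve-∀

ups-length : ∀ l {l′} → l′ ∈ ups l → length l′ ≡ length l
ups-length (x ∷ l) (here refl) = refl
ups-length (x ∷ l) (there i) with ∈-map⁻ _ i
... | _ , j , refl = cong suc (ups-length l j)

ups-sum : ∀ l {l′} → l′ ∈ ups l → sum l′ ≡ suc (sum l)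
ups-sum (x ∷ l) (here refl) = refl
ups-sum (x ∷ l) (there i) with ∈-map⁻ _ i
... | _ , j , refl = trans (cong (λ z → x + z) (ups-sum l j)) (+-suc x (sum l))

∈-L : ∀ d N {l} → l ∈ L d N → length l ≡ d × Desc l × sum l ≡ N + tri d
∈-L d zero (here refl) = lst-length d _ , desc-lst d (λ _ → 0) (λ _ → z≤n) ,
  trans (sum-const d 0) (cong (_+ tri d) (*-zeroʳ d))
∈-L d (suc N) i with ∈-concatMap⁻′ _ (L d N) i
... | l , j , k with ∈-filter⁻ desc? {xs = ups l} k | ∈-L d N j
... | k′ , h | lenₑ , _ , e = trans (ups-length l k′) lenₑ , h , trans (ups-sum l k′) (cong suc e)

𝟙-∷ : ∀ a b u v → 𝟙 ((a ∷ u) ≟ᴸ (b ∷ v)) ≡ 𝟙 (a ≟ b) * 𝟙 (u ≟ᴸ v)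
𝟙-∷ a b u v = 𝟙-∧ (a ≟ b) (u ≟ᴸ v) ((a ∷ u) ≟ᴸ (b ∷ v)) ∷-injective (cong₂ _∷_)

∑-prefixʳ : ∀ a b v xs → ∑ (map (a ∷_) xs) (λ x → 𝟙 (x ≟ᴸ (b ∷ v))) ≡ 𝟙 (a ≟ b) * ∑ xs (λ u → 𝟙 (u ≟ᴸ v))
∑-prefixʳ a b v xs = trans (∑-map (a ∷_) xs _)
  (trans (∑-cong xs (λ {u} _ → 𝟙-∷ a b u v)) (∑-*ˡ xs _ (𝟙 (a ≟ b))))

∑-prefixˡ : ∀ a b u xs → ∑ (map (b ∷_) xs) (λ x → 𝟙 ((a ∷ u) ≟ᴸ x)) ≡ 𝟙 (a ≟ b) * ∑ xs (λ v → 𝟙 (u ≟ᴸ v))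
∑-prefixˡ a b u xs = trans (∑-map (b ∷_) xs _)
  (trans (∑-cong xs (λ {v} _ → 𝟙-∷ a b u v)) (∑-*ˡ xs _ (𝟙 (a ≟ b))))

ups-downs : ∀ l l′ → ∑ (ups l) (λ x → 𝟙 (x ≟ᴸ l′)) ≡ ∑ (downs l′) (λ x → 𝟙 (l ≟ᴸ x))
ups-downs [] [] = refl
ups-downs [] (zero ∷ l′) = sym (trans (∑-map (zero ∷_) (downs l′) _) (∑-0 (downs l′)))
ups-downs [] (suc b ∷ l′) = sym (trans (∑-map (suc b ∷_) (downs l′) _) (∑-0 (downs l′)))
ups-downs (a ∷ l) [] = trans (∑-map (a ∷_) (ups l) _) (∑-0 (ups l))
ups-downs (a ∷ l) (zero ∷ l′) = trans (cong₂ _+_ (𝟙-∷ (suc a) 0 l l′)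
  (trans (∑-prefixʳ a 0 l′ (ups l)) (cong (𝟙 (a ≟ 0) *_) (ups-downs l l′))))
  (sym (∑-prefixˡ a 0 l (downs l′)))
ups-downs (a ∷ l) (suc b ∷ l′) = cong₂ _+_ (trans (𝟙-∷ (suc a) (suc b) l l′) (sym (𝟙-∷ a b l l′)))
  (trans (∑-prefixʳ a (suc b) l′ (ups l)) (trans (cong (𝟙 (a ≟ suc b) *_) (ups-downs l l′))
    (sym (∑-prefixˡ a (suc b) l (downs l′)))))

module Desc-Paths d = Paths (desc-chamber d)

-- `L` extends paths upwards from `ρ d`, while `H` looks back at the last step. Exchanging the sums
-- turns one recursion into the other, because raising `l` to `l′` and lowering `l′` to `l` are the
-- same step (`ups-downs`).
mult-L : ∀ d N l → mult (L d N) l ≡ Desc-Paths.H d N l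
mult-L d zero l = trans (+-identityʳ _) (𝟙-cong (ρ d ≟ᴸ l) (l ≟ᴸ ρ d) sym sym)
mult-L d (suc N) l = begin
  mult (L d (suc N)) l ≡⟨ ∑-concatMap _ (L d N) _ ⟩
  ∑ (L d N) (λ l′ → ∑ (filter desc? (ups l′)) (λ x → 𝟙 (x ≟ᴸ l)))
    ≡⟨ ∑-cong (L d N) (λ {l′} _ → one-path l′) ⟩
  ∑ (L d N) (λ l′ → 𝟙 (desc? l) * ∑ (downs l) (λ x → 𝟙 (l′ ≟ᴸ x)))
    ≡⟨ ∑-*ˡ (L d N) _ (𝟙 (desc? l)) ⟩
  𝟙 (desc? l) * ∑ (L d N) (λ l′ → ∑ (downs l) (λ x → 𝟙 (l′ ≟ᴸ x)))
    ≡⟨ cong (𝟙 (desc? l) *_) (∑-swap (L d N) (downs l) (λ l′ x → 𝟙 (l′ ≟ᴸ x))) ⟩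
  𝟙 (desc? l) * ∑ (downs l) (mult (L d N))
    ≡⟨ cong (𝟙 (desc? l) *_) (∑-cong (downs l) (λ {x} _ → mult-L d N x)) ⟩
  𝟙 (desc? l) * ∑ (downs l) (Desc-Paths.H d N) ∎
  where
  open ≡-Reasoning
  only : ∀ x → 𝟙 (desc? x) * 𝟙 (x ≟ᴸ l) ≡ 𝟙 (desc? l) * 𝟙 (x ≟ᴸ l)
  only x = trans (*-comm (𝟙 (desc? x)) _) (trans (𝟙-*-cong (x ≟ᴸ l) {𝟙 (desc? x)} {𝟙 (desc? l)} λ { refl → refl }) (*-comm (𝟙 (x ≟ᴸ l)) _))
  one-path : ∀ l′ → ∑ (filter desc? (ups l′)) (λ x → 𝟙 (x ≟ᴸ l)) ≡ 𝟙 (desc? l) * ∑ (downs l) (λ x → 𝟙 (l′ ≟ᴸ x))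
  one-path l′ = begin
    ∑ (filter desc? (ups l′)) (λ x → 𝟙 (x ≟ᴸ l)) ≡⟨ ∑-filter desc? (ups l′) _ ⟩
    ∑ (ups l′) (λ x → 𝟙 (desc? x) * 𝟙 (x ≟ᴸ l)) ≡⟨ ∑-cong (ups l′) (λ {x} _ → only x) ⟩
    ∑ (ups l′) (λ x → 𝟙 (desc? l) * 𝟙 (x ≟ᴸ l)) ≡⟨ ∑-*ˡ (ups l′) _ (𝟙 (desc? l)) ⟩
    𝟙 (desc? l) * ∑ (ups l′) (λ x → 𝟙 (x ≟ᴸ l)) ≡⟨ cong (𝟙 (desc? l) *_) (ups-downs l′ l) ⟩
    𝟙 (desc? l) * ∑ (downs l) (λ x → 𝟙 (l′ ≟ᴸ x)) ∎

-- Complements in the rectangle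

module Complement (d n : ℕ) where

  -- The largest entry of a sequence whose shape fits the rectangle. In this module there are
  -- `suc d` rows, and `n` is the full length of a row.
  M : ℕ
  M = n + d

  comp : List ℕ → List ℕ
  comp = map (M ∸_)

  bounded? : ∀ l → Dec (All (_≤ M) l)
  bounded? = All.all? (_≤? M)

  open Paths (asc-chamber d)

  -- The number of K-step paths from l to the target; the bound check keeps ∸ in comp exact.
  g : ℕ → List ℕ → ℕ
  g K l = 𝟙 (bounded? l) * H K (comp l)

  𝟙-bounded-∷ : ∀ x l → 𝟙 (bounded? (x ∷ l)) ≡ 𝟙 (x ≤? M) * 𝟙 (bounded? l)
  𝟙-bounded-∷ x l = 𝟙-∧ (x ≤? M) (bounded? l) (bounded? (x ∷ l)) (λ { (p ∷ q) → p , q }) _∷_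

  -- Raising an entry lowers its complement. At the entry `M` both sides lose a term: the raised
  -- entry violates the bound, and the complement 0 has no predecessor.
  ups-comp : ∀ l (F : List ℕ → ℕ) →
    ∑ (ups l) (λ x → 𝟙 (bounded? x) * F (comp x)) ≡ 𝟙 (bounded? l) * ∑ (downs (comp l)) F
  ups-comp [] F = refl
  ups-comp (x ∷ l) F = begin
    𝟙 (bounded? (suc x ∷ l)) * F (comp (suc x ∷ l)) + ∑ (map (x ∷_) (ups l)) (λ x → 𝟙 (bounded? x) * F (comp x))
      ≡⟨ cong₂ _+_ (cong (_* F (comp (suc x ∷ l))) (𝟙-bounded-∷ (suc x) l)) tail ⟩
    𝟙 (suc x ≤? M) * 𝟙 (bounded? l) * F (comp (suc x ∷ l)) + 𝟙 (x ≤? M) * (𝟙 (bounded? l) * rest)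
      ≡⟨ cases ⟩
    𝟙 (x ≤? M) * 𝟙 (bounded? l) * ∑ (downs (comp (x ∷ l))) F
      ≡⟨ cong (_* ∑ (downs (comp (x ∷ l))) F) (sym (𝟙-bounded-∷ x l)) ⟩
    𝟙 (bounded? (x ∷ l)) * ∑ (downs (comp (x ∷ l))) F ∎
    where
    open ≡-Reasoning
    rest : ℕ
    rest = ∑ (downs (comp l)) (λ u → F (M ∸ x ∷ u))
    tail : ∑ (map (x ∷_) (ups l)) (λ x → 𝟙 (bounded? x) * F (comp x)) ≡ 𝟙 (x ≤? M) * (𝟙 (bounded? l) * rest)
    tail = begin
      ∑ (map (x ∷_) (ups l)) (λ x → 𝟙 (bounded? x) * F (comp x)) ≡⟨ ∑-map (x ∷_) (ups l) _ ⟩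
      ∑ (ups l) (λ u → 𝟙 (bounded? (x ∷ u)) * F (M ∸ x ∷ comp u))
        ≡⟨ ∑-cong (ups l) (λ {u} _ → trans (cong (_* F (M ∸ x ∷ comp u)) (𝟙-bounded-∷ x u))
             (*-assoc (𝟙 (x ≤? M)) (𝟙 (bounded? u)) _)) ⟩
      ∑ (ups l) (λ u → 𝟙 (x ≤? M) * (𝟙 (bounded? u) * F (M ∸ x ∷ comp u)))
        ≡⟨ ∑-*ˡ (ups l) _ (𝟙 (x ≤? M)) ⟩
      𝟙 (x ≤? M) * ∑ (ups l) (λ u → 𝟙 (bounded? u) * F (M ∸ x ∷ comp u))
        ≡⟨ cong (𝟙 (x ≤? M) *_) (ups-comp l (λ u → F (M ∸ x ∷ u))) ⟩
      𝟙 (x ≤? M) * (𝟙 (bounded? l) * rest) ∎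
    unit : ∀ b f r → 1 * b * f + 1 * (b * r) ≡ 1 * b * (f + r)
    unit = solve-∀
    unit₀ : ∀ b f r → 0 * b * f + 1 * (b * r) ≡ 1 * b * r
    unit₀ = solve-∀
    cases : 𝟙 (suc x ≤? M) * 𝟙 (bounded? l) * F (comp (suc x ∷ l)) + 𝟙 (x ≤? M) * (𝟙 (bounded? l) * rest) ≡
      𝟙 (x ≤? M) * 𝟙 (bounded? l) * ∑ (downs (comp (x ∷ l))) F
    cases with x ≤? M
    ... | no ¬p rewrite 𝟙-no (x ≤? M) ¬p | 𝟙-no (suc x ≤? M) (¬p ∘ <⇒≤) = refl
    ... | yes p with m≤n⇒m<n∨m≡n p
    ... | inj₁ lt rewrite 𝟙-yes (x ≤? M) p | 𝟙-yes (suc x ≤? M) lt = trans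
      (unit (𝟙 (bounded? l)) (F (comp (suc x ∷ l))) rest) (cong (1 * 𝟙 (bounded? l) *_) (peel (M ∸ x) refl (+-∸-assoc 1 lt)))
      where
      peel : ∀ k → M ∸ x ≡ k → k ≡ suc (M ∸ suc x) →
        F (comp (suc x ∷ l)) + ∑ (downs (comp l)) (λ u → F (M ∸ x ∷ u)) ≡ ∑ (downs (k ∷ comp l)) F
      peel k e refl = cong (λ z → F (comp (suc x ∷ l)) + z)
        (trans (cong (λ z → ∑ (downs (comp l)) (λ u → F (z ∷ u))) e) (sym (∑-map (suc (M ∸ suc x) ∷_) (downs (comp l)) F)))
    ... | inj₂ x≡M rewrite 𝟙-yes (x ≤? M) p | 𝟙-no (suc x ≤? M) (<⇒≱ (s≤s (≤-reflexive (sym x≡M)))) = trans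
      (unit₀ (𝟙 (bounded? l)) (F (comp (suc x ∷ l))) rest) (cong (1 * 𝟙 (bounded? l) *_) (peel (M ∸ x) refl (m≤n⇒m∸n≡0 (≤-reflexive (sym x≡M)))))
      where
      peel : ∀ k → M ∸ x ≡ k → k ≡ 0 →
        ∑ (downs (comp l)) (λ u → F (M ∸ x ∷ u)) ≡ ∑ (downs (k ∷ comp l)) F
      peel k e refl = trans (cong (λ z → ∑ (downs (comp l)) (λ u → F (z ∷ u))) e) (sym (∑-map (0 ∷_) (downs (comp l)) F))

  asc-comp⁺ : ∀ l → All (_≤ M) l → Desc l → Asc (comp l)
  asc-comp⁺ [] b h = tt
  asc-comp⁺ (x ∷ l) (le ∷ b) (a , h) = Allₚ.map⁺ (All.map (λ lt → ∸-monoʳ-< lt le) a) , asc-comp⁺ l b h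

  asc-comp⁻ : ∀ l → Asc (comp l) → Desc l
  asc-comp⁻ [] h = tt
  asc-comp⁻ (x ∷ l) (a , h) = All.map (λ {y} lt → ∸-cancelʳ-< {x} {y} {M} lt) (Allₚ.map⁻ a) , asc-comp⁻ l h

  g-step : ∀ K l → Desc l → ∑ (filter desc? (ups l)) (g K) ≡ g (suc K) l
  g-step K l h = begin
    ∑ (filter desc? (ups l)) (g K) ≡⟨ ∑-filter desc? (ups l) (g K) ⟩
    ∑ (ups l) (λ x → 𝟙 (desc? x) * g K x) ≡⟨ ∑-cong (ups l) (λ {x} _ → drop x) ⟩
    ∑ (ups l) (g K) ≡⟨ ups-comp l (H K) ⟩
    𝟙 (bounded? l) * ∑ (downs (comp l)) (H K) ≡⟨ add ⟩
    𝟙 (bounded? l) * (𝟙 (asc? (comp l)) * ∑ (downs (comp l)) (H K)) ∎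
    where
    open ≡-Reasoning
    drop : ∀ x → 𝟙 (desc? x) * g K x ≡ g K x
    drop x = 𝟙-absorb (desc? x) λ ¬p → trans (cong (𝟙 (bounded? x) *_) (H-outside K (comp x) (¬p ∘ asc-comp⁻ x)))
      (*-zeroʳ (𝟙 (bounded? x)))
    add : 𝟙 (bounded? l) * ∑ (downs (comp l)) (H K) ≡
      𝟙 (bounded? l) * (𝟙 (asc? (comp l)) * ∑ (downs (comp l)) (H K))
    add = 𝟙-*-cong (bounded? l) λ b → sym (𝟙-absorb (asc? (comp l)) λ ¬a → contradiction (asc-comp⁺ l b h) ¬a)

  target : List ℕ
  target = lst (suc d) (λ _ → n)

  target-bounded : All (_≤ M) target
  target-bounded = All.map (λ {x} lt → s≤s⁻¹ (subst (x <_) (+-suc n d) lt))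
    (lst-< (suc d) (λ _ → n) n (λ _ → ≤-refl) ≤-refl)

  comp-target : comp target ≡ up 0 (suc d)
  comp-target = map-up n d 0

  comp-injective : ∀ l l′ → All (_≤ M) l → All (_≤ M) l′ → comp l ≡ comp l′ → l ≡ l′
  comp-injective [] [] a b e = refl
  comp-injective (x ∷ l) (y ∷ l′) (p ∷ a) (q ∷ b) e =
    cong₂ _∷_ (∸-cancelˡ-≡ p q (∷-injectiveˡ e)) (comp-injective l l′ a b (∷-injectiveʳ e))

  -- Paths to the full rectangle are cut after `N` steps. The induction moves the cut one step
  -- earlier at a time, and `g-step` says that the total does not change.
  mult-target : ∀ K N → mult (L (suc d) (K + N)) target ≡ ∑ (L (suc d) N) (g K)
  mult-target zero N = ∑-cong (L (suc d) N) λ {l} _ → same l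
    where
    same : ∀ l → 𝟙 (l ≟ᴸ target) ≡ g 0 l
    same l = 𝟙-∧ (bounded? l) (comp l ≟ᴸ up 0 (suc d)) (l ≟ᴸ target)
      (λ { refl → target-bounded , comp-target })
      (λ b e → comp-injective l target b target-bounded (trans e (sym comp-target)))
  mult-target (suc K) N = begin
    mult (L (suc d) (suc K + N)) target ≡⟨ cong (λ z → mult (L (suc d) z) target) (sym (+-suc K N)) ⟩
    mult (L (suc d) (K + suc N)) target ≡⟨ mult-target K (suc N) ⟩
    ∑ (L (suc d) (suc N)) (g K) ≡⟨ ∑-concatMap _ (L (suc d) N) (g K) ⟩
    ∑ (L (suc d) N) (λ l → ∑ (filter desc? (ups l)) (g K))
      ≡⟨ ∑-cong (L (suc d) N) (λ {l} i → g-step K l (proj₁ (proj₂ (∈-L (suc d) N i)))) ⟩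
    ∑ (L (suc d) N) (g (suc K)) ∎
    where open ≡-Reasoning

  sum-comp : ∀ l → All (_≤ M) l → sum (comp l) + sum l ≡ length l * M
  sum-comp [] b = refl
  sum-comp (x ∷ l) (le ∷ b) = trans (regroup (M ∸ x) (sum (comp l)) x (sum l)) (cong₂ _+_ (m∸n+n≡m le) (sum-comp l b))
    where
    regroup : ∀ a b c e → a + b + (c + e) ≡ (a + c) + (b + e)
    regroup = solve-∀

  g-unbounded : ∀ K l → ¬ All (_≤ M) l → g K l ≡ 0
  g-unbounded K l ¬b = cong (_* H K (comp l)) (𝟙-no (bounded? l) ¬b)

  g-δ : ∀ K l → All (_≤ M) l → Desc l → length l ≡ suc d → sum (comp l) ≡ K + tri (suc d) →
    g K l * factorials (comp l) ≡ K ! * δ l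
  g-δ K l b h lenₑ e = begin
    𝟙 (bounded? l) * H K (comp l) * factorials (comp l)
      ≡⟨ cong (λ z → z * H K (comp l) * factorials (comp l)) (𝟙-yes (bounded? l) b) ⟩
    1 * H K (comp l) * factorials (comp l) ≡⟨ cong (_* factorials (comp l)) (*-identityˡ (H K (comp l))) ⟩
    H K (comp l) * factorials (comp l)
      ≡⟨ H-δ K (comp l) (asc-comp⁺ l b h) (trans (length-map (M ∸_) l) lenₑ) e ⟩
    K ! * δ (comp l) ≡⟨ cong (K ! *_) (δ-comp M l b) ⟩
    K ! * δ l ∎
    where open ≡-Reasoning

-- Extremal involutions and rectangular tableaux

-- β i is the number of further elements of the longest R-chain starting at position i.
record Height {M} (R : Fin M → Fin M → Set) (β : Fin M → ℕ) : Set where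
  field
    rise : ∀ {i k} → i Fin.< k → R i k → β k < β i
    drop : ∀ {i h} → β i ≡ suc h → ∃ λ k → i Fin.< k × R i k × β k ≡ h
open Height

-- Following `drop` from `i` gives a chain of `β i` further positions, and `γ` falls strictly at
-- each of them.
height-min : ∀ {M} {R : Fin M → Fin M → Set} {β : Fin M → ℕ} (γ : Fin M → ℕ) → Height R β →
  (∀ {i k} → i Fin.< k → R i k → γ k < γ i) → ∀ i → β i ≤ γ i
height-min {β = β} γ H up i = go (β i) i refl
  where
  go : ∀ h i → β i ≡ h → β i ≤ γ i
  go zero i e = subst (_≤ γ i) (sym e) z≤n
  go (suc h) i e with drop H e
  ... | k , lt , r , e′ = subst (_≤ γ i) (trans (cong suc e′) (sym e)) (≤-<-trans (go h k e′) (up lt r))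

height-unique : ∀ {M} {R : Fin M → Fin M → Set} {β γ : Fin M → ℕ} → Height R β → Height R γ → β ≗ γ
height-unique {β = β} {γ} H K i = ≤-antisym (height-min γ H (rise K) i) (height-min β K (rise H) i)

height-tail : ∀ {M} {R : Fin (suc M) → Fin (suc M) → Set} {β} → Height R β →
  Height (λ i k → R (Fin.suc i) (Fin.suc k)) (β ∘ Fin.suc)
height-tail H .rise lt r = rise H (s<s lt) r
height-tail H .drop e with drop H e
... | Fin.suc k , lt , r , e′ = k , s<s⁻¹ lt , r , e′

supremum : ∀ {M} {Q : Fin M → Set} → Decidable Q → (v : Fin M → ℕ) →
  ∃ λ b → (∀ k → Q k → v k < b) × (∀ {h} → b ≡ suc h → ∃ λ k → Q k × v k ≡ h)
supremum {zero} Q? v = 0 , (λ ()) , λ ()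
supremum {suc M} Q? v with supremum (Q? ∘ Fin.suc) (v ∘ Fin.suc)
... | b , u , a with Q? Fin.zero | v Fin.zero <? b
... | no ¬q | _ = b , (λ { Fin.zero q → contradiction q ¬q ; (Fin.suc k) q → u k q }) ,
  λ e → let (k , q , e′) = a e in Fin.suc k , q , e′
... | yes q | yes lt = b , (λ { Fin.zero _ → lt ; (Fin.suc k) q → u k q }) ,
  λ e → let (k , q , e′) = a e in Fin.suc k , q , e′
... | yes q | no ¬lt = suc (v Fin.zero) ,
  (λ { Fin.zero _ → n<1+n _ ; (Fin.suc k) q → m<n⇒m<1+n (<-≤-trans (u k q) (≮⇒≥ ¬lt)) }) ,
  λ { refl → Fin.zero , q , refl }

height-exists : ∀ {M} (R : Fin M → Fin M → Set) → (∀ i k → Dec (R i k)) → ∃ (Height R)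
height-exists {zero} R R? = (λ ()) , record { rise = λ { {()} } ; drop = λ { {()} } }
height-exists {suc M} R R? with height-exists (λ i k → R (Fin.suc i) (Fin.suc k)) (λ i k → R? _ _)
... | β , H with supremum (λ k → R? Fin.zero (Fin.suc k)) β
... | b , u , a = b F.∷ β , record
  { rise = λ { {Fin.zero} {Fin.suc k} _ r → u k r ; {Fin.suc i} {Fin.suc k} lt r → rise H (s<s⁻¹ lt) r }
  ; drop = λ { {Fin.zero} e → let (k , r , e′) = a e in Fin.suc k , z<s , r , e′
             ; {Fin.suc i} e → let (k , lt , r , e′) = drop H e in Fin.suc k , s<s lt , r , e′ } }

module _ where
  open Subset using () renaming (_∈_ to _∈ˢ_)

  ChainOn : ∀ {M} → (Fin M → Fin M → Set) → Subset M → Set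
  ChainOn R s = ∀ i j → i ∈ˢ s → j ∈ˢ s → i Fin.< j → R i j

  chain⇒height : ∀ {M} {R : Fin M → Fin M → Set} {β} → Height R β → ∀ s k → ChainOn R s →
    Subset.∣ s ∣ ≡ suc k → ∃ λ i → i ∈ˢ s × k ≤ β i
  chain⇒height H (outside Vec.∷ s) k h e
    with chain⇒height (height-tail H) s k (λ i j p q lt → h _ _ (Vec.there p) (Vec.there q) (s<s lt)) e
  ... | i , p , le = Fin.suc i , Vec.there p , le
  chain⇒height H (inside Vec.∷ s) zero h e = Fin.zero , Vec.here , z≤n
  chain⇒height H (inside Vec.∷ s) (suc k) h e
    with chain⇒height (height-tail H) s k (λ i j p q lt → h _ _ (Vec.there p) (Vec.there q) (s<s lt)) (suc-injective e)
  ... | i , p , le = Fin.zero , Vec.here , ≤-<-trans le (rise H z<s (h _ _ Vec.here (Vec.there p) z<s))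

  height⇒chain : ∀ {M} {R : Fin M → Fin M → Set} {β} → (∀ {i j k} → R i j → R j k → R i k) → Height R β →
    ∀ i k → β i ≡ k → ∃ λ (s : Subset M) → Subset.∣ s ∣ ≡ suc k × ChainOn R s ×
      (∀ j → j ∈ˢ s → j ≡ i ⊎ R i j)
  height⇒chain tr H (Fin.suc i) k e with height⇒chain tr (height-tail H) i k e
  ... | s , c , h , m = outside Vec.∷ s , c ,
    (λ { (Fin.suc i) (Fin.suc j) (Vec.there p) (Vec.there q) lt → h i j p q (s<s⁻¹ lt) }) ,
    (λ { (Fin.suc j) (Vec.there q) → [ inj₁ ∘ cong Fin.suc , inj₂ ]′ (m j q) })
  height⇒chain {suc M} tr H Fin.zero zero e = inside Vec.∷ Subset.⊥ , cong suc (Subsetₚ.∣⊥∣≡0 M) ,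
    (λ { Fin.zero Fin.zero _ _ () ; _ (Fin.suc j) _ (Vec.there q) → contradiction q Subsetₚ.∉⊥
       ; (Fin.suc i) Fin.zero _ _ () }) ,
    (λ { Fin.zero _ → inj₁ refl ; (Fin.suc j) (Vec.there q) → contradiction q Subsetₚ.∉⊥ })
  height⇒chain tr H Fin.zero (suc k) e with drop H e
  ... | Fin.suc i , _ , r , e′ with height⇒chain tr (height-tail H) i k e′
  ... | s , c , h , m = inside Vec.∷ s , cong suc c ,
    (λ { Fin.zero (Fin.suc j) _ (Vec.there q) _ → below j q
       ; (Fin.suc i) (Fin.suc j) (Vec.there p) (Vec.there q) lt → h i j p q (s<s⁻¹ lt)
       ; Fin.zero Fin.zero _ _ () ; (Fin.suc i) Fin.zero _ _ () }) ,
    (λ { Fin.zero _ → inj₁ refl ; (Fin.suc j) (Vec.there q) → inj₂ (below j q) })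
    where
    below : ∀ j → j ∈ˢ s → _
    below j q with m j q
    ... | inj₁ refl = r
    ... | inj₂ r′ = tr r r′

DecR IncR : ∀ {M} → Word M → Fin M → Fin M → Set
DecR σ i k = σ k Fin.< σ i
IncR σ i k = σ i Fin.< σ k

module _ {M} {R : Fin M → Fin M → Set} {β} (tr : ∀ {i j k} → R i j → R j k → R i k) (H : Height R β) where

  height-bound : ∀ D → ¬ (∃ λ s → Subset.∣ s ∣ ≡ suc D × ChainOn R s) → ∀ i → β i < D
  height-bound D h i = ≰⇒> λ le → go (β i) i refl le
    where
    go : ∀ b i → β i ≡ b → ¬ D ≤ b
    go b i e le with m≤n⇒m<n∨m≡n le
    ... | inj₂ refl = let (s , c , ch , _) = height⇒chain tr H i D e in h (s , c , ch)
    go (suc b) i e le | inj₁ lt = let (k , _ , _ , e′) = drop H e in go b k e′ (s≤s⁻¹ lt)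

  bound-chain : ∀ D → (∀ i → β i < D) → ¬ (∃ λ s → Subset.∣ s ∣ ≡ suc D × ChainOn R s)
  bound-chain D h (s , c , ch) = let (i , _ , le) = chain⇒height H s D ch c in <⇒≱ (h i) le

injective⇒hits : ∀ {n} (f : Fin n → Fin n) → (∀ {i j} → f i ≡ f j → i ≡ j) → ∀ y → ∃ λ x → f x ≡ y
injective⇒hits {suc n} f inj y with Finₚ.any? (λ x → f x Finₚ.≟ y)
... | yes h = h
... | no ¬h = contradiction (Finₚ.injective⇒≤ {f = λ x → Fin.punchOut (y≢ x)}
  (λ {i} {j} e → inj (Finₚ.punchOut-injective (y≢ i) (y≢ j) e))) (<⇒≱ (n<1+n n))
  where
  y≢ : ∀ x → y ≢ f x
  y≢ x e = ¬h (x , sym e)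

record Grid {M} (D ℓ : ℕ) (α β : Fin M → ℕ) : Set where
  field
    α<ℓ : ∀ i → α i < ℓ
    β<D : ∀ i → β i < D
    labels-injective : ∀ {i k} → α i ≡ α k → β i ≡ β k → i ≡ k

module GridProperties {D ℓ} {α β : Fin (D * ℓ) → ℕ} (𝒢 : Grid D ℓ α β) where
  open Grid 𝒢

  -- The number `D * ℓ` of positions equals the number of cells, so distinct labels use every cell.
  -- This is where extremality enters.
  at : ∀ {a b} → a < ℓ → b < D → ∃ λ i → α i ≡ a × β i ≡ b
  at p q with injective⇒hits code code-injective (Fin.combine (fromℕ< q) (fromℕ< p))
    where
    code : Fin (D * ℓ) → Fin (D * ℓ)
    code i = Fin.combine (fromℕ< (β<D i)) (fromℕ< (α<ℓ i))
    code-injective : ∀ {i j} → code i ≡ code j → i ≡ j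
    code-injective {i} {j} e with Finₚ.combine-injective (fromℕ< (β<D i)) _ (fromℕ< (β<D j)) _ e
    ... | e₁ , e₂ = labels-injective (Finₚ.fromℕ<-injective _ _ _ _ e₂) (Finₚ.fromℕ<-injective _ _ _ _ e₁)
  ... | i , e with Finₚ.combine-injective (fromℕ< (β<D i)) (fromℕ< (α<ℓ i)) (fromℕ< q) (fromℕ< p) e
  ... | e₁ , e₂ = i , Finₚ.fromℕ<-injective _ _ _ _ e₂ , Finₚ.fromℕ<-injective _ _ _ _ e₁

-- The head of a lattice word is its last step, so `after β i` is the part read before the letter at
-- position `i`.
after : ∀ {M} → (Fin M → ℕ) → Fin M → List ℕ
after β Fin.zero = tabulate (β ∘ Fin.suc)
after β (Fin.suc i) = after (β ∘ Fin.suc) i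

after-< : ∀ {M} (β : Fin M → ℕ) k → cnt (after β k) (β k) < cnt (tabulate β) (β k)
after-< β Fin.zero = ≤-reflexive (sym (sh-same (β Fin.zero) (map just (tabulate (β ∘ Fin.suc)))))
after-< β (Fin.suc k) = ≤-trans (after-< (β ∘ Fin.suc) k) (m≤n+m _ (𝟙 (β Fin.zero ≟ β (Fin.suc k))))

after-strict : ∀ {M} (β : Fin M → ℕ) {i k} → i Fin.< k → cnt (after β k) (β k) < cnt (after β i) (β k)
after-strict β {Fin.zero} {Fin.suc k} lt = after-< (β ∘ Fin.suc) k
after-strict β {Fin.suc i} {Fin.suc k} lt = after-strict (β ∘ Fin.suc) (s<s⁻¹ lt)

after-≤ : ∀ {M} (β : Fin M → ℕ) k b → cnt (after β k) b ≤ cnt (tabulate β) b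
after-≤ β Fin.zero b = m≤n+m _ (𝟙 (β Fin.zero ≟ b))
after-≤ β (Fin.suc k) b = ≤-trans (after-≤ (β ∘ Fin.suc) k b) (m≤n+m _ (𝟙 (β Fin.zero ≟ b)))

after-antitone : ∀ {M} (β : Fin M → ℕ) {i k} b → i Fin.< k → cnt (after β k) b ≤ cnt (after β i) b
after-antitone β {Fin.zero} {Fin.suc k} b lt = after-≤ (β ∘ Fin.suc) k b
after-antitone β {Fin.suc i} {Fin.suc k} b lt = after-antitone (β ∘ Fin.suc) b (s<s⁻¹ lt)

after-first : ∀ {M} (β : Fin M → ℕ) {b t} → cnt (tabulate β) b ≡ suc t →
  ∃ λ k → β k ≡ b × cnt (after β k) b ≡ t
after-first {suc M} β {b} {t} e with β Fin.zero ≟ b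
... | yes refl = Fin.zero , refl , suc-injective (trans (sym (sh-same (β Fin.zero) (map just (tabulate (β ∘ Fin.suc))))) e)
... | no ne with after-first (β ∘ Fin.suc) (trans (sym (sh-diff (map just (tabulate (β ∘ Fin.suc))) ne)) e)
... | k , p , q = Fin.suc k , p , q

after-next : ∀ {M} (β : Fin M → ℕ) i {b t} → cnt (after β i) b ≡ suc t →
  ∃ λ k → i Fin.< k × β k ≡ b × cnt (after β k) b ≡ t
after-next β Fin.zero e with after-first (β ∘ Fin.suc) e
... | k , p , q = Fin.suc k , z<s , p , q
after-next β (Fin.suc i) e with after-next (β ∘ Fin.suc) i e
... | k , lt , p , q = Fin.suc k , s<s lt , p , q

after-height : ∀ {M} (β : Fin M → ℕ) → Height (λ i k → β i ≡ β k) (λ i → cnt (after β i) (β i))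
after-height β .rise {i} {k} lt e = subst (λ b → cnt (after β k) (β k) < cnt (after β i) b) (sym e) (after-strict β lt)
after-height β .drop {i} e with after-next β i e
... | k , lt , p , q = k , lt , sym p , trans (cong (cnt (after β k)) p) q

Lat⁺ : ∀ {M} (β : Fin M → ℕ) → (∀ i → Add (cnt (after β i)) (β i)) → Lat (tabulate β)
Lat⁺ {zero} β h = tt
Lat⁺ {suc M} β h = h Fin.zero , Lat⁺ (β ∘ Fin.suc) (h ∘ Fin.suc)

Lat⁻ : ∀ {M} (β : Fin M → ℕ) → Lat (tabulate β) → ∀ i → Add (cnt (after β i)) (β i)
Lat⁻ β (a , l) Fin.zero = a
Lat⁻ β (a , l) (Fin.suc i) = Lat⁻ (β ∘ Fin.suc) l i

module Extremal (d ℓ : ℕ) where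

  private
    D = suc d
    M = D * ℓ

  -- The labels (α i , β i) are the column and row of i in a standard filling of the rectangle, read from
  -- the last position downwards; they are all distinct, hence exhaust the ℓ × D cells.
  module FromInvolution (σ : Word M) (perm : IsPerm σ) (inv : IsInvolution σ) {α β : Fin M → ℕ}
    (Hα : Height (IncR σ) α) (Hβ : Height (DecR σ) β) (α<ℓ : ∀ i → α i < ℓ) (β<D : ∀ i → β i < D) where

    -- The Erdős-Szekeres argument: two positions form either a rise or a fall of `σ`.
    order : ∀ {i k} → i Fin.< k → (α k < α i) ⊎ (β k < β i)
    order {i} {k} lt with Finₚ.<-cmp (σ i) (σ k)
    ... | tri< l _ _ = inj₁ (rise Hα lt l)
    ... | tri≈ _ e _ = contradiction (cong toℕ (perm i k e)) (<⇒≢ lt)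
    ... | tri> _ _ l = inj₂ (rise Hβ lt l)

    same-α : ∀ {i k} → α i ≡ α k → β k < β i → i Fin.< k
    same-α {i} {k} e lt with Finₚ.<-cmp i k
    ... | tri< l _ _ = l
    ... | tri≈ _ refl _ = contradiction lt (<-irrefl refl)
    ... | tri> _ _ l with order l
    ... | inj₁ q = contradiction e (<⇒≢ q)
    ... | inj₂ q = contradiction lt (<-asym q)

    same-β : ∀ {i k} → β i ≡ β k → α k < α i → i Fin.< k
    same-β {i} {k} e lt with Finₚ.<-cmp i k
    ... | tri< l _ _ = l
    ... | tri≈ _ refl _ = contradiction lt (<-irrefl refl)
    ... | tri> _ _ l with order l
    ... | inj₁ q = contradiction lt (<-asym q)
    ... | inj₂ q = contradiction e (<⇒≢ q)

    grid : Grid D ℓ α β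
    grid = record { α<ℓ = α<ℓ ; β<D = β<D ; labels-injective = λ {i} {k} → inj i k }
      where
      inj : ∀ i k → α i ≡ α k → β i ≡ β k → i ≡ k
      inj i k e e′ with Finₚ.<-cmp i k
      ... | tri≈ _ p _ = p
      ... | tri< l _ _ = [ (λ q → contradiction (sym e) (<⇒≢ q)) , (λ q → contradiction (sym e′) (<⇒≢ q)) ]′ (order l)
      ... | tri> _ _ l = [ (λ q → contradiction e (<⇒≢ q)) , (λ q → contradiction e′ (<⇒≢ q)) ]′ (order l)

    open GridProperties grid using (at)

    α-height : Height (λ i k → β i ≡ β k) α
    α-height .rise lt e = [ id , (λ q → contradiction (sym e) (<⇒≢ q)) ]′ (order lt)
    α-height .drop {i} {h} e with at (<-trans (subst (h <_) (sym e) (n<1+n h)) (α<ℓ i)) (β<D i)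
    ... | k , p , q = k , same-β (sym q) (subst₂ _<_ (sym p) (sym e) (n<1+n h)) , sym q , p

    -- Both sides are heights for the relation of having equal `β`, and heights are unique.
    -- Consequently `β` alone determines `α`.
    after-α : ∀ i → cnt (after β i) (β i) ≡ α i
    after-α = height-unique (after-height β) α-height

    total : ∀ b → b < D → cnt (tabulate β) b ≡ ℓ
    total b lt = ≤-antisym (upper (cnt (tabulate β) b) refl) (lower ℓ ≤-refl)
      where
      upper : ∀ t → cnt (tabulate β) b ≡ t → t ≤ ℓ
      upper zero e = z≤n
      upper (suc t) e with after-first β e
      ... | k , refl , q = subst (_< ℓ) (trans (sym (after-α k)) q) (α<ℓ k)
      lower : ∀ a → a ≤ ℓ → a ≤ cnt (tabulate β) b
      lower zero le = z≤n
      lower (suc a) le with at le lt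
      ... | k , refl , refl = subst (_< cnt (tabulate β) (β k)) (after-α k) (after-< β k)

    lattice : Lat (tabulate β)
    lattice = Lat⁺ β λ i → add i (β i) refl
      where
      add : ∀ i b → β i ≡ b → Add (cnt (after β i)) b
      add i zero e = tt
      -- The position `k` with labels `α i` and `b` comes after `i`. It is followed by `α i` letters
      -- `b`; counting `k` as well, there are more letters `b` after `i` than letters `suc b`, of
      -- which there are `α i`.
      add i (suc b) e with at (α<ℓ i) (<-trans (subst (b <_) (sym e) (n<1+n b)) (β<D i))
      ... | k , p , refl = subst (_< cnt (after β i) (β k))
        (trans (after-α k) (trans p (trans (sym (after-α i)) (cong (cnt (after β i)) e))))
        (after-strict β (same-α (sym p) (subst (β k <_) (sym e) (n<1+n (β k)))))

    private
      σσ< : ∀ {i k} → i Fin.< k → σ (σ i) Fin.< σ (σ k)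
      σσ< {i} {k} = subst₂ Fin._<_ (sym (inv i)) (sym (inv k))

    -- An involution carries a rise at `i`, `k` to a rise at `σ i`, `σ k`, so `α ∘ σ` falls along
    -- rises too and dominates the height `α`.
    α-σ : ∀ i → α (σ i) ≡ α i
    α-σ i = ≤-antisym (subst (α (σ i) ≤_) (cong α (inv i)) (le (σ i))) (le i)
      where
      le : ∀ i → α i ≤ α (σ i)
      le = height-min (α ∘ σ) Hα (λ lt r → rise Hα r (σσ< lt))

    -- An involution carries an inversion to an inversion with the two positions in reversed order,
    -- so `d ∸ β (σ j)` falls along inversions and dominates `β`. For the other bound, `column`
    -- climbs from `k` through the cells with the same `α` up to row `d`; each step is an inversion,
    -- since a rise would change `α`.
    β-σ : ∀ i → β (σ i) ≡ d ∸ β i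
    β-σ i = ≤-antisym
      (subst (λ z → β (σ i) ≤ d ∸ β z) (inv i) (height-min (λ j → d ∸ β (σ j)) Hβ
        (λ {j} {k} lt r → ∸-monoʳ-< (rise Hβ r (σσ< lt)) (s≤s⁻¹ (β<D (σ k)))) (σ i)))
      (column (d ∸ β i) i (m+[n∸m]≡n (s≤s⁻¹ (β<D i))))
      where
      column : ∀ e k → β k + e ≡ d → e ≤ β (σ k)
      column zero k eq = z≤n
      column (suc e) k eq with at (α<ℓ k) (s≤s (subst (suc (β k) ≤_) (trans (sym (+-suc (β k) e)) eq) (m≤m+n _ e)))
      ... | k′ , p , q = ≤-<-trans (column e k′ (trans (cong (_+ e) q) (trans (sym (+-suc (β k) e)) eq)))
        (rise Hβ σk<σk′ (σσ< k′<k))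
        where
        k′<k : k′ Fin.< k
        k′<k = same-α p (≤-reflexive (sym q))
        σk<σk′ : σ k Fin.< σ k′
        σk<σk′ with Finₚ.<-cmp (σ k) (σ k′)
        ... | tri< l _ _ = l
        ... | tri≈ _ e _ = contradiction (cong toℕ (sym (perm k k′ e))) (<⇒≢ k′<k)
        ... | tri> _ _ l = contradiction (sym p) (<⇒≢ (rise Hα k′<k l))

  module FromWord (β : Fin M → ℕ) (β<D : ∀ i → β i < D) (lat : Lat (tabulate β))
    (total : ∀ b → b < D → cnt (tabulate β) b ≡ ℓ) where

    α : Fin M → ℕ
    α i = cnt (after β i) (β i)

    α<ℓ : ∀ i → α i < ℓ
    α<ℓ i = subst (α i <_) (total (β i) (β<D i)) (after-< β i)

    row : ∀ {i k} → i Fin.< k → β i ≡ β k → α k < α i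
    row = rise (after-height β)

    grid : Grid D ℓ α β
    grid = record { α<ℓ = α<ℓ ; β<D = β<D ; labels-injective = λ {i} {k} → inj i k }
      where
      inj : ∀ i k → α i ≡ α k → β i ≡ β k → i ≡ k
      inj i k e e′ with Finₚ.<-cmp i k
      ... | tri≈ _ p _ = p
      ... | tri< l _ _ = contradiction (sym e) (<⇒≢ (row l e′))
      ... | tri> _ _ l = contradiction e (<⇒≢ (row l (sym e′)))

    open Grid grid using (labels-injective)
    open GridProperties grid using (at)

    row-mono : ∀ {i k} → β i ≡ β k → α i ≤ α k → k Fin.≤ i
    row-mono e le = ≮⇒≥ λ lt → <⇒≱ (row lt e) le

    column-mono : ∀ {i k} → α i ≡ α k → suc (β i) ≡ β k → k Fin.≤ i
    column-mono {i} {k} e e′ = ≮⇒≥ λ lt → <-irrefl (sym e)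
      (<-≤-trans (add (β k) e′ (Lat⁻ β lat k)) (after-antitone β (β i) lt))
      where
      add : ∀ b → suc (β i) ≡ b → Add (cnt (after β k)) b → cnt (after β k) b < cnt (after β k) (β i)
      add _ refl a = a

    -- A standard filling is monotone along rows and columns; the way from `i` to `k` turns at the
    -- cell with labels `α i` and `β k`.
    mono : ∀ i k → α i ≤ α k → β i ≤ β k → k Fin.≤ i
    mono i k p q with at (α<ℓ i) (β<D k)
    ... | j , u , v = ≤-trans (row-mono v (subst (_≤ α k) (sym u) p)) (column (β k ∸ β i) j u (trans (m+[n∸m]≡n q) (sym v)))
      where
      column : ∀ e j → α j ≡ α i → β i + e ≡ β j → j Fin.≤ i
      column zero j u v = ≤-reflexive (cong toℕ (labels-injective u (trans (sym v) (+-identityʳ (β i)))))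
      column (suc e) j u v with at (α<ℓ i) (<-trans (≤-reflexive (trans (sym (+-suc (β i) e)) v)) (β<D j))
      ... | j′ , u′ , v′ = ≤-trans
        (column-mono (trans u′ (sym u)) (trans (cong suc v′) (trans (sym (+-suc (β i) e)) v)))
        (column e j′ u′ (sym v′))

    private
      image : ∀ i → ∃ λ j → α j ≡ α i × β j ≡ d ∸ β i
      image i = at (α<ℓ i) (s≤s (m∸n≤m d (β i)))

    -- Each column of the rectangle is turned upside down, as `α-σ` and `β-σ` force for an extremal
    -- involution.
    σ : Word M
    σ i = proj₁ (image i)

    α-σ : ∀ i → α (σ i) ≡ α i
    α-σ i = proj₁ (proj₂ (image i))

    β-σ : ∀ i → β (σ i) ≡ d ∸ β i
    β-σ i = proj₂ (proj₂ (image i))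

    inv : IsInvolution σ
    inv i = labels-injective (trans (α-σ (σ i)) (α-σ i))
      (trans (β-σ (σ i)) (trans (cong (d ∸_) (β-σ i)) (m∸[m∸n]≡n (s≤s⁻¹ (β<D i)))))

    perm : IsPerm σ
    perm i j e = trans (sym (inv i)) (trans (cong σ e) (inv j))

    private
      mono-σ : ∀ i k → α i ≤ α k → β k ≤ β i → σ k Fin.≤ σ i
      mono-σ i k p q = mono (σ i) (σ k) (subst₂ _≤_ (sym (α-σ i)) (sym (α-σ k)) p)
        (subst₂ _≤_ (sym (β-σ i)) (sym (β-σ k)) (∸-monoʳ-≤ d q))

      strict : ∀ {i k : Fin M} → i Fin.≤ k → i ≢ k → i Fin.< k
      strict le ne = ≤∧≢⇒< le (ne ∘ Finₚ.toℕ-injective)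

    -- `mono` orders positions and `mono-σ` orders values, with `β` compared in opposite directions.
    -- If `β` did not fall along an inversion, one of the two would be violated, whichever way the
    -- `α` labels compare. The witness for `drop` is the neighbouring cell in the same column.
    Hβ : Height (DecR σ) β
    Hβ .rise {i} {k} lt r = ≰⇒> λ le →
      <⇒≱ r (mono-σ k i (≮⇒≥ λ lt′ → <⇒≱ lt (mono i k (<⇒≤ lt′) le)) le)
    Hβ .drop {i} {h} e with at (α<ℓ i) (<-trans (subst (h <_) (sym e) (n<1+n h)) (β<D i))
    ... | k , u , refl = k , strict (mono k i (≤-reflexive u) le) (ne ∘ sym) ,
      strict (mono-σ i k (≤-reflexive (sym u)) le) (ne ∘ perm k i) , refl
      where
      le : β k ≤ β i
      le = subst (β k ≤_) (sym e) (n≤1+n (β k))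
      ne : k ≢ i
      ne refl = 1+n≢n (sym e)

    Hα : Height (IncR σ) α
    Hα .rise {i} {k} lt r = ≰⇒> λ le →
      <⇒≱ r (mono-σ i k le (≮⇒≥ λ lt′ → <⇒≱ lt (mono i k le (<⇒≤ lt′))))
    Hα .drop {i} {h} e with at (<-trans (subst (h <_) (sym e) (n<1+n h)) (α<ℓ i)) (β<D i)
    ... | k , refl , v = k , strict (mono k i le (≤-reflexive v)) (ne ∘ sym) ,
      strict (mono-σ k i le (≤-reflexive (sym v))) (λ p → ne (sym (perm i k p))) , refl
      where
      le : α k ≤ α i
      le = subst (α k ≤_) (sym e) (n≤1+n (α k))
      ne : k ≢ i
      ne refl = 1+n≢n (sym e)

    extremal : 0 < ℓ → InvLDSLIS D ℓ σ
    extremal ℓ>0 = perm , inv ,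
      (longest-dec (at ℓ>0 (n<1+n d)) , bound-chain dec-trans Hβ D β<D) ,
      (longest-inc ℓ ℓ>0 refl , bound-chain Finₚ.<-trans Hα ℓ α<ℓ)
      where
      dec-trans : ∀ {i j k} → DecR σ i j → DecR σ j k → DecR σ i k
      dec-trans p q = Finₚ.<-trans q p
      longest-dec : (∃ λ i → α i ≡ 0 × β i ≡ d) → HasDecSub D σ
      longest-dec (i , _ , e) with height⇒chain dec-trans Hβ i d e
      ... | s , c , h , _ = s , c , h
      longest-inc : ∀ k → 0 < k → k ≡ ℓ → HasIncSub k σ
      longest-inc (suc k) _ eq with at (≤-reflexive eq) z<s
      ... | i , e , _ with height⇒chain Finₚ.<-trans Hα i k e
      ... | s , c , h , _ = s , c , h

  private
    R : List ℕ → List ℕ → Set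
    R w u = ∃₂ λ (σ : Word M) β → w ≡ toL σ × u ≡ tabulate β × InvLDSLIS D ℓ σ × Height (DecR σ) β

    target : List ℕ
    target = lst D (λ _ → ℓ)

    rectangles : List (List ℕ)
    rectangles = filter (λ u → lst D (cnt u) ≟ᴸ target) (words D M)

    resp : ∀ {σ τ : Word M} → σ ≗ τ → InvLDSLIS D ℓ σ → InvLDSLIS D ℓ τ
    resp {σ} {τ} e (perm , inv , (hd , ¬hd) , (hi , ¬hi)) =
      (λ i j q → perm i j (trans (e i) (trans q (sym (e j))))) ,
      (λ i → trans (cong τ (sym (e i))) (trans (sym (e (σ i))) (inv i))) ,
      (dec e hd , ¬hd ∘ dec (sym ∘ e)) , (increasing e hi , ¬hi ∘ increasing (sym ∘ e))
      where
      dec : ∀ {k} {σ τ : Word M} → σ ≗ τ → HasDecSub k σ → HasDecSub k τ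
      dec e (s , c , h) = s , c , λ i j p q lt → subst₂ Fin._<_ (e j) (e i) (h i j p q lt)
      increasing : ∀ {k} {σ τ : Word M} → σ ≗ τ → HasIncSub k σ → HasIncSub k τ
      increasing e (s , c , h) = s , c , λ i j p q lt → subst₂ Fin._<_ (e i) (e j) (h i j p q lt)

    module Of {σ : Word M} {β : Fin M → ℕ} (e : InvLDSLIS D ℓ σ) (Hβ : Height (DecR σ) β) where
      private
        perm = proj₁ e
        inv = proj₁ (proj₂ e)
        incs = height-exists (IncR σ) (λ i k → σ i Fin.<? σ k)
        Hα = proj₂ incs
        β<D : ∀ i → β i < D
        β<D = height-bound (λ p q → Finₚ.<-trans q p) Hβ D (proj₂ (proj₁ (proj₂ (proj₂ e))))
        α<ℓ : ∀ i → proj₁ incs i < ℓ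
        α<ℓ = height-bound Finₚ.<-trans Hα ℓ (proj₂ (proj₂ (proj₂ (proj₂ e))))
      open FromInvolution σ perm inv Hα Hβ α<ℓ β<D public
      β-bound : ∀ i → β i < D
      β-bound = β<D

    lst-cong-< : ∀ d {c c′} → (∀ i → i < d → c i ≡ c′ i) → lst d c ≡ lst d c′
    lst-cong-< zero h = refl
    lst-cong-< (suc d) h = cong₂ _∷_ (cong (_+ d) (h 0 z<s)) (lst-cong-< d (λ i lt → h (suc i) (s<s lt)))

    forth : ∀ {w} → w ∈ enum M M (invLDSLIS? D ℓ) → ∃ λ u → u ∈ rectangles × R w u
    forth i with ∈-enum⁻ M M (invLDSLIS? D ℓ) i
    ... | σ , e , refl with height-exists (DecR σ) (λ i k → σ k Fin.<? σ i)
    ... | β , Hβ = tabulate β ,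
      ∈-filter⁺ _ (∈-words⁺ D M _ (length-tabulate β) (Allₚ.tabulate⁺ β-bound) lattice) (lst-cong-< D total) ,
      σ , β , refl , refl , e , Hβ
      where open Of e Hβ

    back : 0 < ℓ → ∀ {u} → u ∈ rectangles → ∃ λ w → w ∈ enum M M (invLDSLIS? D ℓ) × R w u
    back ℓ>0 i with ∈-filter⁻ _ {xs = words D M} i
    ... | j , e with ∈-words⁻ D M j
    ... | len , a , l with toL-surjective M D _ len a
    ... | f , refl = toL σ , ∈-enum⁺ M M (invLDSLIS? D ℓ) resp σ (extremal ℓ>0) ,
      σ , (λ i → toℕ (f i)) , refl , refl , extremal ℓ>0 , Hβ
      where open FromWord (λ i → toℕ (f i)) (λ i → Finₚ.toℕ<n (f i)) l (lst-injective D {cnt (tabulate (λ i → toℕ (f i)))} e)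

    tabulate-injective : ∀ {n} {f g : Fin n → ℕ} → tabulate f ≡ tabulate g → f ≗ g
    tabulate-injective e Fin.zero = ∷-injectiveˡ e
    tabulate-injective e (Fin.suc i) = tabulate-injective (∷-injectiveʳ e) i

    tabulate-≗ : ∀ {n} {f g : Fin n → ℕ} → f ≗ g → tabulate f ≡ tabulate g
    tabulate-≗ {zero} e = refl
    tabulate-≗ {suc n} e = cong₂ _∷_ (e Fin.zero) (tabulate-≗ (e ∘ Fin.suc))

    functional : ∀ {w u u′} → R w u → R w u′ → u ≡ u′
    functional (σ , β , refl , refl , _ , H) (τ , γ , p , refl , _ , K) =
      tabulate-≗ (height-unique H (record
        { rise = λ lt r → rise K lt (subst₂ Fin._<_ (σ≗τ _) (σ≗τ _) r)
        ; drop = λ e → let (k , lt , r , e′) = drop K e in k , lt , subst₂ Fin._<_ (sym (σ≗τ _)) (sym (σ≗τ _)) r , e′ }))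
      where
      σ≗τ : σ ≗ τ
      σ≗τ = toL-injective p

    -- σ i is the unique position with labels (α i , d - 1 - β i), and α is a function of β alone.
    injective : ∀ {w w′ u} → R w u → R w′ u → w ≡ w′
    injective (σ , β , refl , refl , e , H) (τ , γ , refl , p , e′ , K) = toL-cong λ i →
      Grid.labels-injective A.grid
        (trans (A.α-σ i) (trans (α≗ i) (trans (sym (B.α-σ i)) (sym (α≗ (τ i))))))
        (trans (A.β-σ i) (trans (cong (d ∸_) (β≗γ i)) (trans (sym (B.β-σ i)) (sym (β≗γ (τ i))))))
      where
      module A = Of e H
      module B = Of e′ K
      β≗γ : β ≗ γ
      β≗γ = tabulate-injective p
      after-cong : ∀ {n} {f g : Fin n → ℕ} → f ≗ g → ∀ i → after f i ≡ after g i
      after-cong e Fin.zero = tabulate-≗ (e ∘ Fin.suc)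
      after-cong e (Fin.suc i) = after-cong (e ∘ Fin.suc) i
      α≗ : ∀ i → _
      α≗ i = trans (sym (A.after-α i)) (trans (cong₂ cnt (after-cong β≗γ i) (β≗γ i)) (B.after-α i))

  numInv-mult : 0 < ℓ → numInv D ℓ M ≡ mult (L D M) (lst D (λ _ → ℓ))
  numInv-mult ℓ>0 = begin
    numInv D ℓ M ≡⟨ sym (length-enum M M (invLDSLIS? D ℓ)) ⟩
    length (enum M M (invLDSLIS? D ℓ))
      ≡⟨ length-≡ R _ rectangles (enum-unique M M (invLDSLIS? D ℓ)) (Uniqueₚ.filter⁺ _ (words-unique D M))
           forth (back ℓ>0) injective functional ⟩
    length rectangles ≡⟨ count-shape D M target ⟩
    mult (L D M) (lst D (λ _ → ℓ)) ∎
    where open ≡-Reasoning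

-- Factorial estimates

bernoulli : ∀ m h k → (m + k * h) * m ^ k ≤ m * (m + h) ^ k
bernoulli m h zero = ≤-reflexive (cong (_* 1) (+-identityʳ m))
bernoulli m h (suc k) = begin
  (m + suc k * h) * (m * m ^ k) ≤⟨ m≤m+n _ (k * h * h * m ^ k) ⟩
  (m + suc k * h) * (m * m ^ k) + k * h * h * m ^ k ≡⟨ regroup m h k (m ^ k) ⟩
  (m + h) * ((m + k * h) * m ^ k) ≤⟨ *-monoʳ-≤ (m + h) (bernoulli m h k) ⟩
  (m + h) * (m * (m + h) ^ k) ≡⟨ x∙yz≈y∙xz (m + h) m ((m + h) ^ k) ⟩
  m * ((m + h) * (m + h) ^ k) ∎
  where
  open ≤-Reasoning
  regroup : ∀ m h k p → (m + (1 + k) * h) * (m * p) + k * h * h * p ≡ (m + h) * ((m + k * h) * p)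
  regroup = solve-∀

doubling : ∀ m h k .{{_ : NonZero m}} → m ≤ k * h → 2 * m ^ k ≤ (m + h) ^ k
doubling m h k le = *-cancelˡ-≤ m (begin
  m * (2 * m ^ k) ≡⟨ regroup m (m ^ k) ⟩
  (m + m) * m ^ k ≤⟨ *-monoˡ-≤ (m ^ k) (+-monoʳ-≤ m le) ⟩
  (m + k * h) * m ^ k ≤⟨ bernoulli m h k ⟩
  m * (m + h) ^ k ∎)
  where
  open ≤-Reasoning
  regroup : ∀ m p → m * (2 * p) ≡ (m + m) * p
  regroup = solve-∀

^-distrib-* : ∀ a b n → (a * b) ^ n ≡ a ^ n * b ^ n
^-distrib-* a b zero = refl
^-distrib-* a b (suc n) = trans (cong (a * b *_) (^-distrib-* a b n)) (regroup a b (a ^ n) (b ^ n))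
  where
  regroup : ∀ a b c e → a * b * (c * e) ≡ a * c * (b * e)
  regroup = solve-∀

doubling-^ : ∀ m h k r .{{_ : NonZero m}} → m ≤ k * h → 2 ^ r * m ^ (k * r) ≤ (m + h) ^ (k * r)
doubling-^ m h k r le = begin
  2 ^ r * m ^ (k * r) ≡⟨ cong (2 ^ r *_) (sym (^-*-assoc m k r)) ⟩
  2 ^ r * (m ^ k) ^ r ≡⟨ sym (^-distrib-* 2 (m ^ k) r) ⟩
  (2 * m ^ k) ^ r ≤⟨ ^-monoˡ-≤ r (doubling m h k le) ⟩
  ((m + h) ^ k) ^ r ≡⟨ ^-*-assoc (m + h) k r ⟩
  (m + h) ^ (k * r) ∎
  where open ≤-Reasoning

!-lower : ∀ m j → m ! * m ^ j ≤ (m + j) !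
!-lower m zero = ≤-reflexive (trans (*-identityʳ _) (cong _! (sym (+-identityʳ m))))
!-lower m (suc j) = begin
  m ! * (m * m ^ j) ≡⟨ x∙yz≈y∙xz (m !) m (m ^ j) ⟩
  m * (m ! * m ^ j) ≤⟨ *-mono-≤ (≤-trans (m≤m+n m j) (n≤1+n (m + j))) (!-lower m j) ⟩
  suc (m + j) ! ≡⟨ cong _! (sym (+-suc m j)) ⟩
  (m + suc j) ! ∎
  where
  open ≤-Reasoning

!-upper : ∀ m j N → m + j ≤ N → (m + j) ! ≤ m ! * N ^ j
!-upper m zero N le = ≤-reflexive (trans (cong _! (+-identityʳ m)) (sym (*-identityʳ _)))
!-upper m (suc j) N le = begin
  (m + suc j) ! ≡⟨ cong _! (+-suc m j) ⟩
  suc (m + j) * (m + j) ! ≤⟨ *-mono-≤ le′ (!-upper m j N (≤-trans (n≤1+n _) le′)) ⟩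
  N * (m ! * N ^ j) ≡⟨ x∙yz≈y∙xz N (m !) (N ^ j) ⟩
  m ! * (N * N ^ j) ∎
  where
  open ≤-Reasoning
  le′ : suc (m + j) ≤ N
  le′ = subst (_≤ N) (+-suc m j) le

-- The quotient `x! / n^x` is least at `x = n`, because passing from `x - 1` to `x` multiplies it by
-- `x / n`.
!-near : ∀ n x → n ! * n ^ x ≤ x ! * n ^ n
!-near n x with ≤-total n x
... | inj₁ le with m≤n⇒∃[o]m+o≡n le
... | j , refl = begin
  n ! * n ^ (n + j) ≡⟨ cong (n ! *_) (^-distribˡ-+-* n n j) ⟩
  n ! * (n ^ n * n ^ j) ≡⟨ swap (n !) (n ^ n) (n ^ j) ⟩
  n ! * n ^ j * n ^ n ≤⟨ *-monoˡ-≤ (n ^ n) (!-lower n j) ⟩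
  (n + j) ! * n ^ n ∎
  where
  open ≤-Reasoning
  swap : ∀ a b c → a * (b * c) ≡ a * c * b
  swap = solve-∀
!-near n x | inj₂ le with m≤n⇒∃[o]m+o≡n le
... | j , refl = begin
  (x + j) ! * n ^ x ≤⟨ *-monoˡ-≤ (n ^ x) (!-upper x j n ≤-refl) ⟩
  x ! * n ^ j * n ^ x ≡⟨ swap (x !) (n ^ j) (n ^ x) ⟩
  x ! * (n ^ x * n ^ j) ≡⟨ cong (x ! *_) (sym (^-distribˡ-+-* n x j)) ⟩
  x ! * n ^ (x + j) ∎
  where
  open ≤-Reasoning
  swap : ∀ a b c → a * b * c ≡ a * (c * b)
  swap = solve-∀

Far : ℕ → ℕ → ℕ → Set
Far n h x = (n + (h + h) ≤ x) ⊎ (x + (h + h) ≤ n)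

far? : ∀ n h x → Dec (Far n h x)
far? n h x with n + (h + h) ≤? x | x + (h + h) ≤? n
... | yes p | _ = yes (inj₁ p)
... | no _ | yes q = yes (inj₂ q)
... | no ¬p | no ¬q = no [ ¬p , ¬q ]′

-- Distance `2h` with `h = k * r` leaves `h` factors lying at least `h` beyond the point where the
-- other `h` begin. Comparing them with the larger base gains `h` ratios of the form `1 + h/m` with
-- `m ≤ n`; by `n ≤ k * h` every `k` of these multiply to at least 2, which makes `2 ^ r` in all.
!-far : ∀ n k r x .{{_ : NonZero n}} .{{_ : NonZero (k * r)}} → n ≤ k * (k * r) → Far n (k * r) x →
  2 ^ r * (n ! * n ^ x) ≤ x ! * n ^ n
!-far n k r x le (inj₁ far) with m≤n⇒∃[o]m+o≡n far
... | j , refl = begin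
  2 ^ r * (n ! * n ^ (n + (h + h) + j)) ≡⟨ cong (λ z → 2 ^ r * (n ! * z)) power ⟩
  2 ^ r * (n ! * (n ^ n * (n ^ h * n ^ h) * n ^ j))
    ≡⟨ regroup (2 ^ r) (n !) (n ^ n) (n ^ h) (n ^ j) ⟩
  n ! * n ^ h * (2 ^ r * n ^ h * n ^ j) * n ^ n
    ≤⟨ *-monoˡ-≤ (n ^ n) (*-mono-≤ (!-lower n h) (*-mono-≤ (doubling-^ n h k r le) (^-monoˡ-≤ j (m≤m+n n h)))) ⟩
  (n + h) ! * ((n + h) ^ h * (n + h) ^ j) * n ^ n
    ≡⟨ cong (λ z → (n + h) ! * z * n ^ n) (sym (^-distribˡ-+-* (n + h) h j)) ⟩
  (n + h) ! * (n + h) ^ (h + j) * n ^ n ≤⟨ *-monoˡ-≤ (n ^ n) (!-lower (n + h) (h + j)) ⟩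
  (n + h + (h + j)) ! * n ^ n ≡⟨ cong (λ z → z ! * n ^ n) (assoc n h j) ⟩
  (n + (h + h) + j) ! * n ^ n ∎
  where
  open ≤-Reasoning
  h = k * r
  power : n ^ (n + (h + h) + j) ≡ n ^ n * (n ^ h * n ^ h) * n ^ j
  power = trans (^-distribˡ-+-* n (n + (h + h)) j) (cong (_* n ^ j)
    (trans (^-distribˡ-+-* n n (h + h)) (cong (n ^ n *_) (^-distribˡ-+-* n h h))))
  regroup : ∀ t f a b c → t * (f * (a * (b * b) * c)) ≡ f * b * (t * b * c) * a
  regroup = solve-∀
  assoc : ∀ n h j → n + h + (h + j) ≡ n + (h + h) + j
  assoc = solve-∀
!-far n k r x le (inj₂ far) with m≤n⇒∃[o]m+o≡n far
... | j , refl = begin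
  2 ^ r * ((x + (h + h) + j) ! * n ^ x) ≡⟨ cong (λ z → 2 ^ r * (z ! * n ^ x)) (assoc x h j) ⟩
  2 ^ r * ((x + h + (h + j)) ! * n ^ x)
    ≤⟨ *-monoʳ-≤ (2 ^ r) (*-monoˡ-≤ (n ^ x) (!-upper (x + h) (h + j) n (≤-reflexive (sym (assoc x h j))))) ⟩
  2 ^ r * ((x + h) ! * n ^ (h + j) * n ^ x)
    ≤⟨ *-monoʳ-≤ (2 ^ r) (*-monoˡ-≤ (n ^ x) (*-monoˡ-≤ (n ^ (h + j)) (!-upper x h (x + h) ≤-refl))) ⟩
  2 ^ r * (x ! * (x + h) ^ h * n ^ (h + j) * n ^ x) ≡⟨ regroup (2 ^ r) (x !) ((x + h) ^ h) (n ^ (h + j)) (n ^ x) ⟩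
  x ! * (2 ^ r * (x + h) ^ h * (n ^ (h + j) * n ^ x))
    ≤⟨ *-monoʳ-≤ (x !) (*-monoˡ-≤ (n ^ (h + j) * n ^ x)
         (≤-trans (doubling-^ (x + h) h k r {{>-nonZero (<-≤-trans (>-nonZero⁻¹ h) (m≤n+m h x))}} (≤-trans x+h≤n le))
           (^-monoˡ-≤ h (≤-trans (≤-reflexive (+-assoc x h h)) (m≤m+n (x + (h + h)) j))))) ⟩
  x ! * (n ^ h * (n ^ (h + j) * n ^ x)) ≡⟨ cong (x ! *_) power ⟩
  x ! * n ^ (x + (h + h) + j) ∎
  where
  open ≤-Reasoning
  h = k * r
  assoc : ∀ x h j → x + (h + h) + j ≡ x + h + (h + j)
  assoc = solve-∀
  x+h≤n : x + h ≤ n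
  x+h≤n = ≤-trans (m≤m+n (x + h) (h + j)) (≤-reflexive (sym (assoc x h j)))
  regroup : ∀ t f a b c → t * (f * a * b * c) ≡ f * (t * a * (b * c))
  regroup = solve-∀
  reorder : ∀ x h j → h + (h + j + x) ≡ x + (h + h) + j
  reorder = solve-∀
  power : n ^ h * (n ^ (h + j) * n ^ x) ≡ n ^ (x + (h + h) + j)
  power = trans (cong (n ^ h *_) (sym (^-distribˡ-+-* n (h + j) x)))
    (trans (sym (^-distribˡ-+-* n h (h + j + x))) (cong (n ^_) (reorder x h j)))

-- The product of the middle δ factors of (2b+δ)!, paired symmetrically.
!-ratio-lower : ∀ b δ Y → (∀ e → δ ≡ suc e → Y ≤ 4 * ((b + δ) * (b + 1))) →
  b ! * b ! * Y ^ δ ≤ (b + δ) ! * (b + δ) ! * 4 ^ δ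
!-ratio-lower b zero Y h = ≤-reflexive (cong (λ z → z ! * z ! * 1) (sym (+-identityʳ b)))
!-ratio-lower b (suc zero) Y h = begin
  b ! * b ! * (Y * 1) ≤⟨ *-monoʳ-≤ (b ! * b !) (*-monoˡ-≤ 1 (h 0 refl)) ⟩
  b ! * b ! * (4 * ((b + 1) * (b + 1)) * 1) ≡⟨ regroup b (b !) ⟩
  suc b ! * suc b ! * (4 * 1) ≡⟨ cong (λ z → z ! * z ! * (4 * 1)) (sym (+-comm b 1)) ⟩
  (b + 1) ! * (b + 1) ! * (4 * 1) ∎
  where
  open ≤-Reasoning
  regroup : ∀ b f → f * f * (4 * ((b + 1) * (b + 1)) * 1) ≡ ((1 + b) * f) * ((1 + b) * f) * (4 * 1)
  regroup = solve-∀
!-ratio-lower b (suc (suc δ)) Y h = begin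
  b ! * b ! * (Y * (Y * Y ^ δ)) ≡⟨ assoc (b ! * b !) Y (Y ^ δ) ⟩
  b ! * b ! * Y ^ δ * (Y * Y) ≤⟨ *-monoʳ-≤ (b ! * b ! * Y ^ δ) (*-mono-≤ (h _ refl) (h _ refl)) ⟩
  b ! * b ! * Y ^ δ * (outer * outer) ≡⟨ regroup b δ (b !) (Y ^ δ) ⟩
  (suc b ! * suc b ! * Y ^ δ) * (4 * (suc (suc (b + δ)) * (4 * suc (suc (b + δ)))))
    ≤⟨ *-monoˡ-≤ _ (!-ratio-lower (suc b) δ Y inner) ⟩
  ((suc b + δ) ! * (suc b + δ) ! * 4 ^ δ) * (4 * (suc (suc (b + δ)) * (4 * suc (suc (b + δ)))))
    ≡⟨ collect (suc (suc (b + δ))) ((suc b + δ) !) (4 ^ δ) ⟩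
  suc (suc (b + δ)) ! * suc (suc (b + δ)) ! * (4 * (4 * 4 ^ δ))
    ≡⟨ cong (λ z → z ! * z ! * (4 * (4 * 4 ^ δ))) (shift b δ) ⟩
  (b + suc (suc δ)) ! * (b + suc (suc δ)) ! * (4 * (4 * 4 ^ δ)) ∎
  where
  open ≤-Reasoning
  outer : ℕ
  outer = 4 * ((b + suc (suc δ)) * (b + 1))
  assoc : ∀ a y p → a * (y * (y * p)) ≡ a * p * (y * y)
  assoc = solve-∀
  shift : ∀ b δ → 2 + (b + δ) ≡ b + (2 + δ)
  shift = solve-∀
  regroup : ∀ b δ f p → f * f * p * ((4 * ((b + (2 + δ)) * (b + 1))) * (4 * ((b + (2 + δ)) * (b + 1)))) ≡
    ((1 + b) * f * ((1 + b) * f) * p) * (4 * ((2 + (b + δ)) * (4 * (2 + (b + δ)))))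
  regroup = solve-∀
  collect : ∀ s f p → (f * f * p) * (4 * (s * (4 * s))) ≡ (s * f) * (s * f) * (4 * (4 * p))
  collect = solve-∀
  -- The next pair inwards has the same sum and a larger product, so the bound on the outermost pair
  -- is inherited.
  inner-eq : ∀ b δ → 4 * ((b + (2 + δ)) * (b + 1)) + 4 * δ ≡ 4 * ((1 + b + δ) * (1 + b + 1))
  inner-eq = solve-∀
  inner : ∀ e → δ ≡ suc e → Y ≤ 4 * ((suc b + δ) * (suc b + 1))
  inner _ _ = ≤-trans (h _ refl) (≤-trans (m≤m+n outer (4 * δ)) (≤-reflexive (inner-eq b δ)))

-- Paired symmetrically, the factors of `(b + δ)! / b!` have the sum `2b + δ + 1`, and AM-GM bounds
-- each pair. Squaring lets a middle factor be paired with itself.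
!-ratio-upper : ∀ b δ → (b + δ) ! * (b + δ) ! * 4 ^ δ ≤ b ! * b ! * ((b + b + δ + 1) * (b + b + δ + 1)) ^ δ
!-ratio-upper b zero = ≤-reflexive (cong (λ z → z ! * z ! * 1) (+-identityʳ b))
!-ratio-upper b (suc zero) = ≤-reflexive (begin
  (b + 1) ! * (b + 1) ! * (4 * 1) ≡⟨ cong (λ z → z ! * z ! * (4 * 1)) (+-comm b 1) ⟩
  suc b ! * suc b ! * (4 * 1) ≡⟨ regroup b (b !) ⟩
  b ! * b ! * ((b + b + 1 + 1) * (b + b + 1 + 1) * 1) ∎)
  where
  open ≡-Reasoning
  regroup : ∀ b f → ((1 + b) * f) * ((1 + b) * f) * (4 * 1) ≡ f * f * ((b + b + 1 + 1) * (b + b + 1 + 1) * 1)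
  regroup = solve-∀
!-ratio-upper b (suc (suc δ)) = begin
  (b + suc (suc δ)) ! * (b + suc (suc δ)) ! * (4 * (4 * 4 ^ δ))
    ≡⟨ cong (λ z → z ! * z ! * (4 * (4 * 4 ^ δ))) (sym (shift b δ)) ⟩
  suc (suc (b + δ)) ! * suc (suc (b + δ)) ! * (4 * (4 * 4 ^ δ))
    ≡⟨ sym (collect (suc (suc (b + δ))) ((suc b + δ) !) (4 ^ δ)) ⟩
  ((suc b + δ) ! * (suc b + δ) ! * 4 ^ δ) * (4 * (suc (suc (b + δ)) * (4 * suc (suc (b + δ)))))
    ≤⟨ *-monoˡ-≤ _ (!-ratio-upper (suc b) δ) ⟩
  (suc b ! * suc b ! * ((suc b + suc b + δ + 1) * (suc b + suc b + δ + 1)) ^ δ) * (4 * (suc (suc (b + δ)) * (4 * suc (suc (b + δ)))))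
    ≡⟨ cong (λ z → (suc b ! * suc b ! * (z * z) ^ δ) * (4 * (suc (suc (b + δ)) * (4 * suc (suc (b + δ)))))) (same b δ) ⟩
  (suc b ! * suc b ! * X ^ δ) * (4 * (suc (suc (b + δ)) * (4 * suc (suc (b + δ)))))
    ≡⟨ regroup b δ (b !) (X ^ δ) ⟩
  b ! * b ! * X ^ δ * (4 * ((b + suc (suc δ)) * (b + 1)) * (4 * ((b + suc (suc δ)) * (b + 1))))
    ≤⟨ *-monoʳ-≤ (b ! * b ! * X ^ δ) (*-mono-≤ amgm amgm) ⟩
  b ! * b ! * X ^ δ * (X * X) ≡⟨ assoc (b ! * b !) X (X ^ δ) ⟩
  b ! * b ! * (X * (X * X ^ δ)) ∎
  where
  open ≤-Reasoning
  X : ℕ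
  X = (b + b + suc (suc δ) + 1) * (b + b + suc (suc δ) + 1)
  shift : ∀ b δ → 2 + (b + δ) ≡ b + (2 + δ)
  shift = solve-∀
  same : ∀ b δ → 1 + b + (1 + b) + δ + 1 ≡ b + b + (2 + δ) + 1
  same = solve-∀
  assoc : ∀ a y p → a * p * (y * y) ≡ a * (y * (y * p))
  assoc = solve-∀
  collect : ∀ s f p → (f * f * p) * (4 * (s * (4 * s))) ≡ (s * f) * (s * f) * (4 * (4 * p))
  collect = solve-∀
  regroup : ∀ b δ f p → ((1 + b) * f * ((1 + b) * f) * p) * (4 * ((2 + (b + δ)) * (4 * (2 + (b + δ))))) ≡
    f * f * p * ((4 * ((b + (2 + δ)) * (b + 1))) * (4 * ((b + (2 + δ)) * (b + 1))))
  regroup = solve-∀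
  amgm-eq : ∀ b δ → 4 * ((b + (2 + δ)) * (b + 1)) + (δ + 1) * (δ + 1) ≡ (b + b + (2 + δ) + 1) * (b + b + (2 + δ) + 1)
  amgm-eq = solve-∀
  amgm : 4 * ((b + suc (suc δ)) * (b + 1)) ≤ X
  amgm = ≤-trans (m≤m+n _ ((δ + 1) * (δ + 1))) (≤-reflexive (amgm-eq b δ))

module _ (M D X Y : ℕ) (X≡ : X ≡ (M + 1) * (M + 1)) (Y+D²≤X : Y + D * D ≤ X) where

  private
    Y≤X : Y ≤ X
    Y≤X = ≤-trans (m≤m+n Y (D * D)) Y+D²≤X

  -- b! / x! compared with (X / 4) ^ ((b - x) / 2), with both sides cleared of denominators.
  !-bulk : ∀ x b → x + b ≡ M → x ≤ b + D → b ≤ x + D →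
    (b ! * b !) * (4 ^ b * X ^ x) * Y ^ D ≤ (x ! * x !) * (4 ^ x * X ^ b) * X ^ D
  !-bulk x b e x≤ b≤ with ≤-total b x
  ... | inj₁ le with m≤n⇒∃[o]m+o≡n le
  ... | δ , refl with m≤n⇒∃[o]m+o≡n (+-cancelˡ-≤ b δ D x≤)
  ... | o , refl = begin
    (b ! * b !) * (4 ^ b * X ^ (b + δ)) * Y ^ (δ + o)
      ≡⟨ cong₂ (λ u v → (b ! * b !) * (4 ^ b * u) * v) (^-distribˡ-+-* X b δ) (^-distribˡ-+-* Y δ o) ⟩
    (b ! * b !) * (4 ^ b * (X ^ b * X ^ δ)) * (Y ^ δ * Y ^ o)
      ≡⟨ regroup (b ! * b !) (4 ^ b) (X ^ b) (X ^ δ) (Y ^ δ) (Y ^ o) ⟩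
    ((b ! * b !) * Y ^ δ) * (4 ^ b * X ^ b * X ^ δ * Y ^ o)
      ≤⟨ *-mono-≤ (!-ratio-lower b δ Y cond) (*-monoʳ-≤ (4 ^ b * X ^ b * X ^ δ) (^-monoˡ-≤ o Y≤X)) ⟩
    (((b + δ) ! * (b + δ) !) * 4 ^ δ) * (4 ^ b * X ^ b * X ^ δ * X ^ o)
      ≡⟨ regroup′ ((b + δ) ! * (b + δ) !) (4 ^ δ) (4 ^ b) (X ^ b) (X ^ δ) (X ^ o) ⟩
    ((b + δ) ! * (b + δ) !) * ((4 ^ b * 4 ^ δ) * X ^ b) * (X ^ δ * X ^ o)
      ≡⟨ sym (cong₂ (λ u v → ((b + δ) ! * (b + δ) !) * (u * X ^ b) * v) (^-distribˡ-+-* 4 b δ) (^-distribˡ-+-* X δ o)) ⟩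
    ((b + δ) ! * (b + δ) !) * (4 ^ (b + δ) * X ^ b) * X ^ (δ + o) ∎
    where
    open ≤-Reasoning
    regroup : ∀ f a p q y z → f * (a * (p * q)) * (y * z) ≡ f * y * (a * p * q * z)
    regroup = solve-∀
    regroup′ : ∀ f c a p q z → f * c * (a * p * q * z) ≡ f * ((a * c) * p) * (q * z)
    regroup′ = solve-∀
    square : ∀ b e → (b + (1 + e) + b + 1) * (b + (1 + e) + b + 1) ≡ 4 * ((b + (1 + e)) * (b + 1)) + e * e
    square = solve-∀
    -- Here `x = b + δ`, so the outermost pair has sum `M + 1` and difference `δ - 1`. Four times
    -- its product is `(M + 1)² - (δ - 1)²`, which is at least `Y` because `δ ≤ D`.
    cond : ∀ c → δ ≡ suc c → Y ≤ 4 * ((b + δ) * (b + 1))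
    cond c refl = +-cancelʳ-≤ (c * c) Y _ (begin
      Y + c * c ≤⟨ +-monoʳ-≤ Y (*-mono-≤ (≤-trans (n≤1+n c) (m≤m+n (suc c) o)) (≤-trans (n≤1+n c) (m≤m+n (suc c) o))) ⟩
      Y + (suc c + o) * (suc c + o) ≤⟨ Y+D²≤X ⟩
      X ≡⟨ X≡ ⟩
      (M + 1) * (M + 1) ≡⟨ cong (λ z → (z + 1) * (z + 1)) (sym e) ⟩
      (b + suc c + b + 1) * (b + suc c + b + 1) ≡⟨ square b c ⟩
      4 * ((b + suc c) * (b + 1)) + c * c ∎)
  !-bulk x b e x≤ b≤ | inj₂ le with m≤n⇒∃[o]m+o≡n le
  ... | δ , refl = begin
    ((x + δ) ! * (x + δ) !) * (4 ^ (x + δ) * X ^ x) * Y ^ D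
      ≡⟨ cong (λ z → ((x + δ) ! * (x + δ) !) * (z * X ^ x) * Y ^ D) (^-distribˡ-+-* 4 x δ) ⟩
    ((x + δ) ! * (x + δ) !) * (4 ^ x * 4 ^ δ * X ^ x) * Y ^ D
      ≡⟨ regroup ((x + δ) ! * (x + δ) !) (4 ^ x) (4 ^ δ) (X ^ x) (Y ^ D) ⟩
    (((x + δ) ! * (x + δ) !) * 4 ^ δ) * (4 ^ x * X ^ x * Y ^ D)
      ≤⟨ *-mono-≤ ratio (*-monoʳ-≤ (4 ^ x * X ^ x) (^-monoˡ-≤ D Y≤X)) ⟩
    ((x ! * x !) * X ^ δ) * (4 ^ x * X ^ x * X ^ D)
      ≡⟨ regroup′ (x ! * x !) (X ^ δ) (4 ^ x) (X ^ x) (X ^ D) ⟩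
    (x ! * x !) * (4 ^ x * (X ^ x * X ^ δ)) * X ^ D
      ≡⟨ cong (λ z → (x ! * x !) * (4 ^ x * z) * X ^ D) (sym (^-distribˡ-+-* X x δ)) ⟩
    (x ! * x !) * (4 ^ x * X ^ (x + δ)) * X ^ D ∎
    where
    open ≤-Reasoning
    regroup : ∀ f a c p y → f * (a * c * p) * y ≡ f * c * (a * p * y)
    regroup = solve-∀
    regroup′ : ∀ f c a p z → f * c * (a * p * z) ≡ f * (a * (p * c)) * z
    regroup′ = solve-∀
    side : ∀ x δ → x + x + δ + 1 ≡ x + (x + δ) + 1
    side = solve-∀
    ratio : (x + δ) ! * (x + δ) ! * 4 ^ δ ≤ x ! * x ! * X ^ δ
    ratio = subst (λ z → (x + δ) ! * (x + δ) ! * 4 ^ δ ≤ x ! * x ! * z ^ δ)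
      (trans (cong (λ z → z * z) (trans (side x δ) (cong (_+ 1) e))) (sym X≡)) (!-ratio-upper x δ)

-- Products of factorials over a sequence

∏ : ∀ {A : Set} → List A → (A → ℕ) → ℕ
∏ xs u = product (map u xs)

module _ {A : Set} where

  ∏-mono : (xs : List A) {u v : A → ℕ} → (∀ {x} → x ∈ xs → u x ≤ v x) → ∏ xs u ≤ ∏ xs v
  ∏-mono [] h = ≤-refl
  ∏-mono (x ∷ xs) h = *-mono-≤ (h (here refl)) (∏-mono xs (h ∘ there))

  ∏-gain : (xs : List A) {u v : A → ℕ} (c : ℕ) → (∀ {x} → x ∈ xs → u x ≤ v x) →
    Any (λ x → c * u x ≤ v x) xs → c * ∏ xs u ≤ ∏ xs v
  ∏-gain (x ∷ xs) {u} c h (here le) =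
    ≤-trans (≤-reflexive (sym (*-assoc c (u x) (∏ xs u)))) (*-mono-≤ le (∏-mono xs (h ∘ there)))
  ∏-gain (x ∷ xs) {u} c h (there i) =
    ≤-trans (≤-reflexive (x∙yz≈y∙xz c (u x) (∏ xs u))) (*-mono-≤ (h (here refl)) (∏-gain xs c (h ∘ there) i))

  ∏-* : (xs : List A) (u v : A → ℕ) → ∏ xs (λ x → u x * v x) ≡ ∏ xs u * ∏ xs v
  ∏-* [] u v = refl
  ∏-* (x ∷ xs) u v = trans (cong (u x * v x *_) (∏-* xs u v)) (regroup (u x) (v x) (∏ xs u) (∏ xs v))
    where
    regroup : ∀ a b c e → a * b * (c * e) ≡ a * c * (b * e)
    regroup = solve-∀

  ∏-^ : (xs : List A) (c : ℕ) (u : A → ℕ) → ∏ xs (λ x → c ^ u x) ≡ c ^ ∑ xs u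
  ∏-^ [] c u = refl
  ∏-^ (x ∷ xs) c u = trans (cong (c ^ u x *_) (∏-^ xs c u)) (sym (^-distribˡ-+-* c (u x) (∑ xs u)))

  ∏-const : (xs : List A) (c : ℕ) → ∏ xs (λ _ → c) ≡ c ^ length xs
  ∏-const [] c = refl
  ∏-const (x ∷ xs) c = cong (c *_) (∏-const xs c)

*-nonZero : ∀ {a b} → NonZero a → NonZero b → NonZero (a * b)
*-nonZero {a} {b} p q = m*n≢0 a b {{p}} {{q}}

∏-near : ∀ n l → ∏ l (λ x → n ! * n ^ x) ≡ (n !) ^ length l * n ^ sum l
∏-near n l = trans (∏-* l (λ _ → n !) (n ^_)) (cong₂ _*_ (∏-const l (n !))
  (trans (∏-^ l n id) (cong (λ z → n ^ sum z) (map-id l))))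

∏-! : ∀ c l → ∏ l (λ x → x ! * c) ≡ ∏ l _! * c ^ length l
∏-! c l = trans (∏-* l _! (λ _ → c)) (cong (∏ l _! *_) (∏-const l c))

module _ (n d T : ℕ) {{_ : NonZero n}} (l : List ℕ) (len : length l ≡ d) (total : sum l ≡ d * n + T) where

  private
    factored : (n !) ^ length l * n ^ sum l ≡ (n !) ^ d * n ^ T * (n ^ n) ^ d
    factored = begin
      (n !) ^ length l * n ^ sum l ≡⟨ cong₂ (λ a b → (n !) ^ a * n ^ b) len total ⟩
      (n !) ^ d * n ^ (d * n + T) ≡⟨ cong ((n !) ^ d *_) (^-distribˡ-+-* n (d * n) T) ⟩
      (n !) ^ d * (n ^ (d * n) * n ^ T) ≡⟨ cong (λ z → (n !) ^ d * (n ^ z * n ^ T)) (*-comm d n) ⟩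
      (n !) ^ d * (n ^ (n * d) * n ^ T) ≡⟨ cong (λ z → (n !) ^ d * (z * n ^ T)) (sym (^-*-assoc n n d)) ⟩
      (n !) ^ d * ((n ^ n) ^ d * n ^ T) ≡⟨ swap ((n !) ^ d) ((n ^ n) ^ d) (n ^ T) ⟩
      (n !) ^ d * n ^ T * (n ^ n) ^ d ∎
      where
      open ≡-Reasoning
      swap : ∀ a b c → a * (b * c) ≡ a * c * b
      swap = solve-∀

    nz : NonZero ((n ^ n) ^ d)
    nz = m^n≢0 (n ^ n) d {{m^n≢0 n n}}

    right : ∏ l (λ x → x ! * n ^ n) ≡ ∏ l _! * (n ^ n) ^ d
    right = trans (∏-! (n ^ n) l) (cong (λ z → ∏ l _! * (n ^ n) ^ z) len)

  -- In the product of `!-near` over the entries, the entries enter the lower bound only through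
  -- their sum, which is the same for all shapes of the given size.
  factorials-lower : (n !) ^ d * n ^ T ≤ ∏ l _!
  factorials-lower = *-cancelʳ-≤ _ _ ((n ^ n) ^ d) {{nz}} (begin
    (n !) ^ d * n ^ T * (n ^ n) ^ d ≡⟨ sym (trans (∏-near n l) factored) ⟩
    ∏ l (λ x → n ! * n ^ x) ≤⟨ ∏-mono l (λ {x} _ → !-near n x) ⟩
    ∏ l (λ x → x ! * n ^ n) ≡⟨ right ⟩
    ∏ l _! * (n ^ n) ^ d ∎)
    where open ≤-Reasoning

  factorials-far : ∀ k r .{{_ : NonZero (k * r)}} → n ≤ k * (k * r) → Any (Far n (k * r)) l →
    2 ^ r * ((n !) ^ d * n ^ T) ≤ ∏ l _!
  factorials-far k r le far = *-cancelʳ-≤ _ _ ((n ^ n) ^ d) {{nz}} (begin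
    2 ^ r * ((n !) ^ d * n ^ T) * (n ^ n) ^ d ≡⟨ *-assoc (2 ^ r) ((n !) ^ d * n ^ T) _ ⟩
    2 ^ r * ((n !) ^ d * n ^ T * (n ^ n) ^ d) ≡⟨ cong (2 ^ r *_) (sym (trans (∏-near n l) factored)) ⟩
    2 ^ r * ∏ l (λ x → n ! * n ^ x)
      ≤⟨ ∏-gain l (2 ^ r) (λ {x} _ → !-near n x) (Any.map (λ {x} → !-far n k r x le) far) ⟩
    ∏ l (λ x → x ! * n ^ n) ≡⟨ right ⟩
    ∏ l _! * (n ^ n) ^ d ∎)
    where open ≤-Reasoning

  factorials-upper : ∀ P .{{_ : NonZero P}} → (∀ {x} → x ∈ l → n ≤ x × x ≤ P) → ∏ l _! ≤ (n !) ^ d * P ^ T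
  factorials-upper P h = *-cancelʳ-≤ _ _ ((P ^ n) ^ d) {{m^n≢0 (P ^ n) d {{m^n≢0 P n}}}} (begin
    ∏ l _! * (P ^ n) ^ d ≡⟨ sym (trans (∏-! (P ^ n) l) (cong (λ z → ∏ l _! * (P ^ n) ^ z) len)) ⟩
    ∏ l (λ x → x ! * P ^ n) ≤⟨ ∏-mono l (λ i → one (proj₁ (h i)) (proj₂ (h i))) ⟩
    ∏ l (λ x → n ! * P ^ x)
      ≡⟨ trans (∏-* l (λ _ → n !) (P ^_)) (cong₂ _*_ (∏-const l (n !)) (trans (∏-^ l P id) (cong (λ z → P ^ sum z) (map-id l)))) ⟩
    (n !) ^ length l * P ^ sum l ≡⟨ cong₂ (λ a b → (n !) ^ a * P ^ b) len total ⟩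
    (n !) ^ d * P ^ (d * n + T) ≡⟨ cong ((n !) ^ d *_) (^-distribˡ-+-* P (d * n) T) ⟩
    (n !) ^ d * (P ^ (d * n) * P ^ T) ≡⟨ cong (λ z → (n !) ^ d * (P ^ z * P ^ T)) (*-comm d n) ⟩
    (n !) ^ d * (P ^ (n * d) * P ^ T) ≡⟨ cong (λ z → (n !) ^ d * (z * P ^ T)) (sym (^-*-assoc P n d)) ⟩
    (n !) ^ d * ((P ^ n) ^ d * P ^ T) ≡⟨ swap ((n !) ^ d) ((P ^ n) ^ d) (P ^ T) ⟩
    (n !) ^ d * P ^ T * (P ^ n) ^ d ∎)
    where
    open ≤-Reasoning
    swap : ∀ a b c → a * (b * c) ≡ a * c * b
    swap = solve-∀
    one : ∀ {x} → n ≤ x → x ≤ P → x ! * P ^ n ≤ n ! * P ^ x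
    one le le′ with m≤n⇒∃[o]m+o≡n le
    ... | j , refl = begin
      (n + j) ! * P ^ n ≤⟨ *-monoˡ-≤ (P ^ n) (!-upper n j P le′) ⟩
      n ! * P ^ j * P ^ n ≡⟨ swap′ (n !) (P ^ j) (P ^ n) ⟩
      n ! * (P ^ n * P ^ j) ≡⟨ cong (n ! *_) (sym (^-distribˡ-+-* P n j)) ⟩
      n ! * P ^ (n + j) ∎
      where
      swap′ : ∀ a b c → a * b * c ≡ a * (c * b)
      swap′ = solve-∀

-- Equality of the two sums is used here: the powers of 4 and of `X`, which are large for a single
-- entry, cancel in the product, and only the correction by powers of `Y / X` remains.
∏-bulk : ∀ {X Y D} .{{_ : NonZero X}} (l : List ℕ) (u v : ℕ → ℕ) → ∑ l u ≡ ∑ l v →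
  (∀ {x} → x ∈ l → (v x ! * v x !) * (4 ^ v x * X ^ u x) * Y ^ D ≤ (u x ! * u x !) * (4 ^ u x * X ^ v x) * X ^ D) →
  ∏ l (_! ∘ v) * ∏ l (_! ∘ v) * (Y ^ D) ^ length l ≤ ∏ l (_! ∘ u) * ∏ l (_! ∘ u) * (X ^ D) ^ length l
∏-bulk {X} {Y} {D} l u v e h = *-cancelʳ-≤ _ _ (4 ^ ∑ l v * X ^ ∑ l v)
  {{*-nonZero (m^n≢0 4 (∑ l v)) (m^n≢0 X (∑ l v))}} (begin
    Fv * Fv * (Y ^ D) ^ length l * (4 ^ ∑ l v * X ^ ∑ l v)
      ≡⟨ cong (λ z → Fv * Fv * (Y ^ D) ^ length l * (4 ^ ∑ l v * X ^ z)) (sym e) ⟩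
    Fv * Fv * (Y ^ D) ^ length l * (4 ^ ∑ l v * X ^ ∑ l u)
      ≡⟨ swap (Fv * Fv) ((Y ^ D) ^ length l) (4 ^ ∑ l v * X ^ ∑ l u) ⟩
    Fv * Fv * (4 ^ ∑ l v * X ^ ∑ l u) * (Y ^ D) ^ length l ≡⟨ sym (expand v u Y) ⟩
    ∏ l (λ x → (v x ! * v x !) * (4 ^ v x * X ^ u x) * Y ^ D) ≤⟨ ∏-mono l h ⟩
    ∏ l (λ x → (u x ! * u x !) * (4 ^ u x * X ^ v x) * X ^ D) ≡⟨ expand u v X ⟩
    Fu * Fu * (4 ^ ∑ l u * X ^ ∑ l v) * (X ^ D) ^ length l
      ≡⟨ cong (λ z → Fu * Fu * (4 ^ z * X ^ ∑ l v) * (X ^ D) ^ length l) e ⟩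
    Fu * Fu * (4 ^ ∑ l v * X ^ ∑ l v) * (X ^ D) ^ length l
      ≡⟨ swap (Fu * Fu) (4 ^ ∑ l v * X ^ ∑ l v) ((X ^ D) ^ length l) ⟩
    Fu * Fu * (X ^ D) ^ length l * (4 ^ ∑ l v * X ^ ∑ l v) ∎)
  where
  open ≤-Reasoning
  Fu Fv : ℕ
  Fu = ∏ l (_! ∘ u)
  Fv = ∏ l (_! ∘ v)
  swap : ∀ a b c → a * b * c ≡ a * c * b
  swap = solve-∀
  expand : ∀ u v Z → ∏ l (λ x → (u x ! * u x !) * (4 ^ u x * X ^ v x) * Z ^ D) ≡
    ∏ l (_! ∘ u) * ∏ l (_! ∘ u) * (4 ^ ∑ l u * X ^ ∑ l v) * (Z ^ D) ^ length l
  expand u v Z = trans (∏-* l _ (λ _ → Z ^ D)) (cong₂ _*_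
    (trans (∏-* l _ _) (cong₂ _*_ (∏-* l (_! ∘ u) (_! ∘ u))
      (trans (∏-* l _ _) (cong₂ _*_ (∏-^ l 4 u) (∏-^ l X v)))))
    (∏-const l (Z ^ D)))

-- With `X = Y + z` this is `(1 - z/X)^e ≥ 1 - ez/X`, written without subtraction and division.
bernoulli′ : ∀ Y z e → (Y + z) ^ e * (Y + z) ≤ Y ^ e * (Y + z) + e * z * (Y + z) ^ e
bernoulli′ Y z zero = ≤-reflexive (sym (+-identityʳ _))
bernoulli′ Y z (suc e) = begin
  (Y + z) * (Y + z) ^ e * (Y + z) ≡⟨ *-assoc (Y + z) ((Y + z) ^ e) (Y + z) ⟩
  (Y + z) * ((Y + z) ^ e * (Y + z)) ≤⟨ *-monoʳ-≤ (Y + z) (bernoulli′ Y z e) ⟩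
  (Y + z) * (Y ^ e * (Y + z) + e * z * (Y + z) ^ e) ≡⟨ split Y z (Y ^ e) ((Y + z) ^ e) e ⟩
  Y * Y ^ e * (Y + z) + z * (Y + z) * Y ^ e + e * z * ((Y + z) * (Y + z) ^ e)
    ≤⟨ +-monoˡ-≤ _ (+-monoʳ-≤ (Y * Y ^ e * (Y + z)) (*-monoʳ-≤ (z * (Y + z)) (^-monoˡ-≤ e (m≤m+n Y z)))) ⟩
  Y * Y ^ e * (Y + z) + z * (Y + z) * (Y + z) ^ e + e * z * ((Y + z) * (Y + z) ^ e)
    ≡⟨ collect Y z (Y ^ e) ((Y + z) ^ e) e ⟩
  Y * Y ^ e * (Y + z) + suc e * z * ((Y + z) * (Y + z) ^ e) ∎
  where
  open ≤-Reasoning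
  split : ∀ Y z p r e → (Y + z) * (p * (Y + z) + e * z * r) ≡ Y * p * (Y + z) + z * (Y + z) * p + e * z * ((Y + z) * r)
  split = solve-∀
  collect : ∀ Y z p r e → Y * p * (Y + z) + z * (Y + z) * r + e * z * ((Y + z) * r) ≡
    Y * p * (Y + z) + (1 + e) * z * ((Y + z) * r)
  collect = solve-∀

-- Because `1 - 1/(2q+1)² ≥ (2q/(2q+1))²`. The factors are squares since the factorial products are
-- compared through their squares.
power-ratio : ∀ q Y z e .{{_ : NonZero (Y + z)}} → e * z * ((2 * q + 1) * (2 * q + 1)) ≤ Y + z →
  (2 * q) * (2 * q) * (Y + z) ^ e ≤ (2 * q + 1) * (2 * q + 1) * Y ^ e
power-ratio q Y z e le = *-cancelʳ-≤ _ _ X (+-cancelʳ-≤ (X * X ^ e) _ _ (begin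
  (2 * q) * (2 * q) * X ^ e * X + X * X ^ e ≤⟨ m≤m+n _ (4 * q * (X * X ^ e)) ⟩
  (2 * q) * (2 * q) * X ^ e * X + X * X ^ e + 4 * q * (X * X ^ e) ≡⟨ complete q X (X ^ e) ⟩
  Q * Q * (X ^ e * X) ≤⟨ *-monoʳ-≤ (Q * Q) (bernoulli′ Y z e) ⟩
  Q * Q * (Y ^ e * X + e * z * X ^ e) ≡⟨ split Q (Y ^ e) X (e * z) (X ^ e) ⟩
  Q * Q * Y ^ e * X + e * z * (Q * Q) * X ^ e ≤⟨ +-monoʳ-≤ (Q * Q * Y ^ e * X) (*-monoˡ-≤ (X ^ e) le) ⟩
  Q * Q * Y ^ e * X + X * X ^ e ∎))
  where
  open ≤-Reasoning
  Q X : ℕ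
  Q = 2 * q + 1
  X = Y + z
  complete : ∀ q X p → (2 * q) * (2 * q) * p * X + X * p + 4 * q * (X * p) ≡ (2 * q + 1) * (2 * q + 1) * (p * X)
  complete = solve-∀
  split : ∀ Q y X w p → Q * Q * (y * X + w * p) ≡ Q * Q * y * X + w * (Q * Q) * p
  split = solve-∀

square-cancel : ∀ a b → a * a ≤ b * b → a ≤ b
square-cancel a b le = ≮⇒≥ λ lt → <⇒≱ (*-mono-< lt lt) le

scaled-≤ : ∀ s t x y F G .{{_ : NonZero x}} → G * G * y ≤ F * F * x → s * s * x ≤ t * t * y → s * G ≤ t * F
scaled-≤ s t x y F G h h′ = square-cancel (s * G) (t * F) (*-cancelʳ-≤ _ _ x (begin
  s * G * (s * G) * x ≡⟨ regroup s G x ⟩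
  G * G * (s * s * x) ≤⟨ *-monoʳ-≤ (G * G) h′ ⟩
  G * G * (t * t * y) ≡⟨ regroup′ t G y ⟩
  t * t * (G * G * y) ≤⟨ *-monoʳ-≤ (t * t) h ⟩
  t * t * (F * F * x) ≡⟨ regroup″ t F x ⟩
  t * F * (t * F) * x ∎))
  where
  open ≤-Reasoning
  regroup : ∀ s G x → s * G * (s * G) * x ≡ G * G * (s * s * x)
  regroup = solve-∀
  regroup′ : ∀ t G y → G * G * (t * t * y) ≡ t * t * (G * G * y)
  regroup′ = solve-∀
  regroup″ : ∀ t F x → t * t * (F * F * x) ≡ t * F * (t * F) * x
  regroup″ = solve-∀

-- Exponential growth against powers

n<2^n : ∀ n → n < 2 ^ n
n<2^n zero = z<s
n<2^n (suc n) = begin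
  suc (suc n) ≤⟨ s≤s (n<2^n n) ⟩
  1 + 2 ^ n ≤⟨ +-monoˡ-≤ (2 ^ n) (m^n>0 2 n) ⟩
  2 ^ n + 2 ^ n ≡⟨ cong (λ z → 2 ^ n + z) (sym (+-identityʳ (2 ^ n))) ⟩
  2 * 2 ^ n ∎
  where open ≤-Reasoning

-- With `s` half of `r`, rounded down, `2 ^ r` contains two factors `2 ^ s`: one absorbs `s ^ m` and
-- the constant by induction, the other absorbs the remaining `s`. The enlarged constant
-- `C * 3 ^ suc m` pays for `r ≤ 3 * s`.
exp-beats-poly : ∀ m C → ∃ λ R → ∀ r → R ≤ r → C * r ^ m ≤ 2 ^ r
exp-beats-poly zero C = C , λ r le →
  ≤-trans (≤-reflexive (*-identityʳ C)) (≤-trans (<⇒≤ (n<2^n C)) (^-monoʳ-≤ 2 le))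
exp-beats-poly (suc m) C with exp-beats-poly m (C * 3 ^ suc m)
... | R , bound = suc (suc (R + R)) , λ r le → let (s , e , e′) = halve r in go r s e e′ le
  where
  halve : ∀ r → ∃ λ s → s + s ≤ r × r ≤ suc (s + s)
  halve zero = 0 , z≤n , z≤n
  halve (suc zero) = 0 , z≤n , ≤-refl
  halve (suc (suc r)) with halve r
  ... | s , le , le′ = suc s , s≤s (≤-trans (≤-reflexive (+-suc s s)) (s≤s le)) ,
    s≤s (≤-trans (s≤s le′) (s≤s (≤-reflexive (sym (+-suc s s)))))
  open ≤-Reasoning
  regroup : ∀ C s t p → C * (t * (s * p)) ≡ C * t * p * s
  regroup = solve-∀
  go : ∀ r s → s + s ≤ r → r ≤ suc (s + s) → suc (suc (R + R)) ≤ r → C * r ^ suc m ≤ 2 ^ r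
  go r s le le′ big = begin
    C * r ^ suc m ≤⟨ *-monoʳ-≤ C (^-monoˡ-≤ (suc m) r≤3s) ⟩
    C * (3 * s) ^ suc m ≡⟨ cong (C *_) (^-distrib-* 3 s (suc m)) ⟩
    C * (3 ^ suc m * (s * s ^ m)) ≡⟨ regroup C s (3 ^ suc m) (s ^ m) ⟩
    C * 3 ^ suc m * s ^ m * s ≤⟨ *-mono-≤ (bound s R≤s) (<⇒≤ (n<2^n s)) ⟩
    2 ^ s * 2 ^ s ≡⟨ sym (^-distribˡ-+-* 2 s s) ⟩
    2 ^ (s + s) ≤⟨ ^-monoʳ-≤ 2 le ⟩
    2 ^ r ∎
    where
    R<s : R < s
    R<s = ≰⇒> λ s≤R → <⇒≱ (≤-trans (s≤s (s≤s (+-mono-≤ s≤R s≤R))) big) le′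
    R≤s : R ≤ s
    R≤s = <⇒≤ R<s
    r≤3s : r ≤ 3 * s
    r≤3s = begin
      r ≤⟨ le′ ⟩
      1 + (s + s) ≤⟨ +-monoˡ-≤ (s + s) (≤-trans (s≤s z≤n) R<s) ⟩
      s + (s + s) ≡⟨ triple s ⟩
      3 * s ∎
      where
      triple : ∀ s → s + (s + s) ≡ 3 * s
      triple = solve-∀

fifth-root : ∀ n → ∃ λ r → n ≤ suc r ^ 5 × r ^ 5 ≤ n
fifth-root zero = 0 , z≤n , z≤n
fifth-root (suc n) with fifth-root n
... | r , up , low with suc n ≤? suc r ^ 5
... | yes le = r , le , m≤n⇒m≤1+n low
... | no ¬le = suc r , ≤-trans (s≤s up) (^-monoˡ-< 5 (n<1+n (suc r))) , <⇒≤ (≰⇒> ¬le)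

-- Comparison of the two sums

tri-double : ∀ e → tri (suc e) + tri (suc e) ≡ suc e * e
tri-double zero = refl
tri-double (suc e) = trans (regroup e (tri (suc e))) (trans (cong (λ z → suc e + suc e + z) (tri-double e)) (finish e))
  where
  regroup : ∀ e t → (1 + e + t) + (1 + e + t) ≡ (1 + e) + (1 + e) + (t + t)
  regroup = solve-∀
  finish : ∀ e → (1 + e) + (1 + e) + (1 + e) * e ≡ (2 + e) * (1 + e)
  finish = solve-∀

∈⇒≤sum : ∀ {x} l → x ∈ l → x ≤ sum l
∈⇒≤sum (x ∷ l) (here refl) = m≤m+n x (sum l)
∈⇒≤sum (y ∷ l) (there i) = ≤-trans (∈⇒≤sum l i) (m≤n+m (sum l) y)

δ-≤ : ∀ S l → All (_≤ S) l → δ l ≤ S ^ tri (length l)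
δ-≤ S [] a = ≤-refl
δ-≤ S (x ∷ l) (le ∷ a) = ≤-trans (*-mono-≤ (dist l a) (δ-≤ S l a)) (≤-reflexive (sym (^-distribˡ-+-* S (length l) _)))
  where
  dist : ∀ l → All (_≤ S) l → distances x l ≤ S ^ length l
  dist [] a = ≤-refl
  dist (y ∷ l) (le′ ∷ a) = *-mono-≤ (≤-trans (∣m-n∣≤m⊔n x y) (⊔-lub le le′)) (dist l a)

factorials-nonZero : ∀ l → NonZero (factorials l)
factorials-nonZero [] = _
factorials-nonZero (x ∷ l) = *-nonZero (x !≢0) (factorials-nonZero l)

superfactorial-> : ∀ d → 0 < superfactorial d
superfactorial-> zero = z<s
superfactorial-> (suc d) = *-mono-≤ (1≤n! d) (superfactorial-> d)

box : ℕ → ℕ → List (List ℕ)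
box zero S = [] ∷ []
box (suc d) S = concatMap (λ x → map (x ∷_) (box d S)) (upTo (suc S))

length-box : ∀ d S → length (box d S) ≡ suc S ^ d
length-box zero S = refl
length-box (suc d) S = begin
  length (box (suc d) S) ≡⟨ length-concatMap (λ x → map (x ∷_) (box d S)) (upTo (suc S)) ⟩
  ∑ (upTo (suc S)) (λ x → length (map (x ∷_) (box d S)))
    ≡⟨ ∑-cong (upTo (suc S)) (λ {x} _ → trans (length-map (x ∷_) (box d S)) (length-box d S)) ⟩
  ∑ (upTo (suc S)) (λ _ → suc S ^ d) ≡⟨ ∑-const (upTo (suc S)) _ ⟩
  length (upTo (suc S)) * suc S ^ d ≡⟨ cong (_* suc S ^ d) (length-upTo (suc S)) ⟩
  suc S * suc S ^ d ∎
  where open ≡-Reasoning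

∈-box : ∀ d S l → length l ≡ d → All (_≤ S) l → l ∈ box d S
∈-box zero S [] e a = here refl
∈-box (suc d) S (x ∷ l) e (le ∷ a) =
  ∈-concatMap⁺′ (∈-upTo⁺ (s≤s le)) (∈-map⁺ (x ∷_) (∈-box d S l (suc-injective e) a))

-- The list `xs` of path endpoints is exponentially long, the list `ys` of candidate shapes only
-- polynomially; estimates term by term become affordable after regrouping.
∑-collapse : ∀ (xs : List (List ℕ)) ys (Φ : List ℕ → ℕ) → (∀ {x} → x ∈ xs → x ∈ ys) →
  ∑ xs Φ ≤ ∑ ys (λ y → mult xs y * Φ y)
∑-collapse xs ys Φ h = begin
  ∑ xs Φ ≤⟨ ∑-mono xs (λ {x} i → ≤-trans
      (≤-reflexive (sym (trans (cong (_* Φ x) (𝟙-yes (x ≟ᴸ x) refl)) (*-identityˡ (Φ x)))))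
      (∑-≥ (λ y → 𝟙 (x ≟ᴸ y) * Φ y) (h i))) ⟩
  ∑ xs (λ x → ∑ ys (λ y → 𝟙 (x ≟ᴸ y) * Φ y)) ≡⟨ ∑-swap xs ys _ ⟩
  ∑ ys (λ y → ∑ xs (λ x → 𝟙 (x ≟ᴸ y) * Φ y)) ≡⟨ ∑-cong ys (λ {y} _ → ∑-*ʳ xs _ (Φ y)) ⟩
  ∑ ys (λ y → mult xs y * Φ y) ∎
  where open ≤-Reasoning

mult-∈ : ∀ xs l → mult xs l ≡ 0 ⊎ l ∈ xs
mult-∈ [] l = inj₁ refl
mult-∈ (x ∷ xs) l = cases (x ≟ᴸ l) (mult-∈ xs l)
  where
  cases : Dec (x ≡ l) → mult xs l ≡ 0 ⊎ l ∈ xs → mult (x ∷ xs) l ≡ 0 ⊎ l ∈ x ∷ xs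
  cases (yes refl) _ = inj₂ (here refl)
  cases (no ne) (inj₂ i) = inj₂ (there i)
  cases (no ne) (inj₁ e) = inj₁ (cong₂ _+_ (𝟙-no (x ≟ᴸ l) ne) e)

mult-*-≤ : ∀ xs l (F : List ℕ → ℕ) → mult xs l * F l ≤ ∑ xs F
mult-*-≤ xs l F = ≤-trans (≤-reflexive (sym (∑-*ʳ xs _ (F l)))) (∑-mono xs λ {x} _ → one x)
  where
  one : ∀ x → 𝟙 (x ≟ᴸ l) * F l ≤ F x
  one x = cases (x ≟ᴸ l)
    where
    cases : Dec (x ≡ l) → 𝟙 (x ≟ᴸ l) * F l ≤ F x
    cases (yes refl) = ≤-reflexive (trans (cong (_* F x) (𝟙-yes (x ≟ᴸ x) refl)) (*-identityˡ (F x)))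
    cases (no ne) = ≤-trans (≤-reflexive (cong (_* F l) (𝟙-no (x ≟ᴸ l) ne))) z≤n

∣∑-∑∣≤ : ∀ {A : Set} (xs : List A) (F G : A → ℕ) → ∣ ∑ xs F - ∑ xs G ∣ ≤ ∑ xs (λ x → ∣ F x - G x ∣)
∣∑-∑∣≤ [] F G = z≤n
∣∑-∑∣≤ (x ∷ xs) F G = begin
  ∣ F x + ∑ xs F - G x + ∑ xs G ∣ ≤⟨ ∣-∣-triangle (F x + ∑ xs F) (F x + ∑ xs G) (G x + ∑ xs G) ⟩
  ∣ F x + ∑ xs F - F x + ∑ xs G ∣ + ∣ F x + ∑ xs G - G x + ∑ xs G ∣
    ≡⟨ cong₂ _+_ (∣m+n-m+o∣≡∣n-o∣ (F x) (∑ xs F) (∑ xs G))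
         (trans (cong₂ ∣_-_∣ (+-comm (F x) (∑ xs G)) (+-comm (G x) (∑ xs G))) (∣m+n-m+o∣≡∣n-o∣ (∑ xs G) (F x) (G x))) ⟩
  ∣ ∑ xs F - ∑ xs G ∣ + ∣ F x - G x ∣ ≤⟨ +-monoˡ-≤ _ (∣∑-∑∣≤ xs F G) ⟩
  ∑ xs (λ x → ∣ F x - G x ∣) + ∣ F x - G x ∣ ≡⟨ +-comm (∑ xs (λ x → ∣ F x - G x ∣)) _ ⟩
  ∣ F x - G x ∣ + ∑ xs (λ x → ∣ F x - G x ∣) ∎
  where open ≤-Reasoning

distance-≤ : ∀ p a b → p * a ≤ (p + 1) * b → p * b ≤ (p + 1) * a → p * ∣ a - b ∣ ≤ b
distance-≤ p a b h h′ with ≤-total b a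
... | inj₁ le = +-cancelˡ-≤ (p * b) _ b (begin
  p * b + p * ∣ a - b ∣ ≡⟨ cong (λ z → p * b + p * z) (m≤n⇒∣n-m∣≡n∸m le) ⟩
  p * b + p * (a ∸ b) ≡⟨ sym (*-distribˡ-+ p b (a ∸ b)) ⟩
  p * (b + (a ∸ b)) ≡⟨ cong (p *_) (m+[n∸m]≡n le) ⟩
  p * a ≤⟨ h ⟩
  (p + 1) * b ≡⟨ expand p b ⟩
  p * b + b ∎)
  where
  open ≤-Reasoning
  expand : ∀ p b → (p + 1) * b ≡ p * b + b
  expand = solve-∀
... | inj₂ le = ≤-trans (+-cancelˡ-≤ (p * a) _ a (begin
  p * a + p * ∣ a - b ∣ ≡⟨ cong (λ z → p * a + p * z) (m≤n⇒∣m-n∣≡n∸m le) ⟩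
  p * a + p * (b ∸ a) ≡⟨ sym (*-distribˡ-+ p a (b ∸ a)) ⟩
  p * (a + (b ∸ a)) ≡⟨ cong (p *_) (m+[n∸m]≡n le) ⟩
  p * b ≤⟨ h′ ⟩
  (p + 1) * a ≡⟨ expand p a ⟩
  p * a + a ∎)) le
  where
  open ≤-Reasoning
  expand : ∀ p b → (p + 1) * b ≡ p * b + b
  expand = solve-∀

module Compare (e n : ℕ) {{_ : NonZero n}} (e≤n : e ≤ n) where

  -- `a` is a lower bound for the product of the factorials of any shape and of its complement. As
  -- `S ^ T` bounds the Vandermonde product, `f` and `G` are at most `N! S^T / a`, while at the
  -- central shape both are at least `N! / (a 2^T)`. `W` is the resulting bound for `f (f + G)` in
  -- units of `f G` at the centre.
  d T N S a W : ℕ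
  d = suc e
  T = tri d
  N = d * n
  S = N + T
  a = (n !) ^ d * n ^ T
  W = 2 * (S ^ T * S ^ T) * (2 ^ T * 2 ^ T)

  open Complement e (2 * n)

  f G : List ℕ → ℕ
  f = mult (L d N)
  G = g N

  Shape : List ℕ → Set
  Shape l = length l ≡ d × Desc l × sum l ≡ S

  f-δ : ∀ {l} → Shape l → f l * factorials l ≡ N ! * δ l
  f-δ {l} (len , h , s) = trans (cong (_* factorials l) (mult-L d N l)) (Desc-Paths.H-δ d N l h len s)

  -- A shape of size `d n` fills half of the rectangle: `d (2n + d - 1) = 2 (d n + T)`, since `T` is
  -- `d (d - 1) / 2`.
  sum-comp-S : ∀ {l} → Shape l → All (_≤ M) l → sum (comp l) ≡ S
  sum-comp-S {l} (len , h , s) b = +-cancelʳ-≡ (sum l) _ _ (begin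
    sum (comp l) + sum l ≡⟨ sum-comp l b ⟩
    length l * M ≡⟨ cong (_* M) len ⟩
    suc e * (2 * n + e) ≡⟨ expand e n ⟩
    (suc e * n + suc e * n) + suc e * e ≡⟨ cong (λ z → suc e * n + suc e * n + z) (sym (tri-double e)) ⟩
    (suc e * n + suc e * n) + (T + T) ≡⟨ regroup (suc e * n) T ⟩
    S + S ≡⟨ cong (λ z → S + z) (sym s) ⟩
    S + sum l ∎)
    where
    open ≡-Reasoning
    expand : ∀ e n → (1 + e) * (2 * n + e) ≡ ((1 + e) * n + (1 + e) * n) + (1 + e) * e
    expand = solve-∀
    regroup : ∀ x t → x + x + (t + t) ≡ (x + t) + (x + t)
    regroup = solve-∀

  G-δ : ∀ {l} → Shape l → All (_≤ M) l → G l * factorials (comp l) ≡ N ! * δ l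
  G-δ {l} sh@(len , h , s) b = g-δ N l b h len (sum-comp-S sh b)

  δ≤ : ∀ {l} → Shape l → δ l ≤ S ^ T
  δ≤ {l} (len , h , s) = subst (λ z → δ l ≤ S ^ tri z) len
    (δ-≤ S l (All.tabulate λ i → ≤-trans (∈⇒≤sum l i) (≤-reflexive s)))

  upper : ∀ {l F} (F* : ℕ) c → Shape l → F * F* ≡ N ! * δ l → c * a ≤ F* → c * (F * a) ≤ N ! * S ^ T
  upper {l} {F} F* c sh eq le = begin
    c * (F * a) ≡⟨ x∙yz≈y∙xz c F a ⟩
    F * (c * a) ≤⟨ *-monoʳ-≤ F le ⟩
    F * F* ≡⟨ eq ⟩
    N ! * δ l ≤⟨ *-monoʳ-≤ (N !) (δ≤ sh) ⟩
    N ! * S ^ T ∎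
    where
    open ≤-Reasoning

  f-upper : ∀ {l} → Shape l → f l * a ≤ N ! * S ^ T
  f-upper {l} sh@(len , h , s) = ≤-trans (≤-reflexive (sym (*-identityˡ (f l * a))))
    (upper {l} {f l} (factorials l) 1 sh (f-δ sh) (≤-trans (≤-reflexive (*-identityˡ a)) (factorials-lower n d T l len s)))

  f-far : ∀ {l} k r {{_ : NonZero (k * r)}} → n ≤ k * (k * r) → Shape l → Any (Far n (k * r)) l →
    2 ^ r * (f l * a) ≤ N ! * S ^ T
  f-far {l} k r le sh@(len , h , s) far = upper {l} {f l} (factorials l) (2 ^ r) sh (f-δ sh)
    (factorials-far n d T l len s k r le far)

  G-upper : ∀ {l} → Shape l → G l * a ≤ N ! * S ^ T
  G-upper {l} sh@(len , h , s) = cases (bounded? l)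
    where
    cases : Dec (All (_≤ M) l) → G l * a ≤ N ! * S ^ T
    cases (no ¬b) = subst (λ z → z * a ≤ N ! * S ^ T) (sym (g-unbounded N l ¬b)) z≤n
    cases (yes b) = ≤-trans (≤-reflexive (sym (*-identityˡ (G l * a))))
      (upper {l} {G l} (factorials (comp l)) 1 sh (G-δ sh b) (≤-trans (≤-reflexive (*-identityˡ a))
        (factorials-lower n d T (comp l) (trans (length-map (M ∸_) l) len) (sum-comp-S sh b))))

  -- The sequence of the rectangle with `d` rows of length `n`, whose complement has the same shape.
  centre : List ℕ
  centre = lst d (λ _ → n)

  centre-shape : Shape centre
  centre-shape = lst-length d (λ _ → n) , desc-lst d (λ _ → n) (λ _ → ≤-refl) , sum-const d n

  centre-≤ : All (_≤ n + e) centre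
  centre-≤ = All.map (λ {x} lt → s≤s⁻¹ (subst (x <_) (+-suc n e) lt)) (lst-< d (λ _ → n) n (λ _ → ≤-refl) ≤-refl)

  centre-≥ : ∀ d → All (n ≤_) (lst d (λ _ → n))
  centre-≥ zero = []
  centre-≥ (suc d) = m≤m+n n d ∷ centre-≥ d

  2n≡ : n + n ≡ 2 * n
  2n≡ = cong (λ z → n + z) (sym (+-identityʳ n))

  centre-bounded : All (_≤ M) centre
  centre-bounded = All.map (λ le → ≤-trans le (+-monoˡ-≤ e (≤-trans (m≤m+n n n) (≤-reflexive 2n≡)))) centre-≤

  n+e≤2n : n + e ≤ 2 * n
  n+e≤2n = ≤-trans (+-monoʳ-≤ n e≤n) (≤-reflexive 2n≡)

  lower : ∀ {F} l → F * factorials l ≡ N ! * δ centre → length l ≡ d → sum l ≡ S →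
    (∀ {x} → x ∈ l → n ≤ x × x ≤ 2 * n) → N ! ≤ F * (a * 2 ^ T)
  lower {F} l eq len s h = begin
    N ! ≡⟨ sym (*-identityʳ (N !)) ⟩
    N ! * 1 ≤⟨ *-monoʳ-≤ (N !) (subst (1 ≤_) (sym (δ-const n d)) (superfactorial-> d)) ⟩
    N ! * δ centre ≡⟨ sym eq ⟩
    F * factorials l ≤⟨ *-monoʳ-≤ F (factorials-upper n d T l len s (2 * n) {{m*n≢0 2 n}} h) ⟩
    F * ((n !) ^ d * (2 * n) ^ T) ≡⟨ cong (λ z → F * ((n !) ^ d * z)) (^-distrib-* 2 n T) ⟩
    F * ((n !) ^ d * (2 ^ T * n ^ T)) ≡⟨ swap F ((n !) ^ d) (2 ^ T) (n ^ T) ⟩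
    F * (a * 2 ^ T) ∎
    where
    open ≤-Reasoning
    swap : ∀ F b c e → F * (b * (c * e)) ≡ F * (b * e * c)
    swap = solve-∀

  f-centre : N ! ≤ f centre * (a * 2 ^ T)
  f-centre = lower {f centre} centre (f-δ centre-shape) (proj₁ centre-shape) (proj₂ (proj₂ centre-shape))
    λ i → All.lookup (centre-≥ d) i , ≤-trans (All.lookup centre-≤ i) n+e≤2n

  G-centre : N ! ≤ G centre * (a * 2 ^ T)
  G-centre = lower {G centre} (comp centre) (G-δ centre-shape centre-bounded)
    (trans (length-map (M ∸_) centre) (proj₁ centre-shape)) (sum-comp-S centre-shape centre-bounded) range
    where
    range : ∀ {x} → x ∈ comp centre → n ≤ x × x ≤ 2 * n
    range i with ∈-map⁻ (M ∸_) {xs = centre} i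
    ... | y , j , refl =
      subst (_≤ M ∸ y) (trans (cong (λ z → z ∸ (n + e)) split) (m+n∸n≡m n (n + e))) low ,
      ≤-trans (subst (M ∸ y ≤_) (trans (cong (λ z → z ∸ n) split) (m+n∸m≡n n (n + e))) high) n+e≤2n
      where
      split : M ≡ n + (n + e)
      split = trans (cong (_+ e) (sym 2n≡)) (+-assoc n n e)
      low : M ∸ (n + e) ≤ M ∸ y
      low = ∸-monoʳ-≤ M (All.lookup centre-≤ j)
      high : M ∸ y ≤ M ∸ n
      high = ∸-monoʳ-≤ M (All.lookup (centre-≥ d) j)

  a-nonZero : NonZero a
  a-nonZero = *-nonZero (m^n≢0 (n !) d {{n !≢0}}) (m^n≢0 n T)

  -- One factor `f l` already brings the gain `2 ^ r`; for the other factor the plain upper bounds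
  -- suffice, so `G` is never estimated on far shapes more sharply than elsewhere.
  tail-bound : ∀ {l} k r {{_ : NonZero (k * r)}} → n ≤ k * (k * r) → Shape l → Any (Far n (k * r)) l →
    2 ^ r * (f l * (f l + G l)) ≤ W * (f centre * G centre)
  tail-bound {l} k r le sh far = *-cancelʳ-≤ _ _ (a * a) {{*-nonZero a-nonZero a-nonZero}} (begin
    2 ^ r * (f l * (f l + G l)) * (a * a) ≡⟨ regroup (2 ^ r) (f l) (G l) a ⟩
    2 ^ r * (f l * a) * (f l * a + G l * a) ≤⟨ *-mono-≤ (f-far k r le sh far) (+-mono-≤ (f-upper sh) (G-upper sh)) ⟩
    N ! * S ^ T * (N ! * S ^ T + N ! * S ^ T) ≡⟨ collect (N !) (S ^ T) ⟩
    2 * (S ^ T * S ^ T) * (N ! * N !) ≤⟨ *-monoʳ-≤ (2 * (S ^ T * S ^ T)) (*-mono-≤ f-centre G-centre) ⟩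
    2 * (S ^ T * S ^ T) * (f centre * (a * 2 ^ T) * (G centre * (a * 2 ^ T)))
      ≡⟨ finish (2 * (S ^ T * S ^ T)) (f centre) (G centre) a (2 ^ T) ⟩
    W * (f centre * G centre) * (a * a) ∎)
    where
    open ≤-Reasoning
    regroup : ∀ t f g a → t * (f * (f + g)) * (a * a) ≡ t * (f * a) * (f * a + g * a)
    regroup = solve-∀
    collect : ∀ x y → x * y * (x * y + x * y) ≡ 2 * (y * y) * (x * x)
    collect = solve-∀
    finish : ∀ w f g a t → w * (f * (a * t) * (g * (a * t))) ≡ w * (t * t) * (f * g) * (a * a)
    finish = solve-∀

  module Bulk (q h : ℕ) (2h≤n : h + h ≤ n) (D : ℕ) (D≡ : D ≡ (h + h) + (h + h) + d)
    (small : D * d * (D * D) * ((2 * q + 1) * (2 * q + 1)) ≤ (M + 1) * (M + 1))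
    (D²≤ : D * D ≤ (M + 1) * (M + 1)) where

    private
      X Y Q : ℕ
      X = (M + 1) * (M + 1)
      Y = X ∸ D * D
      Q = 2 * q + 1
      Y+D² : Y + D * D ≡ X
      Y+D² = m∸n+n≡m D²≤
      X-nonZero : NonZero X
      X-nonZero = >-nonZero (*-mono-≤ (m≤n+m 1 M) (m≤n+m 1 M))

    -- Both counts have the numerator `N! δ l`, so their ratio is that of the factorial products.
    -- Entries within `2h` of `n` differ from their complements in `2n + e` by at most `4h + d`,
    -- which is `D`; this makes `∏-bulk` available in both directions. `small` is the hypothesis of
    -- `power-ratio` for `z = D²` and exponent `D d`.
    bulk : ∀ {l} → Shape l → ¬ Any (Far n h) l → 2 * q * ∣ f l - G l ∣ ≤ G l
    bulk {l} sh@(len , desc , s) ¬far = distance-≤ (2 * q) (f l) (G l)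
      (compare (f l) (G l) (factorials l) (factorials (comp l)) {{factorials-nonZero l}} same ratio)
      (compare (G l) (f l) (factorials (comp l)) (factorials l) {{factorials-nonZero (comp l)}} (sym same) ratio′)
      where
      near : ∀ {x} → x ∈ l → x < n + (h + h) × n < x + (h + h)
      near i = ≰⇒> (λ le → ¬far (lose i (inj₁ le))) , ≰⇒> (λ le → ¬far (lose i (inj₂ le)))
      bounded : All (_≤ M) l
      bounded = All.tabulate λ i → ≤-trans (<⇒≤ (proj₁ (near i)))
        (≤-trans (+-monoʳ-≤ n 2h≤n) (≤-trans (≤-reflexive 2n≡) (m≤m+n (2 * n) e)))
      side₁ : ∀ {x} → x ∈ l → x ≤ (M ∸ x) + D
      side₁ {x} i = +-cancelʳ-≤ x x _ (begin
        x + x ≤⟨ +-mono-≤ (<⇒≤ (proj₁ (near i))) (<⇒≤ (proj₁ (near i))) ⟩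
        n + (h + h) + (n + (h + h)) ≤⟨ m≤m+n _ (e + suc e) ⟩
        n + (h + h) + (n + (h + h)) + (e + suc e) ≡⟨ regroup n h e ⟩
        2 * n + e + (h + h + (h + h) + suc e) ≡⟨ cong (λ z → 2 * n + e + z) (sym D≡) ⟩
        M + D ≡⟨ cong (_+ D) (sym (m∸n+n≡m (All.lookup bounded i))) ⟩
        (M ∸ x) + x + D ≡⟨ swap (M ∸ x) x D ⟩
        (M ∸ x) + D + x ∎)
        where
        open ≤-Reasoning
        regroup : ∀ n h e → n + (h + h) + (n + (h + h)) + (e + (1 + e)) ≡ 2 * n + e + (h + h + (h + h) + (1 + e))
        regroup = solve-∀
        swap : ∀ a b c → a + b + c ≡ a + c + b
        swap = solve-∀
      side₂ : ∀ {x} → x ∈ l → M ∸ x ≤ x + D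
      side₂ {x} i = +-cancelʳ-≤ x _ _ (begin
        (M ∸ x) + x ≡⟨ m∸n+n≡m (All.lookup bounded i) ⟩
        2 * n + e ≡⟨ cong (_+ e) (sym 2n≡) ⟩
        n + n + e ≤⟨ +-mono-≤ (+-mono-≤ (<⇒≤ (proj₂ (near i))) (<⇒≤ (proj₂ (near i)))) (n≤1+n e) ⟩
        x + (h + h) + (x + (h + h)) + suc e ≡⟨ regroup x h e ⟩
        x + (h + h + (h + h) + suc e) + x ≡⟨ cong (λ z → x + z + x) (sym D≡) ⟩
        x + D + x ∎)
        where
        open ≤-Reasoning
        regroup : ∀ x h e → x + (h + h) + (x + (h + h)) + (1 + e) ≡ x + (h + h + (h + h) + (1 + e)) + x
        regroup = solve-∀
      sums : ∑ l id ≡ ∑ l (M ∸_)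
      sums = trans (cong sum (map-id l)) (trans s (sym (sum-comp-S sh bounded)))
      one : ∀ {x b} → x + b ≡ M → x ≤ b + D → b ≤ x + D →
        (b ! * b !) * (4 ^ b * X ^ x) * Y ^ D ≤ (x ! * x !) * (4 ^ x * X ^ b) * X ^ D
      one {x} {b} = !-bulk M D X Y refl (≤-reflexive Y+D²) x b
      comp-! : factorials (comp l) ≡ ∏ l (_! ∘ (M ∸_))
      comp-! = cong product (sym (map-∘ l))
      powers : ∀ Z → (Z ^ D) ^ length l ≡ Z ^ (D * d)
      powers Z = trans (^-*-assoc Z D (length l)) (cong (λ z → Z ^ (D * z)) len)
      exponent : (2 * q) * (2 * q) * X ^ (D * d) ≤ Q * Q * Y ^ (D * d)
      exponent = subst (λ X → (2 * q) * (2 * q) * X ^ (D * d) ≤ Q * Q * Y ^ (D * d)) Y+D²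
        (power-ratio q Y (D * D) (D * d) {{subst NonZero (sym Y+D²) X-nonZero}} (≤-trans small (≤-reflexive (sym Y+D²))))
      ratio : 2 * q * factorials (comp l) ≤ Q * factorials l
      ratio = scaled-≤ (2 * q) Q (X ^ (D * d)) (Y ^ (D * d)) (factorials l) (factorials (comp l)) {{m^n≢0 X (D * d) {{X-nonZero}}}}
        (subst₂ _≤_ (cong₂ (λ u v → u * u * v) (sym comp-!) (powers Y)) (cong (factorials l * factorials l *_) (powers X))
          (∏-bulk {X} {Y} {D} {{X-nonZero}} l id (M ∸_) sums
            (λ {x} i → one {x} (m+[n∸m]≡n (All.lookup bounded i)) (side₁ i) (side₂ i))))
        exponent
      ratio′ : 2 * q * factorials l ≤ Q * factorials (comp l)
      ratio′ = scaled-≤ (2 * q) Q (X ^ (D * d)) (Y ^ (D * d)) (factorials (comp l)) (factorials l) {{m^n≢0 X (D * d) {{X-nonZero}}}}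
        (subst₂ _≤_ (cong (factorials l * factorials l *_) (powers Y)) (cong₂ (λ u v → u * u * v) (sym comp-!) (powers X))
          (∏-bulk {X} {Y} {D} {{X-nonZero}} l (M ∸_) id (sym sums)
            (λ {x} i → one {M ∸ x} (m∸n+n≡m (All.lookup bounded i)) (side₂ i) (side₁ i))))
        exponent
      same : f l * factorials l ≡ G l * factorials (comp l)
      same = trans (f-δ sh) (sym (G-δ sh bounded))
      compare : ∀ u v F F′ {{_ : NonZero F}} → u * F ≡ v * F′ → 2 * q * F′ ≤ Q * F → 2 * q * u ≤ Q * v
      compare u v F F′ eq le = *-cancelʳ-≤ _ _ F (begin
        2 * q * u * F ≡⟨ *-assoc (2 * q) u F ⟩
        2 * q * (u * F) ≡⟨ cong (2 * q *_) eq ⟩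
        2 * q * (v * F′) ≡⟨ swap (2 * q) v F′ ⟩
        v * (2 * q * F′) ≤⟨ *-monoʳ-≤ v le ⟩
        v * (Q * F) ≡⟨ swap′ v Q F ⟩
        Q * v * F ∎)
        where
        open ≤-Reasoning
        swap : ∀ a b c → a * (b * c) ≡ b * (a * c)
        swap = solve-∀
        swap′ : ∀ a b c → a * (b * c) ≡ b * a * c
        swap′ = solve-∀

  A B : ℕ
  A = ∑ (L d N) f
  B = ∑ (L d N) G

  f-centre*G-centre≤B : f centre * G centre ≤ B
  f-centre*G-centre≤B = mult-*-≤ (L d N) centre G

  positive : 0 < B
  positive = ≤-trans (>-nonZero⁻¹ (f centre * G centre) {{*-nonZero (pos {f centre} f-centre) (pos {G centre} G-centre)}}) f-centre*G-centre≤B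
    where
    pos : ∀ {F} → N ! ≤ F * (a * 2 ^ T) → NonZero F
    pos {zero} le = contradiction (≤-trans (1≤n! N) le) λ ()
    pos {suc F} le = _

  module Close (q k r : ℕ) {{_ : NonZero (k * r)}} (n≤ : n ≤ k * (k * r))
    (bulk : ∀ {l} → Shape l → ¬ Any (Far n (k * r)) l → 2 * q * ∣ f l - G l ∣ ≤ G l)
    (exponential : 2 * q * (suc S ^ d * W) ≤ 2 ^ r) where

    private
      distant? : ∀ l → Dec (Any (Far n (k * r)) l)
      distant? = Any.any? (far? n (k * r))

      Φ : List ℕ → ℕ
      Φ l = 𝟙 (distant? l) * (f l + G l)

      tail : ℕ
      tail = ∑ (L d N) Φ

    Φ-far : ∀ {l} → Any (Far n (k * r)) l → Φ l ≡ f l + G l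
    Φ-far {l} p = trans (cong (_* (f l + G l)) (𝟙-yes (distant? l) p)) (*-identityˡ (f l + G l))

    -- There are at most `(S + 1)^d` shapes; by `tail-bound` each far one contributes at most
    -- `W / 2^r` times the central term, and that term is at most `B`.
    tail≤ : 2 ^ r * tail ≤ suc S ^ d * W * B
    tail≤ = begin
      2 ^ r * tail ≤⟨ *-monoʳ-≤ (2 ^ r) (∑-collapse (L d N) (box d S) Φ inside-box) ⟩
      2 ^ r * ∑ (box d S) (λ l → f l * Φ l) ≡⟨ sym (∑-*ˡ (box d S) _ (2 ^ r)) ⟩
      ∑ (box d S) (λ l → 2 ^ r * (f l * Φ l)) ≤⟨ ∑-mono (box d S) (λ {l} _ → each l) ⟩
      ∑ (box d S) (λ _ → W * (f centre * G centre)) ≡⟨ ∑-const (box d S) _ ⟩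
      length (box d S) * (W * (f centre * G centre)) ≡⟨ cong (_* (W * (f centre * G centre))) (length-box d S) ⟩
      suc S ^ d * (W * (f centre * G centre)) ≤⟨ *-monoʳ-≤ (suc S ^ d) (*-monoʳ-≤ W f-centre*G-centre≤B) ⟩
      suc S ^ d * (W * B) ≡⟨ sym (*-assoc (suc S ^ d) W B) ⟩
      suc S ^ d * W * B ∎
      where
      open ≤-Reasoning
      inside-box : ∀ {l} → l ∈ L d N → l ∈ box d S
      inside-box {l} i with ∈-L d N i
      ... | len , _ , s = ∈-box d S l len (All.tabulate λ j → ≤-trans (∈⇒≤sum l j) (≤-reflexive s))
      each : ∀ l → 2 ^ r * (f l * Φ l) ≤ W * (f centre * G centre)
      each l = cases (mult-∈ (L d N) l) (distant? l)
        where
        cases : f l ≡ 0 ⊎ l ∈ L d N → Dec (Any (Far n (k * r)) l) → 2 ^ r * (f l * Φ l) ≤ W * (f centre * G centre)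
        cases (inj₁ e) _ = subst (λ z → 2 ^ r * (z * Φ l) ≤ W * (f centre * G centre)) (sym e)
          (≤-trans (≤-reflexive (*-zeroʳ (2 ^ r))) z≤n)
        cases (inj₂ i) (no ¬p) = ≤-trans (≤-reflexive (trans (cong (λ z → 2 ^ r * (f l * (z * (f l + G l)))) (𝟙-no (distant? l) ¬p))
          (trans (cong (2 ^ r *_) (*-zeroʳ (f l))) (*-zeroʳ (2 ^ r))))) z≤n
        cases (inj₂ i) (yes p) = ≤-trans (≤-reflexive (cong (λ z → 2 ^ r * (f l * z)) (Φ-far p)))
          (tail-bound k r n≤ (∈-L d N i) p)

    2q*tail≤B : 2 * q * tail ≤ B
    2q*tail≤B = *-cancelˡ-≤ (2 ^ r) {{m^n≢0 2 r}} (begin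
      2 ^ r * (2 * q * tail) ≡⟨ x∙yz≈y∙xz (2 ^ r) (2 * q) tail ⟩
      2 * q * (2 ^ r * tail) ≤⟨ *-monoʳ-≤ (2 * q) tail≤ ⟩
      2 * q * (suc S ^ d * W * B) ≡⟨ sym (*-assoc (2 * q) (suc S ^ d * W) B) ⟩
      2 * q * (suc S ^ d * W) * B ≤⟨ *-monoˡ-≤ B exponential ⟩
      2 ^ r * B ∎)
      where
      open ≤-Reasoning

    pointwise : ∀ {l} → l ∈ L d N → 2 * q * ∣ f l - G l ∣ ≤ G l + 2 * q * Φ l
    pointwise {l} i = cases (distant? l)
      where
      cases : Dec (Any (Far n (k * r)) l) → 2 * q * ∣ f l - G l ∣ ≤ G l + 2 * q * Φ l
      cases (no ¬p) = ≤-trans (bulk (∈-L d N i) ¬p) (m≤m+n (G l) _)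
      cases (yes p) = ≤-trans (*-monoʳ-≤ (2 * q) (≤-trans (≤-trans (∣m-n∣≤m⊔n (f l) (G l)) (m⊔n≤m+n (f l) (G l)))
        (≤-reflexive (sym (Φ-far p))))) (m≤n+m _ (G l))

    -- The error is split evenly: near shapes and far shapes may each contribute `B / (2q)`, which
    -- is why `2 * q` appears in all the estimates above.
    close : q * ∣ A - B ∣ ≤ B
    close = *-cancelˡ-≤ 2 (begin
      2 * (q * ∣ A - B ∣) ≡⟨ sym (*-assoc 2 q _) ⟩
      2 * q * ∣ A - B ∣ ≤⟨ *-monoʳ-≤ (2 * q) (∣∑-∑∣≤ (L d N) f G) ⟩
      2 * q * ∑ (L d N) (λ l → ∣ f l - G l ∣) ≡⟨ sym (∑-*ˡ (L d N) _ (2 * q)) ⟩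
      ∑ (L d N) (λ l → 2 * q * ∣ f l - G l ∣) ≤⟨ ∑-mono (L d N) pointwise ⟩
      ∑ (L d N) (λ l → G l + 2 * q * Φ l) ≡⟨ ∑-+ (L d N) G _ ⟩
      B + ∑ (L d N) (λ l → 2 * q * Φ l) ≡⟨ cong (λ z → B + z) (∑-*ˡ (L d N) Φ (2 * q)) ⟩
      B + 2 * q * tail ≤⟨ +-monoʳ-≤ B 2q*tail≤B ⟩
      B + B ≡⟨ cong (λ z → B + z) (sym (+-identityʳ B)) ⟩
      2 * B ∎)
      where open ≤-Reasoning

-- Choice of the scales

module Threshold (e q : ℕ) where

  private
    -- `c` is such that `suc S ≤ c * r ^ 5`, and then `C * r ^ (5 * E)` bounds the polynomial factor
    -- in the tail. The condition `w ≤ r` is what `small` needs: by `D ≤ 5h` and `h = r³`,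
    -- `16² D³ v` is at most `w r⁹`, and `r¹⁰` is at most `(32n)² = 16² (2n)²`.
    d T c E C v w : ℕ
    d = suc e
    T = tri d
    c = d + T + 1
    E = d + (T + T)
    C = 2 * q * (c ^ d * (2 * (c ^ T * c ^ T) * (2 ^ T * 2 ^ T)))
    v = d * ((2 * q + 1) * (2 * q + 1))
    w = 16 * 16 * (5 * 5 * 5 * v)

    R₁ : ℕ
    R₁ = proj₁ (exp-beats-poly (5 * E) C)

    -- n > R ^ 5 makes the fifth root of n larger than every bound needed below.
    R : ℕ
    R = R₁ + w + 8 + d

  threshold : ℕ
  threshold = suc (R ^ 5) + e

  module Above (n : ℕ) (big : threshold ≤ n) where

    private
      e≤n : e ≤ n
      e≤n = ≤-trans (m≤n+m e (suc (R ^ 5))) big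

      instance
        n-nonZero : NonZero n
        n-nonZero = >-nonZero (≤-trans (s≤s z≤n) big)

      -- `r` is the fifth root rounded up, so `n ≤ r ^ 5 = k * h`. Hence `k = r²` ratios `1 + h/n`
      -- multiply to at least 2, and `h = r³` of them to at least `2 ^ r`.
      r₀ r k h : ℕ
      r₀ = proj₁ (fifth-root n)
      r = suc r₀
      k = r * r
      h = k * r

      n≤r⁵ : n ≤ r ^ 5
      n≤r⁵ = proj₁ (proj₂ (fifth-root n))

      R<r : R < r
      R<r = ≰⇒> λ le → <⇒≱ (≤-trans (m≤m+n (suc (R ^ 5)) e) big) (≤-trans n≤r⁵ (^-monoˡ-≤ 5 le))

      R₁≤r : R₁ ≤ r
      R₁≤r = ≤-trans (≤-trans (m≤m+n R₁ w) (≤-trans (m≤m+n (R₁ + w) 8) (m≤m+n (R₁ + w + 8) d))) (<⇒≤ R<r)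

      w≤r : w ≤ r
      w≤r = ≤-trans (≤-trans (m≤n+m w R₁) (≤-trans (m≤m+n (R₁ + w) 8) (m≤m+n (R₁ + w + 8) d))) (<⇒≤ R<r)

      8≤r : 8 ≤ r
      8≤r = ≤-trans (≤-trans (m≤n+m 8 (R₁ + w)) (m≤m+n (R₁ + w + 8) d)) (<⇒≤ R<r)

      d≤r : d ≤ r
      d≤r = ≤-trans (m≤n+m d (R₁ + w + 8)) (<⇒≤ R<r)

      r⁵≤32n : r ^ 5 ≤ 32 * n
      r⁵≤32n = begin
        r ^ 5 ≤⟨ ^-monoˡ-≤ 5 r≤2r₀ ⟩
        (2 * r₀) ^ 5 ≡⟨ ^-distrib-* 2 r₀ 5 ⟩
        32 * r₀ ^ 5 ≤⟨ *-monoʳ-≤ 32 (proj₂ (proj₂ (fifth-root n))) ⟩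
        32 * n ∎
        where
        open ≤-Reasoning
        r≤2r₀ : r ≤ 2 * r₀
        r≤2r₀ = ≤-trans (+-monoˡ-≤ r₀ (≤-trans (s≤s z≤n) (s≤s⁻¹ 8≤r))) (≤-reflexive (cong (λ z → r₀ + z) (sym (+-identityʳ r₀))))

      r⁵≡ : r ^ 5 ≡ k * h
      r⁵≡ = regroup r
        where
        regroup : ∀ r → r * (r * (r * (r * (r * 1)))) ≡ (r * r) * ((r * r) * r)
        regroup = solve-∀

      open Compare e n e≤n hiding (d; T)

      D : ℕ
      D = (h + h) + (h + h) + d

      h-nonZero : NonZero (k * r)
      h-nonZero = *-nonZero {k} {r} (*-nonZero {r} {r} _ _) _

      h+h≤n : h + h ≤ n
      h+h≤n = *-cancelˡ-≤ 32 (begin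
        32 * (h + h) ≡⟨ regroup h ⟩
        -- The summand 8 in `R` provides `k = r² ≥ 64`.
        8 * 8 * h ≤⟨ *-monoˡ-≤ h (*-mono-≤ 8≤r 8≤r) ⟩
        k * h ≡⟨ sym r⁵≡ ⟩
        r ^ 5 ≤⟨ r⁵≤32n ⟩
        32 * n ∎)
        where
        open ≤-Reasoning
        regroup : ∀ h → 32 * (h + h) ≡ 8 * 8 * h
        regroup = solve-∀

      D≤5h : D ≤ 5 * h
      D≤5h = begin
        (h + h) + (h + h) + d ≤⟨ +-monoʳ-≤ ((h + h) + (h + h)) (≤-trans d≤r (m≤n*m r k {{*-nonZero {r} {r} _ _}})) ⟩
        (h + h) + (h + h) + h ≡⟨ regroup h ⟩
        5 * h ∎
        where
        open ≤-Reasoning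
        regroup : ∀ h → (h + h) + (h + h) + h ≡ 5 * h
        regroup = solve-∀

      M₀ : ℕ
      M₀ = 2 * n + e + 1

      small : D * d * (D * D) * ((2 * q + 1) * (2 * q + 1)) ≤ M₀ * M₀
      small = *-cancelˡ-≤ (16 * 16) (begin
        16 * 16 * (D * d * (D * D) * Q²) ≡⟨ cong (λ z → 16 * 16 * z) (regroup D d Q²) ⟩
        16 * 16 * (D * D * D * v)
          ≤⟨ *-monoʳ-≤ (16 * 16) (*-monoˡ-≤ v (*-mono-≤ (*-mono-≤ D≤5h D≤5h) D≤5h)) ⟩
        16 * 16 * (5 * h * (5 * h) * (5 * h) * v) ≡⟨ regroup′ 16 5 h v ⟩
        h * h * h * w ≤⟨ *-monoʳ-≤ (h * h * h) w≤r ⟩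
        h * h * h * r ≡⟨ regroup″ r ⟩
        k * h * (k * h) ≡⟨ cong (λ z → z * z) (sym r⁵≡) ⟩
        r ^ 5 * r ^ 5 ≤⟨ *-mono-≤ r⁵≤32n r⁵≤32n ⟩
        32 * n * (32 * n) ≡⟨ cong (λ z → z * z) (*-assoc 16 2 n) ⟩
        16 * (2 * n) * (16 * (2 * n)) ≡⟨ pull 16 (2 * n) ⟩
        16 * 16 * (2 * n * (2 * n)) ≤⟨ *-monoʳ-≤ (16 * 16) (*-mono-≤ 2n≤M₀ 2n≤M₀) ⟩
        16 * 16 * (M₀ * M₀) ∎)
        where
        open ≤-Reasoning
        Q² : ℕ
        Q² = (2 * q + 1) * (2 * q + 1)
        2n≤M₀ : 2 * n ≤ M₀
        2n≤M₀ = ≤-trans (m≤m+n (2 * n) e) (m≤m+n (2 * n + e) 1)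
        regroup : ∀ D d s → D * d * (D * D) * s ≡ D * D * D * (d * s)
        regroup = solve-∀
        regroup′ : ∀ s t h v → s * s * (t * h * (t * h) * (t * h) * v) ≡ h * h * h * (s * s * (t * t * t * v))
        regroup′ = solve-∀
        regroup″ : ∀ r → r * r * r * (r * r * r) * (r * r * r) * r ≡ r * r * (r * r * r) * (r * r * (r * r * r))
        regroup″ = solve-∀
        pull : ∀ s m → s * m * (s * m) ≡ s * s * (m * m)
        pull = solve-∀

      D²≤ : D * D ≤ M₀ * M₀
      D²≤ = ≤-trans (≤-trans (m≤n*m (D * D) (D * d) {{D*d}}) (m≤m*n _ ((2 * q + 1) * (2 * q + 1)) {{Q²}})) small
        where
        D*d : NonZero (D * d)
        D*d = *-nonZero (>-nonZero (≤-trans (s≤s z≤n) (m≤n+m d ((h + h) + (h + h))))) _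
        Q²′ : NonZero (2 * q + 1)
        Q²′ = >-nonZero (m≤n+m 1 (2 * q))
        Q² : NonZero ((2 * q + 1) * (2 * q + 1))
        Q² = *-nonZero Q²′ Q²′

      exponential : 2 * q * (suc S ^ d * W) ≤ 2 ^ r
      exponential = begin
        2 * q * (suc S ^ d * W)
          ≤⟨ *-monoʳ-≤ (2 * q) (*-mono-≤ (^-monoˡ-≤ d sS≤Z)
               (*-monoˡ-≤ (2 ^ T * 2 ^ T) (*-monoʳ-≤ 2 (*-mono-≤ (^-monoˡ-≤ T S≤Z) (^-monoˡ-≤ T S≤Z))))) ⟩
        2 * q * (Z ^ d * (2 * (Z ^ T * Z ^ T) * (2 ^ T * 2 ^ T)))
          ≡⟨ cong₂ (λ x y → 2 * q * (x * (2 * (y * y) * (2 ^ T * 2 ^ T)))) (^-distrib-* c (r ^ 5) d) (^-distrib-* c (r ^ 5) T) ⟩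
        2 * q * (c ^ d * u ^ d * (2 * (c ^ T * u ^ T * (c ^ T * u ^ T)) * (2 ^ T * 2 ^ T)))
          ≡⟨ regroup (2 * q) (c ^ d) (u ^ d) (c ^ T) (u ^ T) (2 ^ T * 2 ^ T) ⟩
        C * (u ^ d * (u ^ T * u ^ T))
          ≡⟨ cong (C *_) (trans (cong (u ^ d *_) (sym (^-distribˡ-+-* u T T))) (sym (^-distribˡ-+-* u d (T + T)))) ⟩
        C * u ^ E ≡⟨ cong (C *_) (^-*-assoc r 5 E) ⟩
        C * r ^ (5 * E) ≤⟨ proj₂ (exp-beats-poly (5 * E) C) r R₁≤r ⟩
        2 ^ r ∎
        where
        open ≤-Reasoning
        u Z : ℕ
        u = r ^ 5
        Z = c * u
        expand : ∀ d T u → d * u + T * u + u ≡ (d + T + 1) * u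
        expand = solve-∀
        sS≤Z : suc S ≤ Z
        sS≤Z = begin
          suc (d * n + T) ≡⟨ +-comm 1 (d * n + T) ⟩
          d * n + T + 1 ≤⟨ +-mono-≤ (+-mono-≤ (*-monoʳ-≤ d n≤r⁵) (m≤m*n T u {{m^n≢0 r 5}})) (m^n>0 r 5) ⟩
          d * u + T * u + u ≡⟨ expand d T u ⟩
          Z ∎
        S≤Z : S ≤ Z
        S≤Z = ≤-trans (n≤1+n S) sS≤Z
        regroup : ∀ q a b x y t → q * (a * b * (2 * (x * y * (x * y)) * t)) ≡ q * (a * (2 * (x * x) * t)) * (b * (y * y))
        regroup = solve-∀

      open Bulk q h h+h≤n D refl small D²≤
      open Close q k r {{h-nonZero}} (≤-trans n≤r⁵ (≤-reflexive r⁵≡)) bulk exponential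

      numAvoid≡A : numAvoid d (d * n) ≡ A
      numAvoid≡A = numAvoid-∑ d (d * n)

      numInv≡B : numInv d (2 * n) (2 * d * n) ≡ B
      numInv≡B = begin
        numInv d (2 * n) (2 * d * n) ≡⟨ cong (numInv d (2 * n)) (commute d n) ⟩
        numInv d (2 * n) (d * (2 * n)) ≡⟨ Extremal.numInv-mult e (2 * n) (>-nonZero⁻¹ (2 * n) {{m*n≢0 2 n}}) ⟩
        mult (L d (d * (2 * n))) (lst d (λ _ → 2 * n)) ≡⟨ cong (λ z → mult (L d z) (lst d (λ _ → 2 * n))) (double d n) ⟩
        mult (L d (N + N)) (lst d (λ _ → 2 * n)) ≡⟨ Complement.mult-target e (2 * n) N N ⟩
        B ∎
        where
        open ≡-Reasoning
        commute : ∀ d n → 2 * d * n ≡ d * (2 * n)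
        commute = solve-∀
        double : ∀ d n → d * (2 * n) ≡ d * n + d * n
        double = solve-∀

    result : (0 < numInv d (2 * n) (2 * d * n)) ×
      (q * ∣ numAvoid d (d * n) - numInv d (2 * n) (2 * d * n) ∣ ≤ numInv d (2 * n) (2 * d * n))
    result = subst (0 <_) (sym numInv≡B) positive ,
      subst₂ (λ x y → q * ∣ x - y ∣ ≤ y) (sym numAvoid≡A) (sym numInv≡B) close

theorem3 : (d : ℕ) → 2 ≤ d →
    (p q : ℕ) → 0 < p → 0 < q →
    ∃ λ (N : ℕ) → (n : ℕ) → N ≤ n →
    (0 < numInv d (2 * n) (2 * d * n))
    × (q * ∣ numAvoid d (d * n) - numInv d (2 * n) (2 * d * n) ∣
    ≤ p * numInv d (2 * n) (2 * d * n))
-- The tolerance is `p / q`; the bound is proved for `1 / q`, and a positive `p` only enlarges the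
-- right-hand side.
theorem3 (suc e) _ (suc p) q _ _ = Threshold.threshold e q , λ n big →
  let (pos , le) = Threshold.Above.result e q n big
  in pos , ≤-trans le (m≤m+n _ (p * numInv (suc e) (2 * n) (2 * suc e * n)))
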